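{- Let $k\ge 3$, $g\ge 5$ and $s\le (k-2)g$ be integers and let $G$ be a nontrivial $(k,g,s)$-multipole. Then $$|G|\ \ge\ b_2(k,g,s)\ \ge\ \tfrac12 M(k,g).$$
   Context: A multipole is a finite graph in which, besides links (edges joining two distinct vertices), there may be semiedges (edges incident with only one vertex); $|G|$ is its number of vertices. Degree counts links and semiedges; $k$-regular means all degrees equal $k$. Girth is the length of a shortest cycle (of links), $\infty$ if acyclic. A $(k,g,s)$-multipole is a $k$-regular multipole of girth at least $g$ with exactly $s$ semiedges; with $s\le(k-2)g$ it is nontrivial if it contains a cycle and is not a $g$-cycle (a cycle of length $g$ with $k-2$ semiedges at each vertex). Moore bound: $M(k,2d+1)=\frac{k(k-1)^d-2}{k-2}$, $M(k,2d+2)=\frac{2(k-1)^{d+1}-2}{k-2}$. For $g=2d+1$ define $P_{k,g,s}(n)=n^2-M(k,g)n+\frac{s(dk-2d-1)(k-1)^d+s}{(k-2)^2}$; for $g=2d+2$ define $P_{k,g,s}(n)=kn^2-(kM+s)n+Ms+2s\cdot\frac{(dk-2d-1)(k-1)^{d+1}+k-1}{(k-2)^2}$ with $M=M(k,g)$. Let $v(k,g,s)=\frac12M(k,g)$ for odd $g$ and $\frac12M(k,g)+\frac{s}{2k}$ for even $g$. If $P_{k,g,s}$ has real roots, $b_1(k,g,s)\le b_2(k,g,s)$ denote them; otherwise $b_1=b_2=v(k,g,s)$. -}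

module Defs where

open import Data.Nat as ℕ using (ℕ; zero; suc; _∸_; _%_)
import Data.Nat.DivMod
open import Data.Integer as ℤ using (ℤ; +_)
open import Data.Rational as ℚ using (ℚ)
open import Data.Fin using (Fin; zero; suc; toℕ; fromℕ<)
open import Data.Bool using (Bool; true; false; if_then_else_)
open import Data.List using (List; map; allFin)
open import Data.Nat.ListAction using (sum)
open import Data.Product using (Σ; _×_; Σ-syntax)
open import Data.Sum using (_⊎_)
open import Relation.Binary.PropositionalEquality using (_≡_)
open import Relation.Nullary using (¬_; yes; no)
open import Function.Definitions using (Injective)

-- Multipoles
-- Links are given by a symmetric irreflexive adjacency relation on the
-- vertex set Fin n; sem v is the number of semiedges at vertex v.

record Multipole (n : ℕ) : Set where
  field
    adj    : Fin n → Fin n → Bool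
    adj-sym : ∀ u v → adj u v ≡ adj v u
    adj-irr : ∀ v → adj v v ≡ false
    sem    : Fin n → ℕ

open Multipole public

order : ∀ {n} → Multipole n → ℕ
order {n} _ = n

degree : ∀ {n} → Multipole n → Fin n → ℕ
degree {n} G v = sum (map (λ w → if adj G v w then 1 else 0) (allFin n)) ℕ.+ sem G v

Regular : ∀ {n} → ℕ → Multipole n → Set
Regular k G = ∀ v → degree G v ≡ k

semiedges : ∀ {n} → Multipole n → ℕ
semiedges {n} G = sum (map (sem G) (allFin n))

cnext : ∀ {ℓ} → Fin ℓ → Fin ℓ
cnext {suc m} i with suc (toℕ i) ℕ.<? suc m
... | yes p = fromℕ< p
... | no _  = zero

Cycle : ∀ {n} → Multipole n → ℕ → Set
Cycle {n} G ℓ =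
  3 ℕ.≤ ℓ × Σ[ f ∈ (Fin ℓ → Fin n) ]
    (Injective _≡_ _≡_ f × (∀ i → adj G (f i) (f (cnext i)) ≡ true))

HasCycle : ∀ {n} → Multipole n → Set
HasCycle G = Σ[ ℓ ∈ ℕ ] Cycle G ℓ

GirthAtLeast : ∀ {n} → ℕ → Multipole n → Set
GirthAtLeast g G = ∀ ℓ → ℓ ℕ.< g → ¬ Cycle G ℓ

IsMultipole : ∀ {n} → ℕ → ℕ → ℕ → Multipole n → Set
IsMultipole k g s G = Regular k G × GirthAtLeast g G × semiedges G ≡ s

IsGCycle : ∀ {n} → ℕ → ℕ → Multipole n → Set
IsGCycle {n} k g G =
  n ≡ g × Σ[ f ∈ (Fin g → Fin n) ]
    ( Injective _≡_ _≡_ f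
    × (∀ i → adj G (f i) (f (cnext i)) ≡ true)
    × (∀ i j → adj G (f i) (f j) ≡ true → (j ≡ cnext i) ⊎ (i ≡ cnext j))
    × (∀ v → sem G v ≡ k ∸ 2))

Nontrivial : ∀ {n} → ℕ → ℕ → Multipole n → Set
Nontrivial k g G = HasCycle G × ¬ IsGCycle k g G

-- Arithmetic (rationals). frac a b = a / b, with a junk value 0 for b = 0
-- (never used: all denominators are positive for k ≥ 3).

frac : ℤ → ℕ → ℚ
frac a zero    = ℚ.0ℚ
frac a (suc b) = a ℚ./ suc b

zq : ℕ → ℤ
zq = +_

nq : ℕ → ℚ
nq n = frac (+ n) 1

-- g = 2d+1 (odd) or g = 2d+2 (even)
odd? : ℕ → Bool
odd? g with g % 2
... | 0 = false
... | _ = true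

dOf : ℕ → ℕ
dOf g = if odd? g then (g ∸ 1) Data.Nat.DivMod./ 2 else (g ∸ 2) Data.Nat.DivMod./ 2

moore : ℕ → ℕ → ℚ
moore k g =
  if odd? g
  then frac (zq k ℤ.* zq (k ∸ 1) ℤ.^ d ℤ.- zq 2) (k ∸ 2)
  else frac (zq 2 ℤ.* zq (k ∸ 1) ℤ.^ (suc d) ℤ.- zq 2) (k ∸ 2)
  where d = dOf g

coefA : ℕ → ℕ → ℕ → ℚ
coefA k g s = if odd? g then nq 1 else nq k

coefB : ℕ → ℕ → ℕ → ℚ
coefB k g s =
  if odd? g then ℚ.- moore k g else ℚ.- (nq k ℚ.* moore k g ℚ.+ nq s)

coefC : ℕ → ℕ → ℕ → ℚ
coefC k g s =
  if odd? g
  then frac (zq s ℤ.* (zq d ℤ.* zq k ℤ.- zq 2 ℤ.* zq d ℤ.- zq 1) ℤ.* zq (k ∸ 1) ℤ.^ d ℤ.+ zq s)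
            ((k ∸ 2) ℕ.* (k ∸ 2))
  else moore k g ℚ.* nq s ℚ.+
       nq (2 ℕ.* s) ℚ.*
         frac ((zq d ℤ.* zq k ℤ.- zq 2 ℤ.* zq d ℤ.- zq 1) ℤ.* zq (k ∸ 1) ℤ.^ (suc d) ℤ.+ zq (k ∸ 1))
              ((k ∸ 2) ℕ.* (k ∸ 2))
  where d = dOf g

P : ℕ → ℕ → ℕ → ℚ → ℚ
P k g s x = coefA k g s ℚ.* x ℚ.* x ℚ.+ coefB k g s ℚ.* x ℚ.+ coefC k g s

vertexV : ℕ → ℕ → ℕ → ℚ
vertexV k g s =
  if odd? g then moore k g ℚ.* frac (+ 1) 2
  else moore k g ℚ.* frac (+ 1) 2 ℚ.+ frac (+ s) (2 ℕ.* k)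

disc : ℕ → ℕ → ℕ → ℚ
disc k g s = coefB k g s ℚ.* coefB k g s ℚ.- nq 4 ℚ.* coefA k g s ℚ.* coefC k g s

-- b₂ is (-B + √D)/(2A) if D ≥ 0, else v.  Since A > 0, comparisons of a
-- rational x with b₂ unfold (with t = 2Ax + B) to:
--   b₂ ≤ x  iff  t ≥ 0 and t² ≥ D      (case D ≥ 0)
--   x ≤ b₂  iff  t ≤ 0 or  t² ≤ D      (case D ≥ 0)
lin : ℕ → ℕ → ℕ → ℚ → ℚ
lin k g s x = nq 2 ℚ.* coefA k g s ℚ.* x ℚ.+ coefB k g s

b₂≤ : ℕ → ℕ → ℕ → ℚ → Set
b₂≤ k g s x =
  (ℚ.0ℚ ℚ.≤ disc k g s × ℚ.0ℚ ℚ.≤ lin k g s x × disc k g s ℚ.≤ lin k g s x ℚ.* lin k g s x)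
  ⊎ (disc k g s ℚ.< ℚ.0ℚ × vertexV k g s ℚ.≤ x)

≤b₂ : ℕ → ℕ → ℕ → ℚ → Set
≤b₂ k g s x =
  (ℚ.0ℚ ℚ.≤ disc k g s × (lin k g s x ℚ.≤ ℚ.0ℚ ⊎ lin k g s x ℚ.* lin k g s x ℚ.≤ disc k g s))
  ⊎ (disc k g s ℚ.< ℚ.0ℚ × x ℚ.≤ vertexV k g s)

halfMoore : ℕ → ℕ → ℚ
halfMoore k g = moore k g ℚ.* frac (+ 1) 2

-- In girth g the non-backtracking (NB) walks of length at most d from a vertex (for g = 2d + 2: from a
-- link) have distinct end vertices. Their number is the Moore bound minus a loss caused by the semiedges,
-- and averaging over all vertices (links) gives P(n) ≥ 0 for n = |G|. So it remains to show that n is not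
-- on the left of the vertex of the parabola P.
--
-- Let U be a minimal set of more than g vertices that at most (k - 2) g half-edges leave. If Y is a part of
-- U whose complement in U has more than g vertices, then by minimality more than (k - 2) g half-edges leave
-- this complement, so at least half of the half-edges leaving Y are links inside U. Apply this to the balls
-- Y around a shortest cycle of U, of length ℓ ≥ g: up to radius about ℓ / 4 they are unicyclic, so exactly
-- (k - 2)|Y| half-edges leave Y and each ball is at least k/2 times as large as the previous one. The
-- complement cannot become small too early, because a set of fewer than g vertices is a forest and walks
-- leaving the cycle and returning to it are long. The resulting bound n ≥ N satisfies P(N) < 0 (or N is
-- already beyond the vertex), hence P(n) ≥ 0 places n beyond the vertex. The pairs (3, 6), (3, 7), (3, 8),
-- (4, 5) and (4, 6) for (k, g) leave almost no slack; (3, 8) and (4, 6) use that three walks from a vertex to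
-- a shortest cycle, with different first links, have total length at least ℓ.
module Submission where

-- P(n) ≥ 0 alone does not place n: it holds for g-cycles too, for instance P(7) = 14 for k = 3, g =
-- 7, s = 7, where the vertex is 11 and the larger root exceeds 12. Nontriviality has to enter
-- through a separate lower bound. A ball around a vertex gives none, because semiedges may be
-- concentrated near it and stop its growth. The right comparison is with the g-cycle, from which
-- exactly (k - 2) g half-edges leave: G itself has more than g vertices and at most that many
-- semiedges, and in a smallest set of this kind the half-edges leaving a ball cannot be mostly
-- lost. With κ = k - 2 and `arcs` counting each link inside a set twice, (2 + κ)|U| - `arcs`
-- half-edges leave U. The estimates are made in natural numbers, with M and the constant term of P
-- expressed by the sums `geo` and `wgeo`; rationals appear only in the final comparison with the
-- roots. Since b₂ is the larger root or the vertex v, P(n) ≥ 0 and n ≥ v give n ≥ b₂, while b₂ ≥ v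
-- ≥ M/2 holds for all parameters.

open import Defs
import Algebra.Properties.Group
open import Data.Bool using (Bool; true; false; if_then_else_; _∧_; _∨_; not)
open import Data.Empty using (⊥; ⊥-elim)
open import Data.Fin using (Fin; zero; suc; toℕ; fromℕ<)
open import Data.Fin.Properties using (_≟_; toℕ-injective; toℕ<n; toℕ-fromℕ<)
open import Data.Integer as ℤ using (ℤ)
import Data.Integer.Properties as ℤP
import Data.Integer.Tactic.RingSolver as ℤSolver
open import Data.List using (List; []; _∷_; _++_; _ʳ++_; map; allFin; tabulate; length; lookup; reverse)
open import Data.List.Membership.Propositional using (_∈_; _∉_)
open import Data.List.Membership.Propositional.Properties using (∈-∃++; ∈-++⁺ˡ; ∈-++⁺ʳ; ∈-++⁻; ∈-lookup)
import Data.List.Membership.DecPropositional as DecMembership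
open import Data.List.Properties using (map-tabulate; ++-identityʳ; length-++; length-ʳ++; ʳ++-defn)
open import Data.List.Relation.Unary.Any using (here; there)
open import Data.List.Relation.Unary.Any.Properties using (reverse⁺; reverse⁻)
open import Data.List.Relation.Unary.Unique.Propositional using (Unique)
open import Data.Nat hiding (_/_; _%_; parity) renaming (_≟_ to _≟ⁿ_)
import Data.Nat.DivMod as ℕDiv
open import Data.Nat.Induction using (<-rec)
open import Data.Nat.ListAction using (sum)
open import Data.Nat.Properties hiding (_≟_)
open import Data.Nat.Tactic.RingSolver using (solve; solve-∀)
open import Data.Product using (Σ; ∃; _×_; _,_; proj₁; proj₂)
open import Data.Rational as ℚ using (ℚ; fromℚᵘ)
import Data.Rational.Properties as ℚP
open import Data.Rational.Unnormalised as ℚᵘ using (mkℚᵘ; *≡*; *≤*)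
import Data.Rational.Unnormalised.Properties as ℚᵘP
open import Data.Sum using (_⊎_; inj₁; inj₂; [_,_]′)
open import Function using (_∘_; id)
open import Function.Definitions using (Injective)
open import Relation.Binary.PropositionalEquality
open import Relation.Nullary using (¬_; Dec; yes; no; does; contradiction)
open import Relation.Nullary.Decidable using (dec-true; dec-false; toWitness; _×-dec_; _⊎-dec_)
import Algebra.Properties.Semiring.Sum +-*-semiring as Sum

-- Natural-number arithmetic, indicators, finite sums and lists without repetition

-- A nonnegative combination L ≤ R of hypotheses, built with _⊕_ and _⊗_, reduces a goal to an
-- identity for the semiring solver (c is the slack).
linarith : ∀ {L R x y} c → L ≤ R → x + R + c ≡ y + L → x ≤ y
linarith {L} {R} {x} {y} c h e = +-cancelʳ-≤ L x y (begin
  x + L      ≤⟨ +-monoʳ-≤ x h ⟩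
  x + R      ≤⟨ m≤m+n (x + R) c ⟩
  x + R + c  ≡⟨ e ⟩
  y + L      ∎)
  where open ≤-Reasoning

infixr 6 _⊕_
infixr 7 _⊗_

_⊕_ : ∀ {a b c d} → a ≤ b → c ≤ d → a + c ≤ b + d
_⊕_ = +-mono-≤

_⊗_ : ∀ c {a b} → a ≤ b → c * a ≤ c * b
c ⊗ h = *-monoʳ-≤ c h

impossible : ∀ {a} {A : Set a} {L R} c → L ≤ R → L ≡ R + suc c → A
impossible {R = R} c h refl = ⊥-elim (m+1+n≰m R h)

1≤⁻* : ∀ {m n} → 1 ≤ m * n → 1 ≤ m × 1 ≤ n
1≤⁻* {zero} ()
1≤⁻* {suc m} {zero} h rewrite *-zeroʳ m = contradiction h λ ()
1≤⁻* {suc m} {suc n} h = s≤s z≤n , s≤s z≤n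

1≤⁻+ : ∀ {m n} → 1 ≤ m + n → 1 ≤ m ⊎ 1 ≤ n
1≤⁻+ {zero} h = inj₂ h
1≤⁻+ {suc m} h = inj₁ (s≤s z≤n)

¬1≤⇒≡0 : ∀ {m} → ¬ (1 ≤ m) → m ≡ 0
¬1≤⇒≡0 {zero} _ = refl
¬1≤⇒≡0 {suc m} h = contradiction (s≤s z≤n) h

𝟙 : Bool → ℕ
𝟙 b = if b then 1 else 0

𝟙≤1 : ∀ b → 𝟙 b ≤ 1
𝟙≤1 true = ≤-refl
𝟙≤1 false = z≤n

1≤𝟙⁻ : ∀ {b} → 1 ≤ 𝟙 b → b ≡ true
1≤𝟙⁻ {true} _ = refl

1≤𝟙 : ∀ {b} → b ≡ true → 1 ≤ 𝟙 b
1≤𝟙 refl = ≤-refl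

𝟙*≤ : ∀ b m → 𝟙 b * m ≤ m
𝟙*≤ true m = ≤-reflexive (*-identityˡ m)
𝟙*≤ false m = z≤n

𝟙*-cong : ∀ b {x y} → (b ≡ true → x ≡ y) → 𝟙 b * x ≡ 𝟙 b * y
𝟙*-cong true h = cong (1 *_) (h refl)
𝟙*-cong false h = refl

𝟙*-mono : ∀ b {x y} → (b ≡ true → x ≤ y) → 𝟙 b * x ≤ 𝟙 b * y
𝟙*-mono true h = 1 ⊗ h refl
𝟙*-mono false h = z≤n

∧-true : ∀ {a b} → a ∧ b ≡ true → a ≡ true × b ≡ true
∧-true {true} {true} refl = refl , refl

δ : ∀ {n} → Fin n → Fin n → ℕ
δ i j = 𝟙 (does (i ≟ j))

δ-refl : ∀ {n} (i : Fin n) → δ i i ≡ 1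
δ-refl i = cong 𝟙 (dec-true (i ≟ i) refl)

δ-≢ : ∀ {n} {i j : Fin n} → i ≢ j → δ i j ≡ 0
δ-≢ {i = i} {j} h = cong 𝟙 (dec-false (i ≟ j) h)

1≤δ⁻ : ∀ {n} {i j : Fin n} → 1 ≤ δ i j → i ≡ j
1≤δ⁻ {i = i} {j} h with i ≟ j
... | yes p = p

δ-sym : ∀ {n} (i j : Fin n) → δ i j ≡ δ j i
δ-sym i j with i ≟ j
... | yes refl = sym (δ-refl i)
... | no p = sym (δ-≢ (p ∘ sym))

-- Opaque, so that unification can recover the summand from a sum.
opaque
  ∑ : ∀ {n} → (Fin n → ℕ) → ℕ
  ∑ = Sum.sum

  ∑-cong : ∀ {n} {f g : Fin n → ℕ} → (∀ i → f i ≡ g i) → ∑ f ≡ ∑ g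
  ∑-cong = Sum.sum-cong-≗

  ∑-+ : ∀ {n} (f g : Fin n → ℕ) → ∑ (λ i → f i + g i) ≡ ∑ f + ∑ g
  ∑-+ = Sum.∑-distrib-+

  ∑-swap : ∀ {m n} (f : Fin m → Fin n → ℕ) → ∑ (λ i → ∑ λ j → f i j) ≡ ∑ λ j → ∑ λ i → f i j
  ∑-swap = Sum.∑-comm

  ∑-*ˡ : ∀ {n} c (f : Fin n → ℕ) → ∑ (λ i → c * f i) ≡ c * ∑ f
  ∑-*ˡ c f = sym (Sum.*-distribˡ-sum c f)

  ∑-mono : ∀ {n} {f g : Fin n → ℕ} → (∀ i → f i ≤ g i) → ∑ f ≤ ∑ g
  ∑-mono {zero} h = z≤n
  ∑-mono {suc n} h = +-mono-≤ (h zero) (∑-mono (h ∘ suc))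

  ∑-const : ∀ n c → ∑ {n} (λ _ → c) ≡ n * c
  ∑-const zero c = refl
  ∑-const (suc n) c = cong (c +_) (∑-const n c)

  ∑-zero : ∀ {n} {f : Fin n → ℕ} → (∀ i → f i ≡ 0) → ∑ f ≡ 0
  ∑-zero {n} h = trans (∑-cong h) (trans (∑-const n 0) (*-zeroʳ n))

  term≤∑ : ∀ {n} (f : Fin n → ℕ) i → f i ≤ ∑ f
  term≤∑ f zero = m≤m+n (f zero) _
  term≤∑ f (suc i) = ≤-trans (term≤∑ (f ∘ suc) i) (m≤n+m _ (f zero))

  1≤∑⁻ : ∀ {n} {f : Fin n → ℕ} → 1 ≤ ∑ f → ∃ λ i → 1 ≤ f i
  1≤∑⁻ {suc n} {f} h with 1≤⁻+ {f zero} h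
  ... | inj₁ p = zero , p
  ... | inj₂ p = let i , q = 1≤∑⁻ p in suc i , q

  ∑≤1 : ∀ {n} {f : Fin n → ℕ} → (∀ i → f i ≤ 1) → (∀ i j → 1 ≤ f i → 1 ≤ f j → i ≡ j) → ∑ f ≤ 1
  ∑≤1 {zero} h u = z≤n
  ∑≤1 {suc n} {f} h u with 1 ≤? f zero
  ... | yes p = ≤-trans (≤-reflexive (trans (cong (f zero +_) (∑-zero rest)) (+-identityʳ _))) (h zero)
    where
    rest : ∀ i → f (suc i) ≡ 0
    rest i = ¬1≤⇒≡0 λ q → contradiction (u zero (suc i) p q) λ ()
  ... | no p rewrite ¬1≤⇒≡0 p =
    ∑≤1 (h ∘ suc) λ i j a b → Data.Fin.Properties.suc-injective (u (suc i) (suc j) a b)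

  ∑-δ : ∀ {n} i (f : Fin n → ℕ) → ∑ (λ j → δ i j * f j) ≡ f i
  ∑-δ {suc n} zero f = trans (cong₂ _+_ (*-identityˡ (f zero)) (∑-zero {n} {λ _ → 0} λ _ → refl)) (+-identityʳ _)
  ∑-δ (suc i) f = ∑-δ i (f ∘ suc)

  sum≡∑ : ∀ {n} (f : Fin n → ℕ) → sum (map f (allFin n)) ≡ ∑ f
  sum≡∑ f = trans (cong sum (map-tabulate id f)) (go f)
    where
    go : ∀ {n} (f : Fin n → ℕ) → sum (tabulate f) ≡ ∑ f
    go {zero} f = refl
    go {suc n} f = cong (f zero +_) (go (f ∘ suc))

module UniqueLists where

  open import Data.List.Relation.Unary.All using (All; []; _∷_)
  open import Data.List.Relation.Unary.All.Properties using (¬Any⇒All¬; All¬⇒¬Any)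
  open import Data.List.Relation.Unary.AllPairs using ([]; _∷_)

  unique-++ : ∀ {A : Set} (xs : List A) {ys} → Unique (xs ++ ys) →
    Unique xs × (∀ {v} → v ∈ xs → v ∉ ys)
  unique-++ [] u = [] , λ ()
  unique-++ {A} (x ∷ xs) {ys} (p ∷ u) = let ux , dis = unique-++ xs u in
    allˡ xs p ∷ ux , λ { (here refl) v∈ys → All¬⇒¬Any p (∈-++⁺ʳ xs v∈ys) ; (there v∈xs) → dis v∈xs }
    where
    allˡ : ∀ (zs : List A) → All (x ≢_) (zs ++ ys) → All (x ≢_) zs
    allˡ [] _ = []
    allˡ (z ∷ zs) (q ∷ qs) = q ∷ allˡ zs qs

  unique-ʳ++ : ∀ {A : Set} (xs : List A) {ys v} → Unique (xs ʳ++ ys) → v ∈ xs → v ∉ ys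
  unique-ʳ++ xs {ys} u v∈xs = proj₂ (unique-++ (reverse xs) (subst Unique (ʳ++-defn xs) u)) (reverse⁺ v∈xs)

  ∈-ʳ++⁻ : ∀ {A : Set} (xs : List A) {ys v} → v ∈ xs ʳ++ ys → v ∈ xs ⊎ v ∈ ys
  ∈-ʳ++⁻ xs {ys} h with ∈-++⁻ (reverse xs) (subst (_ ∈_) (ʳ++-defn xs) h)
  ... | inj₁ p = inj₁ (reverse⁻ p)
  ... | inj₂ p = inj₂ p

  lookup-injective : ∀ {A : Set} {xs : List A} → Unique xs → Injective _≡_ _≡_ (lookup xs)
  lookup-injective (p ∷ u) {zero} {zero} e = refl
  lookup-injective {xs = x ∷ xs} (p ∷ u) {zero} {suc j} e =
    contradiction (subst (_∈ xs) (sym e) (∈-lookup j)) (All¬⇒¬Any p)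
  lookup-injective {xs = x ∷ xs} (p ∷ u) {suc i} {zero} e =
    contradiction (subst (_∈ xs) e (∈-lookup i)) (All¬⇒¬Any p)
  lookup-injective (p ∷ u) {suc i} {suc j} e = cong suc (lookup-injective u e)

  unique-[_] : ∀ {A : Set} (x : A) → Unique (x ∷ [])
  unique-[ x ] = [] ∷ []

  unique-∷ : ∀ {A : Set} {x : A} {xs} → x ∉ xs → Unique xs → Unique (x ∷ xs)
  unique-∷ x∉ u = ¬Any⇒All¬ _ x∉ ∷ u

  unique-head : ∀ {A : Set} {x : A} {xs} → Unique (x ∷ xs) → x ∉ xs
  unique-head (p ∷ _) = All¬⇒¬Any p

  unique-tail : ∀ {A : Set} {x : A} {xs} → Unique (x ∷ xs) → Unique xs
  unique-tail (_ ∷ u) = u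

open UniqueLists public

-- Non-backtracking walks and cycles

cnext-cases : ∀ {m} (i : Fin (suc m)) →
  (Σ (suc (toℕ i) < suc m) λ p → cnext i ≡ fromℕ< p) ⊎ (suc (toℕ i) ≡ suc m × cnext i ≡ zero)
cnext-cases {m} i with suc (toℕ i) <? suc m
... | yes p = inj₁ (p , refl)
... | no p = inj₂ (≤-antisym (toℕ<n i) (≮⇒≥ p) , refl)

module Walks {n} (H : Multipole n) where

  Adj : Fin n → Fin n → Set
  Adj u v = adj H u v ≡ true

  Adj-sym : ∀ {u v} → Adj u v → Adj v u
  Adj-sym {u} {v} h = trans (adj-sym H v u) h

  Adj-irr : ∀ {u} → ¬ Adj u u
  Adj-irr {u} h = contradiction (trans (sym h) (adj-irr H u)) λ ()

  data NB : List (Fin n) → Set where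
    one : ∀ {x} → NB (x ∷ [])
    two : ∀ {x y} → Adj x y → NB (x ∷ y ∷ [])
    cons : ∀ {x y z l} → Adj x y → x ≢ z → NB (y ∷ z ∷ l) → NB (x ∷ y ∷ z ∷ l)

  nb-tail : ∀ {x y l} → NB (x ∷ y ∷ l) → NB (y ∷ l)
  nb-tail (two _) = one
  nb-tail (cons _ _ nb) = nb

  nb-head : ∀ {x y l} → NB (x ∷ y ∷ l) → Adj x y
  nb-head (two h) = h
  nb-head (cons h _ _) = h

  -- The walks overlap in a whole link, traversed in opposite directions, so no non-backtracking
  -- condition has to be supplied at the junction.
  nb-glue : ∀ {b c} xs {ys} → NB (b ∷ c ∷ xs) → NB (c ∷ b ∷ ys) → NB (xs ʳ++ c ∷ b ∷ ys)
  nb-glue [] _ nb = nb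
  nb-glue (x ∷ xs) (cons h ne nb₁) nb₂ =
    nb-glue xs nb₁ (cons (Adj-sym (nb-head nb₁)) (ne ∘ sym) nb₂)

  private
    adj-next : ∀ c {l} → NB (c ++ l) → ∀ (i : Fin (length c)) (p : suc (toℕ i) < length c) →
      Adj (lookup c i) (lookup c (fromℕ< p))
    adj-next (x ∷ []) nb zero (s≤s ())
    adj-next (x ∷ y ∷ c) nb zero p = nb-head nb
    adj-next (x ∷ y ∷ c) nb (suc i) p = adj-next (y ∷ c) (nb-tail nb) i (s<s⁻¹ p)

    adj-last : ∀ c {y l} → NB (c ++ y ∷ l) → ∀ (i : Fin (length c)) → suc (toℕ i) ≡ length c →
      Adj (lookup c i) y
    adj-last (x ∷ []) nb zero e = nb-head nb
    adj-last (x ∷ y ∷ c) nb zero ()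
    adj-last (x ∷ y ∷ c) nb (suc i) e = adj-last (y ∷ c) (nb-tail nb) i (suc-injective e)

    closed-length : ∀ x ys {zs} → NB (x ∷ ys ++ x ∷ zs) → 3 ≤ suc (length ys)
    closed-length x [] nb = contradiction (nb-head nb) Adj-irr
    closed-length x (y ∷ []) (cons _ ne _) = contradiction refl ne
    closed-length x (_ ∷ _ ∷ ys) _ = s≤s (s≤s (s≤s z≤n))

  closed⇒Cycle : ∀ x ys {zs} → NB (x ∷ ys ++ x ∷ zs) → Unique (x ∷ ys) → Cycle H (suc (length ys))
  closed⇒Cycle x ys nb u =
    closed-length x ys nb , lookup (x ∷ ys) , lookup-injective u , next
    where
    next : ∀ i → Adj (lookup (x ∷ ys) i) (lookup (x ∷ ys) (cnext i))
    next i with cnext-cases i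
    ... | inj₁ (p , e) rewrite e = adj-next (x ∷ ys) nb i p
    ... | inj₂ (p , e) rewrite e = adj-last (x ∷ ys) nb i p

  -- The tail is a path by induction, so only the head can repeat. The stretch up to its repetition
  -- is a cycle, and a list of at most g vertices leaves at most g - 1 of them for it.
  nb-unique : ∀ {g} → GirthAtLeast g H → ∀ {l} → NB l → length l ≤ g → Unique l
  nb-unique girth {x ∷ []} nb len = unique-[ x ]
  nb-unique {g} girth {x ∷ l@(_ ∷ _)} nb len with nb-unique girth (nb-tail nb) (≤-trans (n≤1+n _) len)
                                                | DecMembership._∈?_ _≟_ x l
  ... | u | no x∉l = unique-∷ x∉l u
  ... | u | yes x∈l with ∈-∃++ x∈l
  ... | ys , zs , e = contradiction (closed⇒Cycle x ys nb′ (unique-∷ (λ x∈ys → dis x∈ys (here refl)) uys)) (girth _ short)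
    where
    nb′ : NB (x ∷ ys ++ x ∷ zs)
    nb′ = subst (λ t → NB (x ∷ t)) e nb
    uys = proj₁ (unique-++ ys (subst Unique e u))
    dis = proj₂ (unique-++ ys (subst Unique e u))
    short : suc (length ys) < g
    short = ≤-trans (s≤s (≤-trans (≤-trans (m≤m+n (suc (length ys)) (length zs)) (≤-reflexive (sym (+-suc _ _))))
              (≤-reflexive (sym (trans (cong length e) (length-++ ys)))))) len

  nb-disjoint : ∀ {g} → GirthAtLeast g H → ∀ {b c v} xs {ys} → NB (b ∷ c ∷ xs) → NB (c ∷ b ∷ ys) →
    length xs + (2 + length ys) ≤ g → v ∈ c ∷ xs → v ∉ b ∷ ys
  nb-disjoint girth {b} {c} xs {ys} nb₁ nb₂ len =
    unique-ʳ++ (c ∷ xs) (nb-unique girth (nb-glue xs nb₁ nb₂) (≤-trans (≤-reflexive (length-ʳ++ xs)) len))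

-- Counting non-backtracking walks

geo : ℕ → ℕ → ℕ
geo x zero = 0
geo x (suc d) = 1 + x * geo x d

-- wgeo x d = Σ_{i<d} (i + 1) xⁱ
wgeo : ℕ → ℕ → ℕ
wgeo x zero = 0
wgeo x (suc d) = x * wgeo x d + geo x (suc d)

module WalkCount {n} (G : Multipole n) where

  open Walks G

  a : Fin n → Fin n → ℕ
  a u v = 𝟙 (adj G u v)

  a-sym : ∀ u v → a u v ≡ a v u
  a-sym u v = cong 𝟙 (adj-sym G u v)

  a-irr : ∀ u → a u u ≡ 0
  a-irr u = cong 𝟙 (adj-irr G u)

  deg : Fin n → ℕ
  deg v = ∑ (a v)

  A₁ : ℕ
  A₁ = ∑ deg

  ν : Fin n → Fin n → ℕ
  ν u w = 𝟙 (not (does (u ≟ w)))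

  1≤ν⁻ : ∀ {u w} → 1 ≤ ν u w → u ≢ w
  1≤ν⁻ {u} {w} h with u ≟ w
  ... | no p = p

  δ+ν : ∀ u w → δ u w + ν u w ≡ 1
  δ+ν u w with does (u ≟ w)
  ... | true = refl
  ... | false = refl

  -- the number of non-backtracking walks with first arc u → v that end in z and have
  -- at most d further arcs
  T : ℕ → Fin n → Fin n → Fin n → ℕ
  T zero u v z = δ v z
  T (suc d) u v z = δ v z + ∑ λ w → a v w * (ν u w * T d v w z)

  t : ℕ → Fin n → Fin n → ℕ
  t zero u v = 1
  t (suc d) u v = 1 + ∑ λ w → a v w * (ν u w * t d v w)

  ∑δ≡1 : ∀ (v : Fin n) → ∑ (δ v) ≡ 1
  ∑δ≡1 v = trans (∑-cong λ z → sym (*-identityʳ (δ v z))) (∑-δ v (λ _ → 1))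

  ∑T≡t : ∀ d u v → ∑ (T d u v) ≡ t d u v
  ∑T≡t zero u v = ∑δ≡1 v
  ∑T≡t (suc d) u v = trans (∑-+ (δ v) _) (cong₂ _+_ (∑δ≡1 v) (trans (∑-swap (λ z w → a v w * (ν u w * T d v w z)))
    (∑-cong λ w → trans (∑-*ˡ (a v w) _) (cong (a v w *_) (trans (∑-*ˡ (ν u w) _) (cong (ν u w *_) (∑T≡t d v w)))))))

  1≤step⁻ : ∀ {u v w m} → 1 ≤ a v w * (ν u w * m) → Adj v w × u ≢ w × 1 ≤ m
  1≤step⁻ h = let p , q = 1≤⁻* h ; r , s = 1≤⁻* q in 1≤𝟙⁻ p , 1≤ν⁻ r , s

  reach : ∀ d {u v z} → 1 ≤ T d u v z → Adj u v →
    Σ (List (Fin n)) λ l → length l ≤ d × z ∈ v ∷ l × NB (u ∷ v ∷ l)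
  reach zero h uv = [] , z≤n , here (sym (1≤δ⁻ h)) , two uv
  reach (suc d) {u} {v} {z} h uv with 1≤⁻+ {δ v z} h
  ... | inj₁ p = [] , z≤n , here (sym (1≤δ⁻ p)) , two uv
  ... | inj₂ p with 1≤∑⁻ p
  ... | w , q with 1≤step⁻ {u} q
  ... | vw , u≢w , r with reach d r vw
  ... | l , len , z∈ , nb = w ∷ l , s≤s len , there z∈ , cons uv u≢w nb

  module _ {g} (girth : GirthAtLeast g G) where

    -- Two walks to z that part at v, one of them reversed, form a non-backtracking walk through v
    -- that meets z twice; it has at most 2d + 1 vertices, against `nb-unique`.
    T≤1 : ∀ d → 2 * d + 1 ≤ g → ∀ u v z → T d u v z ≤ 1
    T≤1 zero _ u v z = 𝟙≤1 _
    T≤1 (suc d) 2d<g u v z with v ≟ z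
    ... | yes refl = ≤-reflexive (cong suc (∑-zero λ w → ¬1≤⇒≡0 (none w)))
      where
      none : ∀ w → ¬ (1 ≤ a v w * (ν u w * T d v w v))
      none w h = let vw , _ , r = 1≤step⁻ {u} h ; l , len , v∈ , nb = reach d r vw in
        unique-head (nb-unique girth nb (size (length l) len)) v∈
        where
        size : ∀ m → m ≤ d → 2 + m ≤ g
        size m len = linarith (1 + d) (len ⊕ 2d<g) (solve (d ∷ g ∷ m ∷ []))
    ... | no _ = ∑≤1 (λ w → ≤-trans (𝟙*≤ (adj G v w) _) (≤-trans (𝟙*≤ (not (does (u ≟ w))) _) (T≤1 d (≤-trans (+-monoˡ-≤ 1 (*-monoʳ-≤ 2 (n≤1+n d))) 2d<g) v w z))) same
      where
      same : ∀ w w′ → 1 ≤ a v w * (ν u w * T d v w z) → 1 ≤ a v w′ * (ν u w′ * T d v w′ z) → w ≡ w′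
      same w w′ h h′ with w ≟ w′
      ... | yes e = e
      ... | no w≢w′ = let vw , _ , r = 1≤step⁻ {u} h ; vw′ , _ , r′ = 1≤step⁻ {u} h′
                          l , len , z∈ , nb = reach d r vw ; l′ , len′ , z∈′ , nb′ = reach d r′ vw′ in
        contradiction (there z∈′) (nb-disjoint girth l nb (cons (Adj-sym vw) w≢w′ nb′)
          (size (length l) (length l′) len len′) z∈)
        where
        size : ∀ m m′ → m ≤ d → m′ ≤ d → m + (2 + suc m′) ≤ g
        size m m′ len len′ = linarith 0 (len ⊕ len′ ⊕ 2d<g) (solve (d ∷ g ∷ m ∷ m′ ∷ []))

    T+T≤1 : ∀ d → 2 * d + 2 ≤ g → ∀ u v z → Adj u v → T d u v z + T d v u z ≤ 1
    T+T≤1 d 2d<g u v z uv with 1 ≤? T d u v z | 1 ≤? T d v u z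
    ... | no p | _ rewrite ¬1≤⇒≡0 p = T≤1 d (≤-trans (+-monoʳ-≤ (2 * d) (s≤s z≤n)) 2d<g) v u z
    ... | yes _ | no q rewrite ¬1≤⇒≡0 q | +-identityʳ (T d u v z) = T≤1 d (≤-trans (+-monoʳ-≤ (2 * d) (s≤s z≤n)) 2d<g) u v z
    ... | yes p | yes q = let l , len , z∈ , nb = reach d p uv ; l′ , len′ , z∈′ , nb′ = reach d q (Adj-sym uv) in
      contradiction z∈′ (nb-disjoint girth l nb nb′
        (size (length l) (length l′) len len′) z∈)
      where
      size : ∀ m m′ → m ≤ d → m′ ≤ d → m + (2 + m′) ≤ g
      size m m′ len len′ = linarith 0 (len ⊕ len′ ⊕ 2d<g) (solve (d ∷ g ∷ m ∷ m′ ∷ []))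

  R : ℕ → ℕ
  R d = ∑ λ u → ∑ λ v → a u v * t d u v

  even-ball : ∀ {g} d → GirthAtLeast g G → 2 * d + 2 ≤ g → 2 * R d ≤ n * A₁
  even-ball d girth 2d<g = begin
    2 * R d                                              ≡⟨ cong (R d +_) (+-identityʳ (R d)) ⟩
    R d + R d                                            ≡⟨ cong (R d +_) (∑-swap (λ u v → a u v * t d u v)) ⟩
    R d + ∑ (λ v → ∑ λ u → a u v * t d u v)              ≡⟨ ∑-+ _ _ ⟨
    ∑ (λ u → ∑ (λ v → a u v * t d u v) + ∑ λ v → a v u * t d v u)
      ≡⟨ ∑-cong (λ u → ∑-+ (λ v → a u v * t d u v) _) ⟨
    ∑ (λ u → ∑ λ v → a u v * t d u v + a v u * t d v u)  ≤⟨ ∑-mono (λ u → ∑-mono (pair u)) ⟩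
    ∑ (λ u → ∑ λ v → n * a u v)                          ≡⟨ ∑-cong (λ u → ∑-*ˡ n (a u)) ⟩
    ∑ (λ u → n * deg u)                                  ≡⟨ ∑-*ˡ n deg ⟩
    n * A₁                                               ∎
    where
    open ≤-Reasoning
    pair : ∀ u v → a u v * t d u v + a v u * t d v u ≤ n * a u v
    pair u v = begin
      a u v * t d u v + a v u * t d v u  ≡⟨ cong (λ x → a u v * t d u v + x * t d v u) (a-sym v u) ⟩
      a u v * t d u v + a u v * t d v u  ≡⟨ *-distribˡ-+ (a u v) _ _ ⟨
      a u v * (t d u v + t d v u)        ≤⟨ 𝟙*-mono (adj G u v) (λ uv → bound uv) ⟩
      a u v * n                          ≡⟨ *-comm (a u v) n ⟩
      n * a u v                          ∎
      where
      bound : Adj u v → t d u v + t d v u ≤ n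
      bound uv = begin
        t d u v + t d v u                  ≡⟨ cong₂ _+_ (∑T≡t d u v) (∑T≡t d v u) ⟨
        ∑ (T d u v) + ∑ (T d v u)          ≡⟨ ∑-+ _ _ ⟨
        ∑ (λ z → T d u v z + T d v u z)    ≤⟨ ∑-mono (λ z → T+T≤1 girth d 2d<g u v z uv) ⟩
        ∑ {n} (λ _ → 1)                    ≡⟨ trans (∑-const n 1) (*-identityʳ n) ⟩
        n                                  ∎

  -- The whole ball around v is obtained from a fictitious arc v → v: as v is not adjacent to
  -- itself, this arc forbids no first step, and `t (suc d) v v` counts v together with all walks of
  -- at most `suc d` links from v.
  odd-ball : ∀ {g} d → GirthAtLeast g G → 2 * suc d + 1 ≤ g → n + R d ≤ n * n
  odd-ball d girth 2d<g = begin
    n + R d                       ≡⟨ cong (_+ R d) (trans (∑-const n 1) (*-identityʳ n)) ⟨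
    ∑ {n} (λ _ → 1) + R d         ≡⟨ ∑-+ _ _ ⟨
    ∑ (λ v → 1 + ∑ λ w → a v w * t d v w)  ≡⟨ ∑-cong (λ v → cong suc (∑-cong (root v))) ⟩
    ∑ (λ v → t (suc d) v v)       ≤⟨ ∑-mono bound ⟩
    ∑ {n} (λ _ → n)               ≡⟨ ∑-const n n ⟩
    n * n                         ∎
    where
    open ≤-Reasoning
    root : ∀ v w → a v w * t d v w ≡ a v w * (ν v w * t d v w)
    root v w = 𝟙*-cong (adj G v w) λ vw → trans (sym (*-identityˡ _)) (cong (_* t d v w)
      (trans (sym (δ+ν v w)) (cong (_+ ν v w) (δ-≢ {i = v} {w} λ { refl → Adj-irr vw }))))
    bound : ∀ v → t (suc d) v v ≤ n
    bound v = begin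
      t (suc d) v v        ≡⟨ ∑T≡t (suc d) v v ⟨
      ∑ (T (suc d) v v)    ≤⟨ ∑-mono (T≤1 girth (suc d) 2d<g v v) ⟩
      ∑ {n} (λ _ → 1)      ≡⟨ trans (∑-const n 1) (*-identityʳ n) ⟩
      n                    ∎

  module _ (x : ℕ) (regular : ∀ v → deg v + sem G v ≡ suc x) where

    s : ℕ
    s = ∑ (sem G)

    exits : ∀ {u v} → Adj u v → 1 + ∑ (λ w → a v w * ν u w) ≡ deg v
    exits {u} {v} uv = begin
      1 + ∑ (λ w → a v w * ν u w)                           ≡⟨ cong (λ m → 𝟙 m + ∑ (λ w → a v w * ν u w)) (Adj-sym uv) ⟨
      a v u + ∑ (λ w → a v w * ν u w)                       ≡⟨ cong (_+ ∑ (λ w → a v w * ν u w)) (∑-δ u (a v)) ⟨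
      ∑ (λ w → δ u w * a v w) + ∑ (λ w → a v w * ν u w)     ≡⟨ ∑-+ _ _ ⟨
      ∑ (λ w → δ u w * a v w + a v w * ν u w)               ≡⟨ ∑-cong (λ w → merge (δ u w) (ν u w) (a v w) (δ+ν u w)) ⟩
      deg v                                                 ∎
      where
      open ≡-Reasoning
      merge : ∀ i j m → i + j ≡ 1 → i * m + m * j ≡ m
      merge i j m e = trans (cong (i * m +_) (*-comm m j)) (trans (sym (*-distribʳ-+ m i j)) (trans (cong (_* m) e) (*-identityˡ m)))

    exits≤x : ∀ {u v} → Adj u v → ∑ (λ w → a v w * ν u w) ≤ x
    exits≤x {u} {v} uv = s≤s⁻¹ (≤-trans (≤-reflexive (exits uv)) (≤-trans (m≤m+n _ _) (≤-reflexive (regular v))))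

    t≤geo : ∀ d {u v} → Adj u v → t d u v ≤ geo x (suc d)
    t≤geo zero _ = ≤-reflexive (cong suc (sym (*-zeroʳ x)))
    t≤geo (suc d) {u} {v} uv = s≤s (begin
      ∑ (λ w → a v w * (ν u w * t d v w))    ≤⟨ ∑-mono (λ w → 𝟙*-mono (adj G v w) λ vw → *-monoʳ-≤ (ν u w) (t≤geo d vw)) ⟩
      ∑ (λ w → a v w * (ν u w * S))          ≡⟨ ∑-cong (λ w → comm (a v w) (ν u w) S) ⟩
      ∑ (λ w → S * (a v w * ν u w))          ≡⟨ ∑-*ˡ S _ ⟩
      S * ∑ (λ w → a v w * ν u w)            ≤⟨ *-monoʳ-≤ S (exits≤x uv) ⟩
      S * x                                  ≡⟨ *-comm S x ⟩
      x * S                                  ∎)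
      where
      open ≤-Reasoning
      S = geo x (suc d)
      comm : ∀ i j m → i * (j * m) ≡ m * (i * j)
      comm = solve-∀

    sem*deg≤ : ∀ v → sem G v * deg v ≤ sem G v * x
    sem*deg≤ v with sem G v | regular v
    ... | zero | _ = z≤n
    ... | suc m | e = *-monoʳ-≤ (suc m) (s≤s⁻¹ (≤-trans (s≤s (m≤m+n (deg v) m)) (≤-reflexive (trans (sym (+-suc (deg v) m)) e))))

    -- Without semiedges, a walk beginning with v → w would have x prolongations backwards beyond v;
    -- `sem G v` of them are missing.
    loss : ℕ → ℕ
    loss d = ∑ λ v → ∑ λ w → a v w * t d v w * sem G v

    loss≤ : ∀ d → loss d ≤ s * x * geo x (suc d)
    loss≤ d = begin
      loss d                                          ≤⟨ ∑-mono (λ v → ∑-mono λ w → step v w) ⟩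
      ∑ (λ v → ∑ λ w → (S * sem G v) * a v w)         ≡⟨ ∑-cong (λ v → ∑-*ˡ (S * sem G v) (a v)) ⟩
      ∑ (λ v → (S * sem G v) * deg v)                 ≡⟨ ∑-cong (λ v → *-assoc S (sem G v) (deg v)) ⟩
      ∑ (λ v → S * (sem G v * deg v))                 ≡⟨ ∑-*ˡ S _ ⟩
      S * ∑ (λ v → sem G v * deg v)                   ≤⟨ *-monoʳ-≤ S (∑-mono sem*deg≤) ⟩
      S * ∑ (λ v → sem G v * x)                       ≡⟨ cong (S *_) (trans (∑-cong λ v → *-comm (sem G v) x) (∑-*ˡ x (sem G))) ⟩
      S * (x * s)                                     ≡⟨ comm S x s ⟩
      s * x * S                                       ∎
      where
      open ≤-Reasoning
      S = geo x (suc d)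
      comm : ∀ i j m → i * (j * m) ≡ m * j * i
      comm = solve-∀
      step : ∀ v w → a v w * t d v w * sem G v ≤ S * sem G v * a v w
      step v w = begin
        a v w * t d v w * sem G v     ≤⟨ *-monoˡ-≤ (sem G v) (𝟙*-mono (adj G v w) (t≤geo d)) ⟩
        a v w * S * sem G v           ≡⟨ comm′ (a v w) S (sem G v) ⟩
        S * sem G v * a v w           ∎
        where
        comm′ : ∀ i j m → i * j * m ≡ j * m * i
        comm′ = solve-∀

    -- A walk counted in `R (suc d)` is a single arc or arises from one counted in `R d` by a new
    -- arc in front of it. Prolonging at the start makes the loss a sum weighted by the semiedges at
    -- the first vertex, which `loss≤` can compare with s.
    R-suc : ∀ d → R (suc d) + loss d ≡ A₁ + x * R d
    R-suc d = begin
      R (suc d) + loss d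
        ≡⟨ cong (_+ loss d) (trans (∑-cong λ u → trans (∑-cong λ v → trans (*-distribˡ-+ (a u v) 1 _) (cong (_+ a u v * inner u v) (*-identityʳ (a u v)))) (∑-+ (a u) _)) (∑-+ deg _)) ⟩
      A₁ + ∑ (λ u → ∑ λ v → a u v * inner u v) + loss d
        ≡⟨ cong (λ y → A₁ + y + loss d) second ⟩
      A₁ + ∑ (λ v → ∑ λ w → a v w * t d v w * c v w) + loss d
        ≡⟨ +-assoc A₁ _ _ ⟩
      A₁ + (∑ (λ v → ∑ λ w → a v w * t d v w * c v w) + loss d)
        ≡⟨ cong (A₁ +_) (trans (sym (∑-+ {n} _ _)) (∑-cong λ v → trans (sym (∑-+ {n} _ _)) (∑-cong (point v)))) ⟩
      A₁ + ∑ (λ v → ∑ λ w → x * (a v w * t d v w))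
        ≡⟨ cong (A₁ +_) (trans (∑-cong λ v → ∑-*ˡ x _) (∑-*ˡ x _)) ⟩
      A₁ + x * R d ∎
      where
      open ≡-Reasoning
      inner : Fin n → Fin n → ℕ
      inner u v = ∑ λ w → a v w * (ν u w * t d v w)
      c : Fin n → Fin n → ℕ
      c v w = ∑ λ u → a v u * ν w u
      ν-sym : ∀ u w → ν u w ≡ ν w u
      ν-sym u w = +-cancelˡ-≡ (δ u w) _ _ (trans (δ+ν u w) (trans (sym (δ+ν w u)) (cong (_+ ν w u) (δ-sym w u))))
      rearr : ∀ i j m o → i * (j * (m * o)) ≡ j * o * (i * m)
      rearr = solve-∀
      second : ∑ (λ u → ∑ λ v → a u v * inner u v) ≡ ∑ (λ v → ∑ λ w → a v w * t d v w * c v w)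
      second = begin
        ∑ (λ u → ∑ λ v → a u v * inner u v)
          ≡⟨ ∑-swap (λ u v → a u v * inner u v) ⟩
        ∑ (λ v → ∑ λ u → a u v * inner u v)
          ≡⟨ ∑-cong (λ v → ∑-cong λ u → sym (∑-*ˡ (a u v) _)) ⟩
        ∑ (λ v → ∑ λ u → ∑ λ w → a u v * (a v w * (ν u w * t d v w)))
          ≡⟨ ∑-cong (λ v → ∑-swap (λ u w → a u v * (a v w * (ν u w * t d v w)))) ⟩
        ∑ (λ v → ∑ λ w → ∑ λ u → a u v * (a v w * (ν u w * t d v w)))
          ≡⟨ ∑-cong (λ v → ∑-cong λ w → trans (∑-cong λ u → trans (rearr (a u v) (a v w) (ν u w) (t d v w))
               (cong (a v w * t d v w *_) (cong₂ _*_ (a-sym u v) (ν-sym u w)))) (∑-*ˡ (a v w * t d v w) _)) ⟩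
        ∑ (λ v → ∑ λ w → a v w * t d v w * c v w) ∎
      fin : ∀ i c σ x dg → 1 + c ≡ dg → dg + σ ≡ suc x → i * c + i * σ ≡ x * i
      fin i c σ x .(1 + c) refl e = trans (sym (*-distribˡ-+ i c σ)) (trans (cong (i *_) (suc-injective e)) (*-comm i x))
      point : ∀ v w → a v w * t d v w * c v w + a v w * t d v w * sem G v ≡ x * (a v w * t d v w)
      point v w with adj G v w in e
      ... | true = fin (1 * t d v w) (c v w) (sem G v) x (deg v) (exits (Adj-sym e)) (regular v)
      ... | false = sym (*-zeroʳ x)

    -- Losses at one level are multiplied by x at the next, and level d adds at most s x (1 + ... +
    -- xᵈ) new ones; this is the recursion of `wgeo`.
    R≥ : ∀ d → A₁ * geo x (suc d) ≤ R d + s * x * wgeo x d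
    R≥ zero = ≤-reflexive (trans (cong (A₁ *_) (cong suc (*-zeroʳ x))) (trans (*-identityʳ A₁)
      (trans (∑-cong λ u → ∑-cong λ v → sym (*-identityʳ (a u v))) (sym (trans (cong (R 0 +_) (*-zeroʳ (s * x))) (+-identityʳ (R 0)))))))
    R≥ (suc d) = go A₁ x s (geo x (suc d)) (wgeo x d) (R d) (R (suc d)) (loss d) (R≥ d) (loss≤ d) (R-suc d)
      where
      go : ∀ A x s S K r r′ l → A * S ≤ r + s * x * K → l ≤ s * x * S → r′ + l ≡ A + x * r →
        A * (1 + x * S) ≤ r′ + s * x * (x * K + S)
      go A x s S K r r′ l h₁ h₂ e = linarith 0 (x ⊗ h₁ ⊕ h₂ ⊕ ≤-reflexive (sym e)) (solve (A ∷ x ∷ s ∷ S ∷ K ∷ r ∷ r′ ∷ l ∷ []))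

    A₁+s : A₁ + s ≡ suc x * n
    A₁+s = trans (sym (∑-+ deg (sem G))) (trans (∑-cong regular) (trans (∑-const n (suc x)) (*-comm n (suc x))))

    even-ineq : ∀ {g} d → GirthAtLeast g G → 2 * d + 2 ≤ g →
      2 * A₁ * geo x (suc d) ≤ n * A₁ + 2 * (s * x * wgeo x d)
    even-ineq d girth h = go A₁ n (s * x * wgeo x d) (geo x (suc d)) (R d) (R≥ d) (even-ball d girth h)
      where
      go : ∀ A n K S r → A * S ≤ r + K → 2 * r ≤ n * A → 2 * A * S ≤ n * A + 2 * K
      go A n K S r h₁ h₂ = linarith 0 (2 ⊗ h₁ ⊕ h₂) (solve (A ∷ n ∷ K ∷ S ∷ r ∷ []))

    odd-ineq : ∀ {g} d → GirthAtLeast g G → 2 * suc d + 1 ≤ g →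
      n + suc x * n * geo x (suc d) ≤ n * n + s * wgeo x (suc d)
    odd-ineq d girth h = go A₁ n x s (geo x (suc d)) (wgeo x d) (R d) (R≥ d) (odd-ball d girth h) A₁+s
      where
      go : ∀ A n x s S K r → A * S ≤ r + s * x * K → n + r ≤ n * n → A + s ≡ suc x * n →
        n + suc x * n * S ≤ n * n + s * (x * K + S)
      go A n x s S K r h₁ h₂ e rewrite sym e = linarith 0 (h₁ ⊕ h₂) (solve (A ∷ n ∷ x ∷ s ∷ S ∷ K ∷ r ∷ []))

-- Vertex sets, the links inside them, and forests

∨-true : ∀ {a b} → a ∨ b ≡ true → a ≡ true ⊎ b ≡ true
∨-true {true} _ = inj₁ refl
∨-true {false} h = inj₂ h

positive : ℕ → Bool
positive zero = false
positive (suc _) = true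

positive⁻ : ∀ {m} → positive m ≡ true → 1 ≤ m
positive⁻ {suc m} _ = s≤s z≤n

positive⁺ : ∀ {m} → 1 ≤ m → positive m ≡ true
positive⁺ {suc m} _ = refl

∑-ν : ∀ {n} i (f : Fin n → ℕ) → f i + ∑ (λ j → 𝟙 (not (does (i ≟ j))) * f j) ≡ ∑ f
∑-ν i f = trans (cong (_+ ∑ (λ j → 𝟙 (not (does (i ≟ j))) * f j)) (sym (∑-δ i f)))
  (trans (sym (∑-+ _ _)) (∑-cong λ j → merge (does (i ≟ j)) (f j)))
  where
  merge : ∀ b m → 𝟙 b * m + 𝟙 (not b) * m ≡ m
  merge true m = trans (+-identityʳ _) (*-identityˡ m)
  merge false m = *-identityˡ m

another : ∀ {n} {f : Fin n → ℕ} → (∀ i → f i ≤ 1) → 2 ≤ ∑ f → ∀ i → ∃ λ j → i ≢ j × 1 ≤ f j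
another {f = f} f≤1 h i with 1≤∑⁻ {f = λ j → 𝟙 (not (does (i ≟ j))) * f j}
    (s≤s⁻¹ (≤-trans h (≤-trans (≤-reflexive (sym (∑-ν i f))) (+-monoˡ-≤ _ (f≤1 i)))))
... | j , p with i ≟ j
... | no i≢j = j , i≢j , proj₂ (1≤⁻* {1} p)

module VertexSets {n} (G : Multipole n) where

  open Walks G public
  open WalkCount G public using (a; a-sym; a-irr; deg; A₁)

  VSet : Set
  VSet = Fin n → Bool

  infix 4 _⊆_
  _⊆_ : VSet → VSet → Set
  A ⊆ B = ∀ {v} → A v ≡ true → B v ≡ true

  _∖_ : VSet → VSet → VSet
  (A ∖ B) v = A v ∧ not (B v)

  ⟦_⟧ : VSet → Fin n → ℕ
  ⟦ A ⟧ v = 𝟙 (A v)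

  size : VSet → ℕ
  size A = ∑ ⟦ A ⟧

  single : Fin n → VSet
  single v w = does (v ≟ w)

  ∖⁻ : ∀ A B {v} → (A ∖ B) v ≡ true → A v ≡ true × B v ≡ false
  ∖⁻ A B {v} h with A v | B v
  ... | true | false = refl , refl

  ∖⁺ : ∀ A B {v} → A v ≡ true → B v ≡ false → (A ∖ B) v ≡ true
  ∖⁺ A B p q rewrite p | q = refl

  ⊆-split : ∀ A B → B ⊆ A → ∀ v → ⟦ A ⟧ v ≡ ⟦ B ⟧ v + ⟦ A ∖ B ⟧ v
  ⊆-split A B h v with A v in p | B v in q
  ... | true | true = refl
  ... | true | false = refl
  ... | false | true = contradiction (trans (sym p) (h q)) λ ()
  ... | false | false = refl

  single⊆ : ∀ A {v} → A v ≡ true → single v ⊆ A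
  single⊆ A {v} h {w} e with v ≟ w
  ... | yes refl = h

  dg : (Fin n → ℕ) → Fin n → ℕ
  dg p v = ∑ λ w → a v w * p w

  -- The bilinear form of the adjacency matrix. `arcs ⟦ A ⟧ ⟦ A ⟧` is twice the number of links
  -- inside A; weights in place of sets make it additive when A is split.
  arcs : (Fin n → ℕ) → (Fin n → ℕ) → ℕ
  arcs p q = ∑ λ u → p u * dg q u

  dg-+ : ∀ p p₁ p₂ → (∀ w → p w ≡ p₁ w + p₂ w) → ∀ v → dg p v ≡ dg p₁ v + dg p₂ v
  dg-+ p p₁ p₂ h v = trans (∑-cong λ w → trans (cong (a v w *_) (h w)) (*-distribˡ-+ (a v w) _ _)) (∑-+ _ _)

  arcs-sym : ∀ p q → arcs p q ≡ arcs q p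
  arcs-sym p q = begin
    ∑ (λ u → p u * ∑ λ w → a u w * q w)      ≡⟨ ∑-cong (λ u → ∑-*ˡ (p u) _) ⟨
    ∑ (λ u → ∑ λ w → p u * (a u w * q w))    ≡⟨ ∑-swap (λ u w → p u * (a u w * q w)) ⟩
    ∑ (λ w → ∑ λ u → p u * (a u w * q w))    ≡⟨ ∑-cong (λ w → ∑-cong λ u → trans (cong (λ y → p u * (y * q w)) (a-sym u w)) (rearr (p u) (a w u) (q w))) ⟩
    ∑ (λ w → ∑ λ u → q w * (a w u * p u))    ≡⟨ ∑-cong (λ w → ∑-*ˡ (q w) _) ⟩
    ∑ (λ w → q w * ∑ λ u → a w u * p u)      ∎
    where
    open ≡-Reasoning
    rearr : ∀ i j m → i * (j * m) ≡ m * (j * i)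
    rearr = solve-∀

  arcs-+ʳ : ∀ p q q₁ q₂ → (∀ w → q w ≡ q₁ w + q₂ w) → arcs p q ≡ arcs p q₁ + arcs p q₂
  arcs-+ʳ p q q₁ q₂ h = trans (∑-cong λ u → trans (cong (p u *_) (dg-+ q q₁ q₂ h u)) (*-distribˡ-+ (p u) _ _)) (∑-+ _ _)

  arcs-+ˡ : ∀ p p₁ p₂ q → (∀ w → p w ≡ p₁ w + p₂ w) → arcs p q ≡ arcs p₁ q + arcs p₂ q
  arcs-+ˡ p p₁ p₂ q h = trans (∑-cong λ u → trans (cong (_* dg q u) (h u)) (*-distribʳ-+ (dg q u) (p₁ u) (p₂ u))) (∑-+ _ _)

  arcs-split : ∀ p p₁ p₂ → (∀ w → p w ≡ p₁ w + p₂ w) →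
    arcs p p ≡ arcs p₁ p₁ + arcs p₂ p₂ + 2 * arcs p₁ p₂
  arcs-split p p₁ p₂ h = trans (arcs-+ˡ p p₁ p₂ p h) (trans (cong₂ _+_ (arcs-+ʳ p₁ p p₁ p₂ h) (arcs-+ʳ p₂ p p₁ p₂ h))
    (trans (cong (λ y → arcs p₁ p₁ + arcs p₁ p₂ + (y + arcs p₂ p₂)) (arcs-sym p₂ p₁))
      (solve′ (arcs p₁ p₁) (arcs p₁ p₂) (arcs p₂ p₂))))
    where
    solve′ : ∀ i j m → i + j + (j + m) ≡ i + m + 2 * j
    solve′ = solve-∀

  arcs-δ : ∀ v q → arcs (δ v) q ≡ dg q v
  arcs-δ v q = ∑-δ v (dg q)

  dg-δ : ∀ u v → dg (δ v) u ≡ a u v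
  dg-δ u v = trans (∑-cong λ w → *-comm (a u w) (δ v w)) (∑-δ v (a u))

  size-split : ∀ A B → B ⊆ A → size A ≡ size B + size (A ∖ B)
  size-split A B h = trans (∑-cong (⊆-split A B h)) (∑-+ _ _)

  size-remove : ∀ A {v} → A v ≡ true → size A ≡ 1 + size (A ∖ single v)
  size-remove A {v} h = trans (size-split A (single v) (single⊆ A h)) (cong (_+ size (A ∖ single v))
    (trans (∑-cong λ w → sym (*-identityʳ (δ v w))) (∑-δ v (λ _ → 1))))

  arcs-remove : ∀ A {v} → A v ≡ true →
    arcs ⟦ A ⟧ ⟦ A ⟧ ≡ arcs ⟦ A ∖ single v ⟧ ⟦ A ∖ single v ⟧ + 2 * dg ⟦ A ⟧ v
  arcs-remove A {v} h = trans (arcs-split ⟦ A ⟧ (δ v) A′ split) (trans (cong₂ (λ i j → i + arcs A′ A′ + 2 * j) vv (arcs-δ v A′))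
    (cong (λ y → arcs A′ A′ + 2 * y) (sym (trans (dg-+ ⟦ A ⟧ (δ v) A′ split v) (cong (_+ dg A′ v) (trans (dg-δ v v) (a-irr v)))))))
    where
    A′ = ⟦ A ∖ single v ⟧
    split = ⊆-split A (single v) (single⊆ A h)
    vv : arcs (δ v) (δ v) ≡ 0
    vv = trans (arcs-δ v (δ v)) (trans (dg-δ v v) (a-irr v))

  arcs-removeˡ : ∀ A {v} q → A v ≡ true → arcs ⟦ A ⟧ q ≡ dg q v + arcs ⟦ A ∖ single v ⟧ q
  arcs-removeˡ A {v} q h = trans (arcs-+ˡ ⟦ A ⟧ (δ v) ⟦ A ∖ single v ⟧ q (⊆-split A (single v) (single⊆ A h)))
    (cong (_+ arcs ⟦ A ∖ single v ⟧ q) (arcs-δ v q))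

  member : ∀ A → 1 ≤ size A → ∃ λ v → A v ≡ true
  member A h = let v , p = 1≤∑⁻ h in v , 1≤𝟙⁻ p

  1≤size : ∀ A {v} → A v ≡ true → 1 ≤ size A
  1≤size A {v} h = ≤-trans (1≤𝟙 h) (term≤∑ ⟦ A ⟧ v)

  empty-weight : ∀ A → size A ≡ 0 → ∀ v → ⟦ A ⟧ v ≡ 0
  empty-weight A h v = n≤0⇒n≡0 (≤-trans (term≤∑ ⟦ A ⟧ v) (≤-reflexive h))

  arcs-empty : ∀ A q → size A ≡ 0 → arcs ⟦ A ⟧ q ≡ 0
  arcs-empty A q h = ∑-zero λ u → cong (_* dg q u) (empty-weight A h u)

  unique⇒length≤size : ∀ {l} A → Unique l → (∀ {v} → v ∈ l → A v ≡ true) → length l ≤ size A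
  unique⇒length≤size {[]} A u h = z≤n
  unique⇒length≤size {x ∷ l} A u h = ≤-trans (s≤s (unique⇒length≤size (A ∖ single x) (unique-tail u) inA′))
    (≤-reflexive (sym (size-remove A (h (here refl)))))
    where
    inA′ : ∀ {v} → v ∈ l → (A ∖ single x) v ≡ true
    inA′ {v} v∈l = ∖⁺ A (single x) (h (there v∈l)) (dec-false (x ≟ v) λ { refl → unique-head u v∈l })

  neighbour : ∀ A v → 1 ≤ dg ⟦ A ⟧ v → ∃ λ w → Adj v w × A w ≡ true
  neighbour A v h = let w , p = 1≤∑⁻ h ; q , r = 1≤⁻* p in w , 1≤𝟙⁻ q , 1≤𝟙⁻ r

  1≤dg : ∀ A {v w} → Adj v w → A w ≡ true → 1 ≤ dg ⟦ A ⟧ v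
  1≤dg A {v} {w} vw h = ≤-trans (≤-reflexive (sym (cong₂ (λ b c → 𝟙 b * 𝟙 c) vw h))) (term≤∑ _ w)

  neighbour≢ : ∀ A v → 2 ≤ dg ⟦ A ⟧ v → ∀ u → ∃ λ w → u ≢ w × Adj v w × A w ≡ true
  neighbour≢ A v h u = let w , u≢w , p = another (λ w → ≤-trans (𝟙*≤ (adj G v w) _) (𝟙≤1 (A w))) h u ; q , r = 1≤⁻* p in
    w , u≢w , 1≤𝟙⁻ q , 1≤𝟙⁻ r

  neighbour≢≢ : ∀ A v → 3 ≤ dg ⟦ A ⟧ v → ∀ u w → ∃ λ z → u ≢ z × w ≢ z × Adj v z × A z ≡ true
  neighbour≢≢ A v h u w =
    let z , w≢z , p = another (λ z → ≤-trans (𝟙*≤ (not (does (u ≟ z))) _) (f≤1 z)) 2≤ w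
        q , r = 1≤⁻* p ; c , d = 1≤⁻* r
    in z , WalkCount.1≤ν⁻ G {u} {z} q , w≢z , 1≤𝟙⁻ c , 1≤𝟙⁻ d
    where
    f : Fin n → ℕ
    f z = a v z * ⟦ A ⟧ z
    f≤1 : ∀ z → f z ≤ 1
    f≤1 z = ≤-trans (𝟙*≤ (adj G v z) _) (𝟙≤1 (A z))
    2≤ : 2 ≤ ∑ λ z → 𝟙 (not (does (u ≟ z))) * f z
    2≤ = s≤s⁻¹ (≤-trans h (≤-trans (≤-reflexive (sym (∑-ν u f))) (+-monoˡ-≤ _ (f≤1 u))))

  -- the graph induced on U has girth at least ℓ
  Short : ℕ → VSet → Set
  Short ℓ U = ∀ {l} → NB l → (∀ {v} → v ∈ l → U v ≡ true) → length l ≤ ℓ → Unique l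

  Short-⊆ : ∀ {ℓ A B} → A ⊆ B → Short ℓ B → Short ℓ A
  Short-⊆ A⊆B short nb h = short nb (A⊆B ∘ h)

  -- A vertex with at most one neighbour in A is removed. If there is none, a non-backtracking walk
  -- can be prolonged inside A at will, and `size A + 1` of its vertices, distinct by `Short`, do
  -- not fit into A.
  forest : ∀ {ℓ} m A → size A ≡ m → Short ℓ A → suc m ≤ ℓ → 1 ≤ m → arcs ⟦ A ⟧ ⟦ A ⟧ + 2 ≤ 2 * m
  forest {ℓ} (suc m) A e short m<ℓ _ with Data.Fin.Properties.any? (λ v → (A v Data.Bool.≟ true) ×-dec (dg ⟦ A ⟧ v ≤? 1))
  ... | yes (v , v∈A , d≤1) = rest (m ≟ⁿ 0)
    where
    open ≤-Reasoning
    A′ = A ∖ single v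
    e′ : size A′ ≡ m
    e′ = suc-injective (trans (sym (size-remove A v∈A)) e)
    step : ∀ z d s → z + 2 ≤ 2 * s → d ≤ 1 → z + 2 * d + 2 ≤ 2 * suc s
    step z d s h₁ h₂ = linarith 0 (h₁ ⊕ 2 ⊗ h₂) (solve (z ∷ d ∷ s ∷ []))
    rest : Dec (m ≡ 0) → arcs ⟦ A ⟧ ⟦ A ⟧ + 2 ≤ 2 * suc m
    rest (yes refl) = ≤-reflexive (cong (_+ 2) (trans (arcs-remove A v∈A) (cong₂ (λ i j → i + 2 * j) (arcs-empty A′ ⟦ A′ ⟧ e′)
      (trans (dg-+ ⟦ A ⟧ (δ v) ⟦ A′ ⟧ (⊆-split A (single v) (single⊆ A v∈A)) v) (cong₂ _+_ (trans (dg-δ v v) (a-irr v))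
        (∑-zero λ w → trans (cong (a v w *_) (empty-weight A′ e′ w)) (*-zeroʳ (a v w))))))))
    rest (no m≢0) = ≤-trans (≤-reflexive (cong (_+ 2) (arcs-remove A v∈A)))
      (step (arcs ⟦ A′ ⟧ ⟦ A′ ⟧) (dg ⟦ A ⟧ v) m (forest m A′ e′ (Short-⊆ (λ {w} h → proj₁ (∖⁻ A (single v) h)) short) (≤-trans (n≤1+n _) m<ℓ) (n≢0⇒n>0 m≢0)) d≤1)
  ... | no none = contradiction (unique⇒length≤size A (short nb inA len) inA) (<⇒≱ (≤-reflexive (trans (cong suc e) (sym eq))))
    where
    thick : ∀ {v} → A v ≡ true → 2 ≤ dg ⟦ A ⟧ v
    thick {v} h = ≰⇒> λ d≤1 → none (v , h , d≤1)
    Long : ℕ → Set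
    Long i = Σ (Fin n) λ y → Σ (List (Fin n)) λ l → NB (y ∷ l) × (∀ {v} → v ∈ y ∷ l → A v ≡ true) × length (y ∷ l) ≡ suc i
    grow : ∀ i → Long i
    grow zero = let v , h = member A (≤-trans (s≤s z≤n) (≤-reflexive (sym e))) in v , [] , one , (λ { (here refl) → h }) , refl
    grow (suc i) with grow i
    ... | y , [] , nb , h , q = let w , yw , w∈ = neighbour A y (≤-trans (s≤s z≤n) (thick (h (here refl)))) in
      w , y ∷ [] , two (Adj-sym yw) , (λ { (here refl) → w∈ ; (there p) → h p }) , cong suc q
    ... | y , z ∷ l , nb , h , q = let w , z≢w , yw , w∈ = neighbour≢ A y (thick (h (here refl))) z in
      w , y ∷ z ∷ l , cons (Adj-sym yw) (z≢w ∘ sym) nb , (λ { (here refl) → w∈ ; (there p) → h p }) , cong suc q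
    long = grow (suc m)
    l = proj₁ long ∷ proj₁ (proj₂ long)
    nb : NB l
    nb = proj₁ (proj₂ (proj₂ long))
    inA : ∀ {v} → v ∈ l → A v ≡ true
    inA = proj₁ (proj₂ (proj₂ (proj₂ long)))
    eq : length l ≡ suc (suc m)
    eq = proj₂ (proj₂ (proj₂ (proj₂ long)))
    len : length l ≤ ℓ
    len = ≤-trans (≤-reflexive eq) m<ℓ

  -- Only t = size A = ℓ needs more than `forest`: each deletion of a vertex leaves a forest, and
  -- summing the resulting bounds on Z over A gives (t - 2) Z ≤ 2 t (t - 2). This avoids describing
  -- the graph on A.
  arcs≤2size : ∀ {ℓ} A → 3 ≤ ℓ → Short ℓ A → size A ≤ ℓ → arcs ⟦ A ⟧ ⟦ A ⟧ ≤ 2 * size A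
  arcs≤2size {ℓ} A 3≤ℓ short s≤ℓ with size A ≟ⁿ 0 | m≤n⇒m<n∨m≡n s≤ℓ
  ... | yes e | _ = ≤-trans (≤-reflexive (arcs-empty A ⟦ A ⟧ e)) z≤n
  ... | no s≢0 | inj₁ s<ℓ = ≤-trans (m≤m+n _ 2) (forest (size A) A refl short s<ℓ (n≢0⇒n>0 s≢0))
  ... | no _ | inj₂ e = final (size A) (≤-trans 3≤ℓ (≤-reflexive (sym e))) sum≤
    where
    t = size A
    Z = arcs ⟦ A ⟧ ⟦ A ⟧
    -- Deleting any vertex of A leaves a forest.
    delete : ∀ {v} → A v ≡ true → Z + 4 ≤ 2 * t + 2 * dg ⟦ A ⟧ v
    delete {v} h = go (arcs ⟦ A ∖ single v ⟧ ⟦ A ∖ single v ⟧) Z t (size (A ∖ single v)) (dg ⟦ A ⟧ v) (size-remove A h) (arcs-remove A h)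
      (forest _ (A ∖ single v) refl (Short-⊆ (λ {w} p → proj₁ (∖⁻ A (single v) p)) short)
        (≤-trans (≤-reflexive (sym (size-remove A h))) s≤ℓ)
        (s≤s⁻¹ (≤-trans (s≤s (s≤s z≤n)) (≤-trans 3≤ℓ (≤-reflexive (trans (sym e) (size-remove A h)))))))
      where
      go : ∀ z Z t s d → t ≡ 1 + s → Z ≡ z + 2 * d → z + 2 ≤ 2 * s → Z + 4 ≤ 2 * t + 2 * d
      go z _ _ s d refl refl h = linarith 0 h (solve (z ∷ s ∷ d ∷ []))
    sum≤ : (Z + 4) * t ≤ 2 * t * t + 2 * Z
    sum≤ = begin
      (Z + 4) * t                                        ≡⟨ ∑-*ˡ (Z + 4) ⟦ A ⟧ ⟨
      ∑ (λ v → (Z + 4) * ⟦ A ⟧ v)                        ≡⟨ ∑-cong (λ v → *-comm (Z + 4) (⟦ A ⟧ v)) ⟩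
      ∑ (λ v → ⟦ A ⟧ v * (Z + 4))                        ≤⟨ ∑-mono (λ v → 𝟙*-mono (A v) delete) ⟩
      ∑ (λ v → ⟦ A ⟧ v * (2 * t + 2 * dg ⟦ A ⟧ v))       ≡⟨ ∑-cong (λ v → expand (⟦ A ⟧ v) t (dg ⟦ A ⟧ v)) ⟩
      ∑ (λ v → 2 * t * ⟦ A ⟧ v + 2 * (⟦ A ⟧ v * dg ⟦ A ⟧ v)) ≡⟨ ∑-+ _ _ ⟩
      ∑ (λ v → 2 * t * ⟦ A ⟧ v) + ∑ (λ v → 2 * (⟦ A ⟧ v * dg ⟦ A ⟧ v)) ≡⟨ cong₂ _+_ (∑-*ˡ (2 * t) ⟦ A ⟧) (∑-*ˡ 2 _) ⟩
      2 * t * t + 2 * Z                                  ∎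
      where
      open ≤-Reasoning
      expand : ∀ i t d → i * (2 * t + 2 * d) ≡ 2 * t * i + 2 * (i * d)
      expand = solve-∀
    final : ∀ t → 3 ≤ t → (Z + 4) * t ≤ 2 * t * t + 2 * Z → Z ≤ 2 * t
    final (suc (suc (suc r))) _ h = *-cancelˡ-≤ (suc r) (go r Z h)
      where
      go : ∀ r Z → (Z + 4) * (3 + r) ≤ 2 * (3 + r) * (3 + r) + 2 * Z → (1 + r) * Z ≤ (1 + r) * (2 * (3 + r))
      go r Z h = linarith 0 h (solve (r ∷ Z ∷ []))
    final (suc zero) (s≤s ()) _
    final (suc (suc zero)) (s≤s (s≤s ())) _

-- Neighbourhoods of a shortest cycle

module Neighbourhood {n} (G : Multipole n) (U : Fin n → Bool) (m : ℕ)
  (shortU : VertexSets.Short G (suc m) U) (3≤ℓ : 3 ≤ suc m)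
  (f : Fin (suc m) → Fin n) (f-inj : Injective _≡_ _≡_ f)
  (f∈U : ∀ i → U (f i) ≡ true) (f-adj : ∀ i → adj G (f i) (f (cnext i)) ≡ true) where

  open VertexSets G

  ℓ : ℕ
  ℓ = suc m

  -- Iterating `cnext` indexes the cycle by all natural numbers, so that positions past the end wrap
  -- around without subtraction.
  idx : ℕ → Fin ℓ
  idx zero = zero
  idx (suc i) = cnext (idx i)

  toℕ-idx : ∀ i → i < ℓ → toℕ (idx i) ≡ i
  toℕ-idx zero _ = refl
  toℕ-idx (suc i) i<ℓ with toℕ-idx i (≤-trans (n≤1+n _) i<ℓ) | cnext-cases (idx i)
  ... | e | inj₁ (p , q) = trans (cong toℕ q) (trans (toℕ-fromℕ< p) (cong suc e))
  ... | e | inj₂ (p , _) = contradiction (trans (cong suc (sym e)) p) (<⇒≢ i<ℓ)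

  idx-period : ∀ i → idx (i + ℓ) ≡ idx i
  idx-period zero with cnext-cases (idx m)
  ... | inj₁ (p , _) = contradiction p (<-irrefl (cong suc (toℕ-idx m ≤-refl)))
  ... | inj₂ (_ , q) = q
  idx-period (suc i) = cong cnext (idx-period i)

  cnext²≢ : ∀ i → i ≢ cnext (cnext i)
  cnext²≢ i e with cnext-cases i
  ... | inj₁ (p , q) with cnext-cases (cnext i)
  ... | inj₁ (p′ , q′) = contradiction (trans (cong toℕ (trans e q′)) (trans (toℕ-fromℕ< p′) (cong suc (trans (cong toℕ q) (toℕ-fromℕ< p))))) (<⇒≢ (≤-trans (n<1+n _) (n≤1+n _)))
  ... | inj₂ (p′ , q′) = <⇒≱ 3≤ℓ (≤-reflexive (trans (sym p′) (cong suc (trans (trans (cong toℕ q) (toℕ-fromℕ< p)) (cong suc (cong toℕ (trans e q′)))))))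
  cnext²≢ i e | inj₂ (p , q) with cnext-cases (cnext i)
  ... | inj₁ (p′ , q′) = <⇒≱ 3≤ℓ (≤-reflexive (trans (sym p) (cong suc (trans (cong toℕ (trans e q′)) (trans (toℕ-fromℕ< p′) (cong suc (cong toℕ q)))))))
  ... | inj₂ (p′ , q′) = <⇒≱ 3≤ℓ (≤-trans (≤-reflexive (trans (sym p) (cong suc (cong toℕ (trans e q′))))) (n≤1+n 1))

  x : ℕ → Fin n
  x i = f (idx i)

  x-period : ∀ i → x (i + ℓ) ≡ x i
  x-period i = cong f (idx-period i)

  along : ℕ → ℕ → List (Fin n)
  along i zero = []
  along i (suc s) = x (suc i) ∷ along (suc i) s

  along-nb : ∀ i s → NB (x i ∷ along i s)
  along-nb i zero = one
  along-nb i (suc zero) = two (f-adj (idx i))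
  along-nb i (suc (suc s)) = cons (f-adj (idx i)) (cnext²≢ (idx i) ∘ f-inj) (along-nb (suc i) (suc s))

  along-end : ∀ i s → x (i + s) ∈ x i ∷ along i s
  along-end i zero = here (cong x (+-identityʳ i))
  along-end i (suc s) = there (subst (λ j → x j ∈ x (suc i) ∷ along (suc i) s) (sym (+-suc i s)) (along-end (suc i) s))

  length-along : ∀ i s → length (along i s) ≡ s
  length-along i zero = refl
  length-along i (suc s) = cong suc (length-along (suc i) s)

  C : VSet
  C v = positive (∑ λ i → δ (f i) v)

  C⁻ : ∀ {v} → C v ≡ true → ∃ λ i → f i ≡ v
  C⁻ h = let i , p = 1≤∑⁻ (positive⁻ h) in i , 1≤δ⁻ p

  C⁺ : ∀ i → C (f i) ≡ true
  C⁺ i = positive⁺ (≤-trans (≤-reflexive (sym (δ-refl (f i)))) (term≤∑ (λ j → δ (f j) (f i)) i))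

  ⟦C⟧ : ∀ v → ⟦ C ⟧ v ≡ ∑ λ i → δ (f i) v
  ⟦C⟧ v = 𝟙-positive (∑≤1 (λ i → 𝟙≤1 _) λ i j p q → f-inj (trans (1≤δ⁻ p) (sym (1≤δ⁻ q))))
    where
    𝟙-positive : ∀ {k} → k ≤ 1 → 𝟙 (positive k) ≡ k
    𝟙-positive {zero} _ = refl
    𝟙-positive {suc zero} _ = refl
    𝟙-positive {suc (suc k)} (s≤s ())

  size-C : size C ≡ ℓ
  size-C = begin
    ∑ ⟦ C ⟧                        ≡⟨ ∑-cong ⟦C⟧ ⟩
    ∑ (λ v → ∑ λ i → δ (f i) v)    ≡⟨ ∑-swap (λ v i → δ (f i) v) ⟩
    ∑ (λ i → ∑ λ v → δ (f i) v)    ≡⟨ ∑-cong (λ i → trans (∑-cong λ v → sym (*-identityʳ (δ (f i) v))) (∑-δ (f i) (λ _ → 1))) ⟩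
    ∑ {ℓ} (λ _ → 1)                ≡⟨ trans (∑-const ℓ 1) (*-identityʳ ℓ) ⟩
    ℓ                              ∎
    where open ≡-Reasoning

  -- L i is the set of vertices at distance i + 1 (not i) from the cycle.
  B : ℕ → VSet
  B zero = C
  B (suc i) v = B i v ∨ (U v ∧ positive (dg ⟦ B i ⟧ v))

  X L R : ℕ → VSet
  X i = U ∖ B i
  L i v = X i v ∧ positive (dg ⟦ B i ⟧ v)
  R i = X i ∖ L i

  B⊆U : ∀ i → B i ⊆ U
  B⊆U zero h = let i , e = C⁻ h in subst (λ v → U v ≡ true) e (f∈U i)
  B⊆U (suc i) h with ∨-true h
  ... | inj₁ p = B⊆U i p
  ... | inj₂ p = proj₁ (∧-true p)

  B⊆B : ∀ i → B i ⊆ B (suc i)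
  B⊆B i h rewrite h = refl

  C⊆B : ∀ i → C ⊆ B i
  C⊆B zero h = h
  C⊆B (suc i) h = B⊆B i (C⊆B i h)

  L⁻ : ∀ i {v} → L i v ≡ true → X i v ≡ true × ∃ λ w → Adj v w × B i w ≡ true
  L⁻ i {v} h = let p , q = ∧-true h in p , neighbour (B i) v (positive⁻ q)

  L⊆X : ∀ i → L i ⊆ X i
  L⊆X i h = proj₁ (∧-true h)

  true≢false : ∀ {A : VSet} {v w} → A v ≡ true → A w ≡ false → v ≢ w
  true≢false p q refl = contradiction (trans (sym p) q) λ ()

  -- Each `climb` puts a vertex outside `B j` in front, while the rest of the walk and the cycle lie
  -- in `B j`. Hence the walk stays non-backtracking even when it continues along the cycle from its
  -- foot `x i`.
  data Descent (i : ℕ) : ℕ → Fin n → List (Fin n) → Set where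
    foot : Descent i 0 (x i) []
    climb : ∀ {j y z l} → Descent i j y l → U z ≡ true → B j z ≡ false → Adj z y → Descent i (suc j) z (y ∷ l)
    weaken : ∀ {j y l} → Descent i j y l → Descent i (suc j) y l

  module _ {i : ℕ} where

    descent-B : ∀ {j y l v} → Descent i j y l → v ∈ y ∷ l → B j v ≡ true
    descent-B foot (here refl) = C⁺ (idx i)
    descent-B (climb {j} {y} {z} d u b h) (here refl) =
      ∨-right (B j z) (cong₂ _∧_ u (positive⁺ (1≤dg (B j) h (descent-B d (here refl)))))
      where
      ∨-right : ∀ p {q} → q ≡ true → p ∨ q ≡ true
      ∨-right true _ = refl
      ∨-right false e = e
    descent-B (climb {j} d u b h) (there p) = B⊆B j (descent-B d p)
    descent-B (weaken {j} d) p = B⊆B j (descent-B d p)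

    descent-length : ∀ {j y l} → Descent i j y l → length l ≤ j
    descent-length foot = z≤n
    descent-length (climb d _ _ _) = s≤s (descent-length d)
    descent-length (weaken d) = ≤-trans (descent-length d) (n≤1+n _)

    descent-foot : ∀ {j y l} → Descent i j y l → x i ∈ y ∷ l
    descent-foot foot = here refl
    descent-foot (climb d _ _ _) = there (descent-foot d)
    descent-foot (weaken d) = descent-foot d

    nb-prepend : ∀ {y z r} {A : VSet} → NB (y ∷ r) → (∀ {v} → v ∈ y ∷ r → A v ≡ true) → A z ≡ false → Adj z y →
      NB (z ∷ y ∷ r)
    nb-prepend {r = []} nb h e zy = two zy
    nb-prepend {r = w ∷ r} {A} nb h e zy = cons zy (true≢false {A} (h (there (here refl))) e ∘ sym) nb

    along-C : ∀ j s {v} → v ∈ along j s → C v ≡ true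
    along-C j (suc s) (here refl) = C⁺ (idx (suc j))
    along-C j (suc s) (there p) = along-C (suc j) s p

    descent-along-B : ∀ {j y l} → Descent i j y l → ∀ s {v} → v ∈ y ∷ l ++ along i s → B j v ≡ true
    descent-along-B {j} {y} {l} d s p with ∈-++⁻ (y ∷ l) p
    ... | inj₁ q = descent-B d q
    ... | inj₂ q = C⊆B j (along-C i s q)

    descent-nb : ∀ {j y l} → Descent i j y l → ∀ s → NB (y ∷ l ++ along i s)
    descent-nb foot s = along-nb i s
    descent-nb (climb {j} d u b h) s = nb-prepend {A = B j} (descent-nb d s) (descent-along-B d s) b h
    descent-nb (weaken d) s = descent-nb d s

  descent : ∀ j {y} → B j y ≡ true → Σ ℕ λ i → i < ℓ × Σ (List (Fin n)) λ l → Descent i j y l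
  descent zero {y} h = let i , e = C⁻ h in toℕ i , toℕ<n i , [] ,
    subst (λ v → Descent (toℕ i) 0 v []) (trans (cong f (toℕ-injective (toℕ-idx (toℕ i) (toℕ<n i)))) e) foot
  descent (suc j) {y} h with B j y in e
  ... | true = let i , i<ℓ , l , d = descent j e in i , i<ℓ , l , weaken d
  ... | false = let u , p = ∧-true h ; w , yw , w∈ = neighbour (B j) y (positive⁻ p) ; i , i<ℓ , l , d = descent j w∈ in
    i , i<ℓ , w ∷ l , climb d u e yw

  -- A walk p ∷ c ∷ l of at most e links descending to the cycle vertex x i, which remains
  -- non-backtracking when continued along the cycle.
  record Ray (p c : Fin n) (e i : ℕ) : Set where
    field
      l : List (Fin n)
      nb : ∀ s → NB (p ∷ c ∷ l ++ along i s)
      len : length (c ∷ l) ≤ e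
      foot∈ : x i ∈ c ∷ l
      inU : ∀ {v} → v ∈ p ∷ c ∷ l → U v ≡ true
      i<ℓ : i < ℓ

  open Ray

  ray : ∀ j {p c} → X j p ≡ true → Adj p c → B j c ≡ true → ∃ (Ray p c (suc j))
  ray j {p} {c} p∈X pc c∈B = let i , i<ℓ , l , d = descent j c∈B ; p∈U , p∉B = ∖⁻ U (B j) p∈X in i , record
    { l = l ; nb = λ s → nb-prepend {i} {A = B j} (descent-nb d s) (descent-along-B d s) p∉B pc
    ; len = s≤s (descent-length d) ; foot∈ = descent-foot d
    ; inU = λ { (here refl) → p∈U ; (there q) → B⊆U j (descent-B d q) } ; i<ℓ = i<ℓ }

  ray-cons : ∀ {p c e i r} → U r ≡ true → Adj r p → r ≢ c → Ray p c e i → Ray r p (suc e) i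
  ray-cons r∈U rp r≢c ρ = record
    { l = _ ∷ l ρ ; nb = λ s → cons rp r≢c (nb ρ s) ; len = s≤s (len ρ) ; foot∈ = there (foot∈ ρ)
    ; inU = λ { (here refl) → r∈U ; (there q) → inU ρ q } ; i<ℓ = i<ℓ ρ }

  -- Two rays from one vertex form an ear between the feet `x i` and `x j`. It closes up with each
  -- of the two arcs of the cycle between them, and neither closed walk may be shorter than ℓ.
  record EarBound (e i j : ℕ) : Set where
    constructor _,_
    field
      up : ∀ s → x (i + s) ≡ x j → ℓ ≤ e + s
      down : ∀ s → x (j + s) ≡ x i → ℓ ≤ e + s

  private
    -- The walk runs up the second ray, down the first and s steps along the cycle, where `x j` is
    -- met again. Equal feet are included, as the case s = 0.
    half-ear : ∀ {p c c′ e e′ i j} → Ray p c e i → Ray p c′ e′ j → c ≢ c′ → ∀ s → x (i + s) ≡ x j → ℓ ≤ e + e′ + s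
    half-ear {p} {c} {c′} {e} {e′} {i} {j} ρ ρ′ c≢c′ s eq = ≮⇒≥ λ lt → contradiction end
      (unique-ʳ++ (c′ ∷ l ρ′) (shortU (nb-glue (l ρ′) nb₁ nb₂) inside (fits lt)) (foot∈ ρ′))
      where
      tail : List (Fin n)
      tail = c ∷ l ρ ++ along i s
      nb₁ : NB (p ∷ c′ ∷ l ρ′)
      nb₁ = subst (λ k → NB (p ∷ c′ ∷ k)) (++-identityʳ (l ρ′)) (nb ρ′ 0)
      nb₂ : NB (c′ ∷ p ∷ tail)
      nb₂ = cons (Adj-sym (nb-head nb₁)) (c≢c′ ∘ sym) (nb ρ s)
      end : x j ∈ p ∷ tail
      end = there (subst (_∈ tail) eq (reach-end (foot∈ ρ)))
        where
        reach-end : x i ∈ c ∷ l ρ → x (i + s) ∈ tail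
        reach-end q = [ (λ e → ∈-++⁺ˡ {xs = c ∷ l ρ} (subst (_∈ c ∷ l ρ) e q)) , (λ r → ∈-++⁺ʳ (c ∷ l ρ) r) ]′ (split (along-end i s))
          where
          split : x (i + s) ∈ x i ∷ along i s → x i ≡ x (i + s) ⊎ x (i + s) ∈ along i s
          split (here e) = inj₁ (sym e)
          split (there r) = inj₂ r
      inside : ∀ {v} → v ∈ l ρ′ ʳ++ c′ ∷ p ∷ tail → U v ≡ true
      inside q with ∈-ʳ++⁻ (l ρ′) q
      ... | inj₁ r = inU ρ′ (there (there r))
      ... | inj₂ (here refl) = inU ρ′ (there (here refl))
      ... | inj₂ (there (here refl)) = inU ρ (here refl)
      ... | inj₂ (there (there r)) with ∈-++⁻ (c ∷ l ρ) r
      ... | inj₁ t = inU ρ (there t)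
      ... | inj₂ t = B⊆U 0 (along-C {0} i s t)
      fits : suc (e + e′ + s) ≤ ℓ → length (l ρ′ ʳ++ c′ ∷ p ∷ tail) ≤ ℓ
      fits lt = ≤-trans (≤-reflexive (trans (length-ʳ++ (l ρ′)) (cong (λ k → length (l ρ′) + (3 + k))
        (trans (length-++ (l ρ)) (cong (length (l ρ) +_) (length-along i s))))))
        (go (length (l ρ)) (length (l ρ′)) e e′ s ℓ (len ρ) (len ρ′) lt)
        where
        go : ∀ a b e e′ s ℓ → suc a ≤ e → suc b ≤ e′ → suc (e + e′ + s) ≤ ℓ → b + (3 + (a + s)) ≤ ℓ
        go a b e e′ s ℓ h₁ h₂ h₃ = linarith 0 (h₁ ⊕ h₂ ⊕ h₃) (solve (a ∷ b ∷ e ∷ e′ ∷ s ∷ ℓ ∷ []))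

  ear : ∀ {p c c′ e e′ i j} → Ray p c e i → Ray p c′ e′ j → c ≢ c′ → EarBound (e + e′) i j
  ear {e = e} {e′} ρ ρ′ ne = half-ear ρ ρ′ ne , λ s eq → ≤-trans (half-ear ρ′ ρ (ne ∘ sym) s eq) (≤-reflexive (cong (_+ s) (+-comm e′ e)))

  private
    spread : ∀ {e i j} → j < ℓ → i ≤ j → EarBound e i j → ℓ + i ≤ e + j × j ≤ e + i
    spread {e} {i} {j} j<ℓ i≤j (up , down)
      with m≤n⇒∃[o]m+o≡n i≤j | m≤n⇒∃[o]m+o≡n (≤-trans (<⇒≤ j<ℓ) (m≤n+m ℓ i))
    ... | s , p | t , q = go₁ ℓ i j e s (up s (cong x p)) p ,
      go₂ ℓ i j e t (down t (trans (cong x q) (x-period i))) q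
      where
      go₁ : ∀ ℓ i j e s → ℓ ≤ e + s → i + s ≡ j → ℓ + i ≤ e + j
      go₁ ℓ i _ e s h refl = linarith 0 h (solve (ℓ ∷ i ∷ e ∷ s ∷ []))
      go₂ : ∀ ℓ i j e t → ℓ ≤ e + t → j + t ≡ i + ℓ → j ≤ e + i
      go₂ ℓ i j e t h q = linarith 0 (h ⊕ ≤-reflexive q) (solve (ℓ ∷ i ∷ j ∷ e ∷ t ∷ []))

    swap-ear : ∀ {e i j} → EarBound e i j → EarBound e j i
    swap-ear (p , q) = q , p

    two-feet : ∀ e i j → i < ℓ → j < ℓ → EarBound e i j → ℓ ≤ 2 * e
    two-feet e i j i<ℓ j<ℓ b with ≤-total i j
    ... | inj₁ i≤j = let p , q = spread {e} j<ℓ i≤j b in go ℓ e i j p q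
      where
      go : ∀ ℓ e i j → ℓ + i ≤ e + j → j ≤ e + i → ℓ ≤ 2 * e
      go ℓ e i j p q = linarith 0 (p ⊕ q) (solve (ℓ ∷ e ∷ i ∷ j ∷ []))
    ... | inj₂ j≤i = let p , q = spread {e} i<ℓ j≤i (swap-ear {e} b) in go ℓ e j i p q
      where
      go : ∀ ℓ e i j → ℓ + i ≤ e + j → j ≤ e + i → ℓ ≤ 2 * e
      go ℓ e i j p q = linarith 0 (p ⊕ q) (solve (ℓ ∷ e ∷ i ∷ j ∷ []))

    -- Three feet cut the cycle into three arcs of total length ℓ. Each arc together with its ear
    -- has length at least ℓ, so 3 ℓ ≤ d + e + f + ℓ.
    ordered-feet : ∀ d e f i j k → i ≤ j → j ≤ k → j < ℓ → k < ℓ →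
      EarBound d i j → EarBound e j k → EarBound f i k → 2 * ℓ ≤ d + e + f
    ordered-feet d e f i j k i≤j j≤k j<ℓ k<ℓ b₁ b₂ b₃ =
      go ℓ d e f i j k (proj₁ (spread {d} j<ℓ i≤j b₁)) (proj₁ (spread {e} k<ℓ j≤k b₂)) (proj₂ (spread {f} k<ℓ (≤-trans i≤j j≤k) b₃))
      where
      go : ∀ ℓ d e f i j k → ℓ + i ≤ d + j → ℓ + j ≤ e + k → k ≤ f + i → 2 * ℓ ≤ d + e + f
      go ℓ d e f i j k p q r = linarith 0 (p ⊕ q ⊕ r) (solve (ℓ ∷ d ∷ e ∷ f ∷ i ∷ j ∷ k ∷ []))

    three-feet : ∀ d e f i j k → i < ℓ → j < ℓ → k < ℓ →
      EarBound d i j → EarBound e j k → EarBound f i k → 2 * ℓ ≤ d + e + f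
    three-feet d e f i j k i<ℓ j<ℓ k<ℓ b₁ b₂ b₃ with ≤-total i j | ≤-total j k | ≤-total i k
    ... | inj₁ p | inj₁ q | _ = ordered-feet d e f i j k p q j<ℓ k<ℓ b₁ b₂ b₃
    ... | inj₁ p | inj₂ q | inj₁ r = ≤-trans (ordered-feet f e d i k j r q k<ℓ j<ℓ b₃ (swap-ear {e} b₂) b₁) (≤-reflexive (perm f e d))
      where
      perm : ∀ a b c → a + b + c ≡ c + b + a
      perm = solve-∀
    ... | inj₁ p | inj₂ q | inj₂ r = ≤-trans (ordered-feet f d e k i j r p i<ℓ j<ℓ (swap-ear {f} b₃) b₁ (swap-ear {e} b₂)) (≤-reflexive (perm f d e))
      where
      perm : ∀ a b c → a + b + c ≡ b + c + a
      perm = solve-∀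
    ... | inj₂ p | inj₁ q | inj₁ r = ≤-trans (ordered-feet d f e j i k p r i<ℓ k<ℓ (swap-ear {d} b₁) b₃ b₂) (≤-reflexive (perm d f e))
      where
      perm : ∀ a b c → a + b + c ≡ a + c + b
      perm = solve-∀
    ... | inj₂ p | inj₁ q | inj₂ r = ≤-trans (ordered-feet e f d j k i q r k<ℓ i<ℓ b₂ (swap-ear {f} b₃) (swap-ear {d} b₁)) (≤-reflexive (perm e f d))
      where
      perm : ∀ a b c → a + b + c ≡ c + a + b
      perm = solve-∀
    ... | inj₂ p | inj₂ q | _ = ≤-trans (ordered-feet e d f k j i q p j<ℓ i<ℓ (swap-ear {e} b₂) (swap-ear {d} b₁) (swap-ear {f} b₃)) (≤-reflexive (cong (_+ f) (+-comm e d)))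

  two-rays : ∀ {p c c′ e e′ i j} → Ray p c e i → Ray p c′ e′ j → c ≢ c′ → ℓ ≤ 2 * (e + e′)
  two-rays {e = e} {e′} {i} {j} ρ ρ′ ne = two-feet (e + e′) i j (i<ℓ ρ) (i<ℓ ρ′) (ear ρ ρ′ ne)

  three-rays : ∀ {p c c′ c″ e e′ e″ i j k} → Ray p c e i → Ray p c′ e′ j → Ray p c″ e″ k →
    c ≢ c′ → c′ ≢ c″ → c ≢ c″ → ℓ ≤ e + e′ + e″
  three-rays {e = e} {e′} {e″} {i} {j} {k} ρ ρ′ ρ″ n₁ n₂ n₃ = *-cancelˡ-≤ 2 (≤-trans
    (three-feet (e + e′) (e′ + e″) (e + e″) i j k (i<ℓ ρ) (i<ℓ ρ′) (i<ℓ ρ″) (ear ρ ρ′ n₁) (ear ρ′ ρ″ n₂) (ear ρ ρ″ n₃))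
    (≤-reflexive (double e e′ e″)))
    where
    double : ∀ e e′ e″ → e + e′ + (e′ + e″) + (e + e″) ≡ 2 * (e + e′ + e″)
    double = solve-∀

  L-ray : ∀ j {r c} → U r ≡ true → B j r ≡ false → Adj r c → L j c ≡ true → ∃ (Ray r c (suc (suc j)))
  L-ray j {r} {c} r∈U r∉B rc c∈L = let c∈X , w , cw , w∈B = L⁻ j c∈L ; i , ρ = ray j c∈X cw w∈B in
    i , ray-cons r∈U rc (true≢false {B j} w∈B r∉B ∘ sym) ρ

  -- Two neighbours in the ball start two rays of at most j + 1 links, against `two-rays`. The next
  -- two lemmas use rays of j + 1 and j + 2 links and two rays of j + 2 links, whence the different
  -- limits on j.
  dg-B≤1 : ∀ j → 4 * suc j < ℓ → ∀ {v} → X j v ≡ true → dg ⟦ B j ⟧ v ≤ 1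
  dg-B≤1 j lt {v} v∈X = ≮⇒≥ λ 2≤dg →
    let y , vy , y∈B = neighbour (B j) v (≤-trans (n≤1+n 1) 2≤dg)
        z , y≢z , vz , z∈B = neighbour≢ (B j) v 2≤dg y
        _ , ρ = ray j v∈X vy y∈B ; _ , ρ′ = ray j v∈X vz z∈B
    in <⇒≱ lt (≤-trans (two-rays ρ ρ′ y≢z) (≤-reflexive (go j)))
    where
    go : ∀ j → 2 * (suc j + suc j) ≡ 4 * suc j
    go = solve-∀

  L-independent : ∀ j → 4 * suc j + 2 < ℓ → ∀ {v w} → L j v ≡ true → L j w ≡ true → ¬ Adj v w
  L-independent j lt {v} {w} v∈L w∈L vw =
    let v∈X , y , vy , y∈B = L⁻ j v∈L ; v∈U , v∉B = ∖⁻ U (B j) v∈X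
        w∉B = proj₂ (∖⁻ U (B j) (L⊆X j w∈L))
        _ , ρ = ray j v∈X vy y∈B ; _ , ρ′ = L-ray j v∈U v∉B vw w∈L
    in <⇒≱ lt (≤-trans (two-rays ρ ρ′ (true≢false {B j} y∈B w∉B)) (≤-reflexive (go j)))
    where
    go : ∀ j → 2 * (suc j + suc (suc j)) ≡ 4 * suc j + 2
    go = solve-∀

  dg-L≤1 : ∀ j → 4 * suc (suc j) < ℓ → ∀ {v} → X j v ≡ true → dg ⟦ L j ⟧ v ≤ 1
  dg-L≤1 j lt {v} v∈X = ≮⇒≥ λ 2≤dg →
    let v∈U , v∉B = ∖⁻ U (B j) v∈X
        y , vy , y∈L = neighbour (L j) v (≤-trans (n≤1+n 1) 2≤dg)
        z , y≢z , vz , z∈L = neighbour≢ (L j) v 2≤dg y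
        _ , ρ = L-ray j v∈U v∉B vy y∈L ; _ , ρ′ = L-ray j v∈U v∉B vz z∈L
    in <⇒≱ lt (≤-trans (two-rays ρ ρ′ y≢z) (≤-reflexive (go j)))
    where
    go : ∀ j → 2 * (suc (suc j) + suc (suc j)) ≡ 4 * suc (suc j)
    go = solve-∀

-- Growth in a minimal set

-- A lower bound for the size of the ball of radius j around a shortest cycle: more than half of the
-- (k - 2) q half-edges leaving a ball of size q lead to new vertices.
Q : ℕ → ℕ → ℕ → ℕ
Q k g zero = g
Q k g (suc j) = ⌈ k * Q k g j + 1 /2⌉

⌈/2⌉≤ : ∀ {m n} → m ≤ 2 * n → ⌈ m /2⌉ ≤ n
⌈/2⌉≤ {m} {n} h = ≤-trans (⌈n/2⌉-mono h) (≤-reflexive (trans (cong (λ y → ⌈ n + y /2⌉) (+-identityʳ n)) (sym (n≡⌈n+n/2⌉ n))))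

≤2*⌈/2⌉ : ∀ m → m ≤ 2 * ⌈ m /2⌉
≤2*⌈/2⌉ m = ≤-trans (≤-reflexive (sym (⌊n/2⌋+⌈n/2⌉≡n m)))
  (≤-trans (+-monoˡ-≤ ⌈ m /2⌉ (⌊n/2⌋≤⌈n/2⌉ m)) (≤-reflexive (cong (⌈ m /2⌉ +_) (sym (+-identityʳ _)))))

-- Inserting l ≤ t and z ≤ 2 t leaves κ (q - g) + (κ - 2) t ≤ 0, so every inequality used is an
-- equality; for t < g the forest bound would even put -2 on the right.
extremal : ∀ κ g q t z l → 2 ≤ κ → g ≤ q → l ≤ t → t ≤ g →
  (2 + κ) * (q + t) ≤ κ * g + 2 * q + z + 2 * l → 1 ≤ t → z ≤ 2 * t → (t < g → z + 2 ≤ 2 * t) →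
  κ ≡ 2 × q ≡ g × t ≡ g × l ≡ t × 2 * t ≤ z
extremal κ g q t z l 2≤κ g≤q l≤t t≤g h 1≤t z≤2t forest
  with m≤n⇒∃[o]m+o≡n 2≤κ | m≤n⇒∃[o]m+o≡n g≤q | m≤n⇒∃[o]m+o≡n l≤t | m≤n⇒m<n∨m≡n t≤g
... | κ′ , refl | q′ , refl | t′ , refl | inj₁ t<g = ⊥-elim (clash κ′ q′ t′ g z l h (forest t<g))
  where
  clash : ∀ κ′ q′ t′ g z l → (2 + (2 + κ′)) * ((g + q′) + (l + t′)) ≤ (2 + κ′) * g + 2 * (g + q′) + z + 2 * l →
    z + 2 ≤ 2 * (l + t′) → ⊥
  clash κ′ q′ t′ g z l h h′ =
    impossible (1 + (2 + κ′) * q′ + κ′ * (l + t′) + 2 * t′) (h ⊕ h′) (solve (κ′ ∷ q′ ∷ t′ ∷ g ∷ z ∷ l ∷ []))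
... | κ′ , refl | q′ , refl | t′ , refl | inj₂ e = let (a , b , c) , d = zeros κ′ q′ t′ g z l 1≤t h z≤2t in
  cong (2 +_) a , trans (cong (g +_) b) (+-identityʳ g) , e , sym (trans (cong (l +_) c) (+-identityʳ l)) , d
  where
  clash : ∀ κ′ q′ t′ g z l → 1 ≤ l + t′ →
    (2 + (3 + κ′)) * ((g + q′) + (l + t′)) ≤ (3 + κ′) * g + 2 * (g + q′) + z + 2 * l → z ≤ 2 * (l + t′) → ⊥
  clash κ′ q′ t′ g z l p h h′ =
    impossible (κ′ * (l + t′) + (3 + κ′) * q′ + 2 * t′) (h ⊕ h′ ⊕ p) (solve (κ′ ∷ q′ ∷ t′ ∷ g ∷ z ∷ l ∷ []))
  zeros : ∀ κ′ q′ t′ g z l → 1 ≤ l + t′ →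
    (2 + (2 + κ′)) * ((g + q′) + (l + t′)) ≤ (2 + κ′) * g + 2 * (g + q′) + z + 2 * l → z ≤ 2 * (l + t′) →
    (κ′ ≡ 0 × q′ ≡ 0 × t′ ≡ 0) × 2 * (l + t′) ≤ z
  zeros (suc κ′) q′ t′ g z l p h h′ = ⊥-elim (clash κ′ q′ t′ g z l p h h′)
  zeros zero (suc q′) t′ g z l p h h′ = ⊥-elim (impossible (1 + 2 * q′ + 2 * t′) (h ⊕ h′) (solve (q′ ∷ t′ ∷ g ∷ z ∷ l ∷ [])))
  zeros zero zero (suc t′) g z l p h h′ = ⊥-elim (impossible (1 + 2 * t′) (h ⊕ h′) (solve (t′ ∷ g ∷ z ∷ l ∷ [])))
  zeros zero zero zero g z l p h h′ = (refl , refl , refl) , linarith 0 h (solve (g ∷ z ∷ l ∷ []))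

abstract
  no-r : ∀ g q l r z R a → 3 * (q + (l + r)) ≤ 1 * g + 2 * q + z + 2 * l → g ≤ q → 1 ≤ l + r → z ≤ R + 2 * a →
    a ≤ r → R ≤ 0 → ⊥
  no-r g q l r z R a h h₁ h₂ h₃ h₄ h₅ = impossible 0 (h ⊕ h₁ ⊕ h₂ ⊕ h₃ ⊕ 2 ⊗ h₄ ⊕ h₅) (solve (g ∷ q ∷ l ∷ r ∷ z ∷ R ∷ a ∷ []))
  no-l : ∀ g q l r z → 3 * (q + (l + r)) ≤ 1 * g + 2 * q + z + 2 * l → g ≤ q → 1 ≤ l + r → z ≤ 2 * (l + r) →
    l ≤ 0 → ⊥
  no-l g q l r z h h₁ h₂ h₃ h₄ = impossible 0 (h ⊕ h₁ ⊕ h₂ ⊕ h₃ ⊕ 2 ⊗ h₄) (solve (g ∷ q ∷ l ∷ r ∷ z ∷ []))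
  both : ∀ g q l r z R a → 3 * (q + (l + r)) ≤ 1 * g + 2 * q + z + 2 * l → g ≤ q →
    z ≤ 2 * (l + r) → z ≤ R + 2 * a → R + 2 ≤ 2 * r → a ≤ r → ⊥
  both g q l r z R a h h₁ h₂ h₃ h₄ h₅ =
    impossible 1 (2 ⊗ h ⊕ 2 ⊗ h₁ ⊕ h₂ ⊕ h₃ ⊕ h₄ ⊕ 2 ⊗ h₅) (solve (g ∷ q ∷ l ∷ r ∷ z ∷ R ∷ a ∷ []))

-- The balance reads (q - g) + 3 t ≤ z + 2 l. If r = 0 then z = 0; if l = 0 then z ≤ 2 t suffices.
-- Otherwise z ≤ 2 t and z ≤ R + 2 a ≤ 4 r - 2 both hold, and their sum stays below 6 t - 4 l = 2 l
-- + 6 r, which twice the balance demands.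
cubic-extremal : ∀ κ g q t l r z R a → κ ≡ 1 → t ≡ l + r → (2 + κ) * (q + t) ≤ κ * g + 2 * q + z + 2 * l → g ≤ q →
  t ≤ g → 1 ≤ t → z ≤ 2 * t → z ≡ R + 2 * a → a ≤ r → (r ≡ 0 → R ≡ 0) → (1 ≤ r → r < g → R + 2 ≤ 2 * r) → ⊥
cubic-extremal _ g q _ l r z R a refl refl h g≤q t≤g 1≤t z≤ e a≤r R≡0 RR = cases (l ≟ⁿ 0) (r ≟ⁿ 0)
  where
  cases : Dec (l ≡ 0) → Dec (r ≡ 0) → ⊥
  cases _ (yes r≡0) = no-r g q l r z R a h g≤q 1≤t (≤-reflexive e) a≤r (≤-reflexive (R≡0 r≡0))
  cases (yes l≡0) (no _) = no-l g q l r z h g≤q 1≤t z≤ (≤-reflexive l≡0)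
  cases (no l≢0) (no r≢0) = both g q l r z R a h g≤q z≤ (≤-reflexive e)
    (RR (n≢0⇒n>0 r≢0) (≤-trans (+-monoˡ-≤ r (n≢0⇒n>0 l≢0)) t≤g)) a≤r

abstract
  next>g : ∀ κ g q q′ → 1 ≤ κ → 1 ≤ g → g ≤ q → (2 + κ) * q + 1 ≤ 2 * q′ → g < q′
  next>g (suc κ) (suc g) q q′ _ _ h₁ h₂ = *-cancelˡ-≤ 2 (go κ g q q′ h₁ h₂)
    where
    go : ∀ κ g q q′ → 1 + g ≤ q → (2 + (1 + κ)) * q + 1 ≤ 2 * q′ → 2 * (1 + (1 + g)) ≤ 2 * q′
    go κ g q q′ h₁ h₂ = linarith (g + κ * q) (3 ⊗ h₁ ⊕ h₂) (solve (κ ∷ g ∷ q ∷ q′ ∷ []))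

  weak-remainder : ∀ g q t z l → 3 * (q + t) ≤ 1 * g + 2 * q + z + 2 * l → z + 2 ≤ 2 * t → q + t + 2 ≤ g + 2 * l
  weak-remainder g q t z l h h′ = linarith 0 (h ⊕ h′) (solve (g ∷ q ∷ t ∷ z ∷ l ∷ []))

  [3,6]-arith : ∀ q t l → 6 ≤ q → l ≤ t → q + t + 2 ≤ 6 + 2 * l → 8 ≤ q + t
  [3,6]-arith q t l h₁ h₂ h₃ = linarith 0 (2 ⊗ h₁ ⊕ 2 ⊗ h₂ ⊕ h₃) (solve (q ∷ t ∷ l ∷ []))

  [3,7]-r : ∀ q t l r → 7 ≤ q → t ≡ l + r → l ≤ t → q + t + 2 ≤ 7 + 2 * l → q + t ≤ 9 → r ≤ 0
  [3,7]-r q t l r h₁ h₂ h₃ h₄ h₅ = *-cancelˡ-≤ 2 (linarith 0 (2 ⊗ h₁ ⊕ 2 ⊗ ≤-reflexive (sym h₂) ⊕ h₄ ⊕ h₅) (solve (q ∷ t ∷ l ∷ r ∷ [])))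

  [3,7]-arith : ∀ q t z l → 3 * (q + t) ≤ 1 * 7 + 2 * q + z + 2 * l → z ≤ 0 → 7 ≤ q → l ≤ t → 1 ≤ t → ⊥
  [3,7]-arith q t z l h h₁ h₂ h₃ h₄ = impossible 0 (h ⊕ h₁ ⊕ h₂ ⊕ 2 ⊗ h₃ ⊕ h₄) (solve (q ∷ t ∷ z ∷ l ∷ []))

  [3,8]-no-edge : ∀ q t l r z a → t ≡ l + r → 3 * (q + t) ≤ 1 * 8 + 2 * q + z + 2 * l → q + t + 2 ≤ 8 + 2 * l → 8 ≤ q →
    z ≤ 2 * a → a ≤ 2 * r → ⊥
  [3,8]-no-edge q t l r z a e h h₁ h₂ h₃ h₄ = 
    impossible 1 (h ⊕ h₁ ⊕ 2 ⊗ h₂ ⊕ h₃ ⊕ 2 ⊗ h₄ ⊕ 4 ⊗ ≤-reflexive (sym e)) (solve (q ∷ t ∷ l ∷ r ∷ z ∷ a ∷ []))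

  [3,8]-edge : ∀ q t l r z a R → t ≡ l + r → 3 * (q + t) ≤ 1 * 8 + 2 * q + z + 2 * l → q + t + 2 ≤ 8 + 2 * l → 8 ≤ q → q + t ≤ 14 →
    z ≤ R + 2 * a → R + 2 ≤ 2 * r → a + 2 ≤ 2 * r → ⊥
  [3,8]-edge q t l r z a R e h h₁ h₂ h₃ h₄ h₅ h₆ =
    impossible 3 (h ⊕ 2 ⊗ h₁ ⊕ 4 ⊗ h₂ ⊕ h₃ ⊕ h₄ ⊕ h₅ ⊕ 2 ⊗ h₆ ⊕ 6 ⊗ ≤-reflexive (sym e)) (solve (q ∷ t ∷ l ∷ r ∷ z ∷ a ∷ R ∷ []))

-- lower bounds N for the order of a nontrivial (κ + 2, g, s)-multipole with s ≤ κ g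
data Bound : ℕ → ℕ → ℕ → Set where
  generic : ∀ {κ g N} j → 2 ≤ κ → 3 ≤ κ ⊎ 6 ≤ g → 4 * suc j < g →
    N ≤ Q (2 + κ) g j + suc g ⊎ N ≤ Q (2 + κ) g (suc j) → Bound κ g N
  cubic : ∀ {g N} j → 4 * suc (suc j) < g → N ≤ Q 3 g j + suc g ⊎ N ≤ Q 3 g (suc j) → Bound 1 g N
  [4,5] : Bound 2 5 10
  [3,5] : Bound 1 5 6
  [3,6] : Bound 1 6 8
  [3,7] : Bound 1 7 10
  [3,8] : Bound 1 8 15

module Minimal {n} (G : Multipole n) (U : Fin n → Bool) (m : ℕ)
  (shortU : VertexSets.Short G (suc m) U) (3≤ℓ : 3 ≤ suc m)
  (f : Fin (suc m) → Fin n) (f-inj : Injective _≡_ _≡_ f)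
  (f∈U : ∀ i → U (f i) ≡ true) (f-adj : ∀ i → adj G (f i) (f (cnext i)) ≡ true)
  (κ g : ℕ) (1≤κ : 1 ≤ κ) (5≤g : 5 ≤ g) (g≤ℓ : g ≤ suc m)
  (g<U : g < VertexSets.size G U)
  (dense : (2 + κ) * VertexSets.size G U ≤ κ * g + VertexSets.arcs G (VertexSets.⟦_⟧ G U) (VertexSets.⟦_⟧ G U))
  (minimal : ∀ W → VertexSets._⊆_ G W U → g < VertexSets.size G W → VertexSets.size G W < VertexSets.size G U →
    κ * g + VertexSets.arcs G (VertexSets.⟦_⟧ G W) (VertexSets.⟦_⟧ G W) < (2 + κ) * VertexSets.size G W) where

  open VertexSets G
  open Neighbourhood G U m shortU 3≤ℓ f f-inj f∈U f-adj

  q t l r Z : ℕ → ℕ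
  q j = size (B j)
  t j = size (X j)
  l j = size (L j)
  r j = size (R j)
  Z j = arcs ⟦ X j ⟧ ⟦ X j ⟧

  X⊆U : ∀ j → X j ⊆ U
  X⊆U j h = proj₁ (∖⁻ U (B j) h)

  R⊆X : ∀ j → R j ⊆ X j
  R⊆X j h = proj₁ (∖⁻ (X j) (L j) h)

  U≡q+t : ∀ j → size U ≡ q j + t j
  U≡q+t j = size-split U (B j) (B⊆U j)

  t≡l+r : ∀ j → t j ≡ l j + r j
  t≡l+r j = size-split (X j) (L j) (L⊆X j)

  l≤t : ∀ j → l j ≤ t j
  l≤t j = ≤-trans (m≤m+n (l j) (r j)) (≤-reflexive (sym (t≡l+r j)))

  B-split : ∀ j v → ⟦ B (suc j) ⟧ v ≡ ⟦ B j ⟧ v + ⟦ L j ⟧ v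
  B-split j v with B j v | U v
  ... | true | true = refl
  ... | true | false = refl
  ... | false | true = refl
  ... | false | false = refl

  q-suc : ∀ j → q (suc j) ≡ q j + l j
  q-suc j = trans (∑-cong (B-split j)) (∑-+ _ _)

  q-mono : ∀ j → ℓ ≤ q j
  q-mono zero = ≤-reflexive (sym size-C)
  q-mono (suc j) = ≤-trans (q-mono j) (≤-trans (m≤m+n (q j) (l j)) (≤-reflexive (sym (q-suc j))))

  g≤q : ∀ j → g ≤ q j
  g≤q j = ≤-trans g≤ℓ (q-mono j)

  arcs-XB : ∀ j → 4 * suc j < ℓ → arcs ⟦ X j ⟧ ⟦ B j ⟧ ≤ l j
  arcs-XB j lt = ∑-mono λ v → bound (X j v) (dg ⟦ B j ⟧ v) (λ h → dg-B≤1 j lt h)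
    where
    bound : ∀ b d → (b ≡ true → d ≤ 1) → 𝟙 b * d ≤ 𝟙 (b ∧ positive d)
    bound false d _ = z≤n
    bound true zero _ = z≤n
    bound true (suc zero) _ = ≤-refl
    bound true (suc (suc d)) h = contradiction (h refl) λ { (s≤s ()) }

  arcs-LB : ∀ j → 4 * suc j < ℓ → arcs ⟦ L j ⟧ ⟦ B j ⟧ ≤ l j
  arcs-LB j lt = ∑-mono λ v → ≤-trans (𝟙*-mono (L j v) λ h → dg-B≤1 j lt (L⊆X j h)) (≤-reflexive (*-identityʳ _))

  arcs-LL : ∀ j → 4 * suc j + 2 < ℓ → arcs ⟦ L j ⟧ ⟦ L j ⟧ ≡ 0
  arcs-LL j lt = ∑-zero λ v → trans (𝟙*-cong (L j v) λ h → ¬1≤⇒≡0 λ p →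
    let w , vw , w∈ = neighbour (L j) v p in L-independent j lt h w∈ vw) (*-zeroʳ (𝟙 (L j v)))

  -- At most as many links as vertices, as in a connected graph with one cycle; in a regular
  -- multipole at least κ q half-edges then leave the ball.
  Thin : ℕ → Set
  Thin j = arcs ⟦ B j ⟧ ⟦ B j ⟧ ≤ 2 * q j

  thin-zero : Thin 0
  thin-zero = arcs≤2size C 3≤ℓ (Short-⊆ (B⊆U 0) shortU) (≤-reflexive size-C)

  thin-suc : ∀ j → 4 * suc j + 2 < ℓ → Thin j → Thin (suc j)
  thin-suc j lt thin = ≤-trans (≤-reflexive (arcs-split ⟦ B (suc j) ⟧ ⟦ B j ⟧ ⟦ L j ⟧ (B-split j)))
    (go _ _ _ (q j) (l j) (q (suc j)) thin (arcs-LL j lt)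
      (≤-trans (≤-reflexive (arcs-sym ⟦ B j ⟧ ⟦ L j ⟧)) (arcs-LB j (≤-trans (s≤s (m≤m+n (4 * suc j) 2)) lt))) (q-suc j))
    where
    go : ∀ b z e q l q′ → b ≤ 2 * q → z ≡ 0 → e ≤ l → q′ ≡ q + l → b + z + 2 * e ≤ 2 * q′
    go b _ e q l _ h refl h′ refl = linarith 0 (h ⊕ 2 ⊗ h′) (solve (b ∷ e ∷ q ∷ l ∷ []))

  -- Density of U with its links sorted into those of the ball, those of the rest and those between,
  -- of which `dg-B≤1` allows only one at each vertex of `L j`.
  balance : ∀ j → 4 * suc j < ℓ → Thin j → (2 + κ) * (q j + t j) ≤ κ * g + 2 * q j + Z j + 2 * l j
  balance j lt thin = go κ g (size U) _ (q j) (t j) _ (Z j) _ (l j) dense (U≡q+t j)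
    (arcs-split ⟦ U ⟧ ⟦ B j ⟧ ⟦ X j ⟧ (⊆-split U (B j) (B⊆U j))) thin
    (≤-trans (≤-reflexive (arcs-sym ⟦ B j ⟧ ⟦ X j ⟧)) (arcs-XB j lt))
    where
    go : ∀ κ g u a q t b z e l → (2 + κ) * u ≤ κ * g + a → u ≡ q + t → a ≡ b + z + 2 * e → b ≤ 2 * q → e ≤ l →
      (2 + κ) * (q + t) ≤ κ * g + 2 * q + z + 2 * l
    go κ g _ _ q t b z e l h refl refl h₁ h₂ = linarith 0 (h ⊕ h₁ ⊕ 2 ⊗ h₂) (solve (κ ∷ g ∷ q ∷ t ∷ b ∷ z ∷ e ∷ l ∷ []))

  Z-split : ∀ j → Z j ≡ arcs ⟦ L j ⟧ ⟦ L j ⟧ + arcs ⟦ R j ⟧ ⟦ R j ⟧ + 2 * arcs ⟦ R j ⟧ ⟦ L j ⟧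
  Z-split j = trans (arcs-split ⟦ X j ⟧ ⟦ L j ⟧ ⟦ R j ⟧ (⊆-split (X j) (L j) (L⊆X j)))
    (cong (λ y → arcs ⟦ L j ⟧ ⟦ L j ⟧ + arcs ⟦ R j ⟧ ⟦ R j ⟧ + 2 * y) (arcs-sym ⟦ L j ⟧ ⟦ R j ⟧))

  Grows : ℕ → Set
  Grows j = g < t j × (2 + κ) * q j + 1 ≤ 2 * q (suc j)

  grows : ∀ j → 4 * suc j < ℓ → Thin j → g < t j → Grows j
  grows j lt thin g<t = g<t , go κ g (q j) (t j) (Z j) (l j) (q (suc j)) (balance j lt thin)
    (minimal (X j) (X⊆U j) g<t (≤-trans (+-monoˡ-≤ (t j) (≤-trans (s≤s z≤n) (q-mono j))) (≤-reflexive (sym (U≡q+t j))))) (q-suc j)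
    where
    go : ∀ κ g q t z l q′ → (2 + κ) * (q + t) ≤ κ * g + 2 * q + z + 2 * l → κ * g + z < (2 + κ) * t → q′ ≡ q + l →
      (2 + κ) * q + 1 ≤ 2 * q′
    go κ g q t z l _ h₁ h₂ refl = linarith 0 (h₁ ⊕ h₂) (solve (κ ∷ g ∷ q ∷ t ∷ z ∷ l ∷ []))

  1≤t : ∀ j → 4 * suc j < ℓ → Thin j → 1 ≤ t j
  1≤t j lt thin = n≢0⇒n>0 λ t≡0 → go κ 1≤κ t≡0
    where
    go : ∀ κ′ → 1 ≤ κ′ → t j ≡ 0 → ⊥
    go _ _ t≡0 = <⇒≱ g<U (*-cancelˡ-≤ κ {{>-nonZero 1≤κ}} (fin κ g (q j) (t j) (Z j) (l j) (size U) (balance j lt thin) t≡0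
      (arcs-empty (X j) ⟦ X j ⟧ t≡0) (n≤0⇒n≡0 (≤-trans (l≤t j) (≤-reflexive t≡0))) (U≡q+t j)))
      where
      fin : ∀ κ g q t z l u → (2 + κ) * (q + t) ≤ κ * g + 2 * q + z + 2 * l → t ≡ 0 → z ≡ 0 → l ≡ 0 → u ≡ q + t → κ * u ≤ κ * g
      fin κ g q _ _ _ _ h refl refl refl refl = linarith 0 h (solve (κ ∷ g ∷ q ∷ []))

  Z≤2t : ∀ j → t j ≤ g → Z j ≤ 2 * t j
  Z≤2t j t≤g = arcs≤2size (X j) 3≤ℓ (Short-⊆ (X⊆U j) shortU) (≤-trans t≤g g≤ℓ)

  Z+2≤2t : ∀ j → 1 ≤ t j → t j < g → Z j + 2 ≤ 2 * t j
  Z+2≤2t j 1≤t t<g = forest (t j) (X j) refl (Short-⊆ (X⊆U j) shortU) (≤-trans t<g g≤ℓ) 1≤t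

  arcs-RR : ∀ j → 1 ≤ r j → r j < ℓ → arcs ⟦ R j ⟧ ⟦ R j ⟧ + 2 ≤ 2 * r j
  arcs-RR j 1≤r r<ℓ = forest (r j) (R j) refl (Short-⊆ (λ h → X⊆U j (R⊆X j h)) shortU) r<ℓ 1≤r

  -- For κ ≥ 2 a small remainder X j is only possible in one extremal configuration.
  Exceptional : ℕ → Set
  Exceptional j = κ ≡ 2 × q j ≡ g × t j ≡ g × l j ≡ t j × 2 * t j ≤ Z j

  small-remainder : ∀ j → 4 * suc j < ℓ → Thin j → 2 ≤ κ → t j ≤ g → Exceptional j
  small-remainder j lt thin 2≤κ t≤g = extremal κ g (q j) (t j) (Z j) (l j) 2≤κ (g≤q j) (l≤t j) t≤g
    (balance j lt thin) (1≤t j lt thin) (Z≤2t j t≤g) (Z+2≤2t j (1≤t j lt thin))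

  -- In the extremal configuration every vertex of X j lies in L j.
  exceptional-LL : ∀ j → Exceptional j → 2 * t j ≤ arcs ⟦ L j ⟧ ⟦ L j ⟧
  exceptional-LL j (_ , _ , _ , l≡t , h) = ≤-trans h (≤-reflexive (trans (Z-split j)
    (trans (cong₂ (λ a b → arcs ⟦ L j ⟧ ⟦ L j ⟧ + a + 2 * b) (arcs-empty (R j) ⟦ R j ⟧ r≡0) (arcs-empty (R j) ⟦ L j ⟧ r≡0))
      (trans (+-identityʳ _) (+-identityʳ _)))))
    where
    r≡0 : r j ≡ 0
    r≡0 = +-cancelˡ-≡ (l j) _ _ (trans (sym (t≡l+r j)) (trans (sym l≡t) (sym (+-identityʳ (l j)))))

  -- The configuration exists for k = 4 and g = 5: the Petersen graph with one semiedge at each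
  -- vertex, around any of its 5-cycles. For g ≥ 6 and j = 0 it fails: if ℓ > 6 then `L 0` is
  -- independent, and if ℓ = 6 then three rays of 1, 2 and 2 links allow each vertex of `L 0` only
  -- one neighbour in `L 0`.
  not-exceptional : 3 ≤ κ ⊎ 6 ≤ g → ∀ j → 4 * suc j < ℓ → Thin j → j ≡ 0 ⊎ g < q j → ¬ Exceptional j
  not-exceptional (inj₁ 3≤κ) j _ _ _ (κ≡2 , _) = <⇒≢ 3≤κ (sym κ≡2)
  not-exceptional (inj₂ 6≤g) j _ _ (inj₂ g<q) (_ , q≡g , _) = <⇒≢ g<q (sym q≡g)
  not-exceptional (inj₂ 6≤g) zero lt thin (inj₁ refl) ex = [ long-cycle , hexagon ]′ (m≤n⇒m<n∨m≡n (≤-trans 6≤g g≤ℓ))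
    where
    long-cycle : ¬ (6 < ℓ)
    long-cycle 6<ℓ = <⇒≱ (≤-trans (1≤t 0 lt thin) (m≤m+n (t 0) _)) (≤-trans (exceptional-LL 0 ex) (≤-reflexive (arcs-LL 0 6<ℓ)))
    lemma : ∀ {t l} → 1 ≤ t → l ≤ t → l < 2 * t
    lemma {t} {l} p h = linarith 0 (p ⊕ h) (solve (t ∷ l ∷ []))
    hexagon : ¬ (6 ≡ ℓ)
    hexagon 6≡ℓ = <⇒≱ (lemma (1≤t 0 lt thin) (l≤t 0)) (≤-trans (exceptional-LL 0 ex) LL≤l)
      where
      LL≤l : arcs ⟦ L 0 ⟧ ⟦ L 0 ⟧ ≤ l 0
      LL≤l = ∑-mono λ v → ≤-trans (𝟙*-mono (L 0 v) one-neighbour) (≤-reflexive (*-identityʳ _))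
        where
        one-neighbour : ∀ {v} → L 0 v ≡ true → dg ⟦ L 0 ⟧ v ≤ 1
        one-neighbour {v} v∈L = ≮⇒≥ λ 2≤dg →
          let v∈X , y , vy , y∈B = L⁻ 0 v∈L ; v∈U , v∉B = ∖⁻ U (B 0) v∈X
              w , vw , w∈L = neighbour (L 0) v (≤-trans (n≤1+n 1) 2≤dg)
              w′ , w≢w′ , vw′ , w′∈L = neighbour≢ (L 0) v 2≤dg w
              outside = λ {u} (h : L 0 u ≡ true) → proj₂ (∖⁻ U (B 0) (L⊆X 0 h))
              _ , ρ = ray 0 v∈X vy y∈B ; _ , ρ′ = L-ray 0 v∈U v∉B vw w∈L ; _ , ρ″ = L-ray 0 v∈U v∉B vw′ w′∈L
          in <⇒≱ (≤-reflexive 6≡ℓ) (three-rays ρ ρ′ ρ″ (true≢false {B 0} y∈B (outside w∈L)) w≢w′ (true≢false {B 0} y∈B (outside w′∈L)))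

  -- For κ = 1 the forest bounds alone do not exclude a small remainder. The additional input is
  -- that a vertex outside the ball has at most one neighbour in `L j`; it costs one step of radius,
  -- hence `suc (suc j)`.
  cubic-remainder : κ ≡ 1 → ∀ j → 4 * suc (suc j) < ℓ → Thin j → g < t j
  cubic-remainder κ≡1 j lt thin = ≰⇒> contra
    where
    lt₂ : 4 * suc j + 2 < ℓ
    lt₂ = slack j ℓ lt
      where
      slack : ∀ j ℓ → 4 * suc (suc j) < ℓ → 4 * suc j + 2 < ℓ
      slack j ℓ h = linarith 2 h (solve (j ∷ ℓ ∷ []))
    lt₁ : 4 * suc j < ℓ
    lt₁ = ≤-trans (s≤s (m≤m+n _ 2)) lt₂
    RL≤r : arcs ⟦ R j ⟧ ⟦ L j ⟧ ≤ r j
    RL≤r = ∑-mono λ v → ≤-trans (𝟙*-mono (R j v) λ h → dg-L≤1 j lt (R⊆X j h)) (≤-reflexive (*-identityʳ _))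
    contra : t j ≤ g → ⊥
    contra t≤g = cubic-extremal κ g (q j) (t j) (l j) (r j) (Z j) (arcs ⟦ R j ⟧ ⟦ R j ⟧) (arcs ⟦ R j ⟧ ⟦ L j ⟧) κ≡1 (t≡l+r j)
      (balance j lt₁ thin) (g≤q j) t≤g (1≤t j lt₁ thin) (Z≤2t j t≤g)
      (trans (Z-split j) (cong (λ y → y + arcs ⟦ R j ⟧ ⟦ R j ⟧ + 2 * arcs ⟦ R j ⟧ ⟦ L j ⟧) (arcs-LL j lt₂)))
      RL≤r (arcs-empty (R j) ⟦ R j ⟧) (λ 1≤r r<g → arcs-RR j 1≤r (≤-trans r<g g≤ℓ))

  q≤U : ∀ j → q j ≤ size U
  q≤U j = ≤-trans (m≤m+n (q j) (t j)) (≤-reflexive (sym (U≡q+t j)))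

  -- The two regimes differ in c, which is 1 for κ ≥ 2 and 2 for κ = 1, and one induction serves
  -- both. The alternative `j ≡ 0 ⊎ g < q j` feeds `not-exceptional`.
  Remainder : ℕ → Set
  Remainder c = ∀ j → 4 * (c + j) < ℓ → Thin j → j ≡ 0 ⊎ g < q j → g < t j

  module _ {c} (1≤c : 1 ≤ c) (remainder : Remainder c) where

    tree-like : ∀ j → 4 * (c + j) < ℓ → 4 * suc j < ℓ
    tree-like j lt = ≤-trans (s≤s (*-monoʳ-≤ 4 (+-monoˡ-≤ j 1≤c))) lt

    tree-like-suc : ∀ j → 4 * (c + suc j) < ℓ → 4 * suc j + 2 < ℓ
    tree-like-suc j lt = ≤-trans (s≤s (≤-trans (+-monoʳ-≤ (4 * suc j) (s≤s (s≤s z≤n)))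
      (≤-trans (≤-reflexive (go j)) (*-monoʳ-≤ 4 (+-monoˡ-≤ (suc j) 1≤c))))) lt
      where
      go : ∀ j → 4 * suc j + 4 ≡ 4 * (1 + suc j)
      go = solve-∀

    earlier : ∀ j → 4 * (c + suc j) < ℓ → 4 * (c + j) < ℓ
    earlier j lt = ≤-trans (s≤s (*-monoʳ-≤ 4 (+-monoʳ-≤ c (n≤1+n j)))) lt

    Q-step : ∀ j → Q (2 + κ) g j ≤ q j → (2 + κ) * q j + 1 ≤ 2 * q (suc j) → Q (2 + κ) g (suc j) ≤ q (suc j)
    Q-step j h h′ = ⌈/2⌉≤ (≤-trans (+-monoˡ-≤ 1 (*-monoʳ-≤ (2 + κ) h)) h′)

    reached : ∀ j → 4 * (c + j) < ℓ → Q (2 + κ) g j ≤ q j × Thin j × (j ≡ 0 ⊎ g < q j)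
    reached zero _ = g≤q 0 , thin-zero , inj₁ refl
    reached (suc j) lt =
      let Q≤q , thin , large = reached j (earlier j lt)
          g<t = remainder j (earlier j lt) thin large
          _ , growth = grows j (tree-like j (earlier j lt)) thin g<t
      in Q-step j Q≤q growth , thin-suc j (tree-like-suc j lt) thin ,
         inj₂ (next>g κ g (q j) (q (suc j)) 1≤κ (≤-trans (s≤s z≤n) 5≤g) (g≤q j) growth)

    conclude : ∀ {N} j → 4 * (c + j) < ℓ → N ≤ Q (2 + κ) g j + suc g ⊎ N ≤ Q (2 + κ) g (suc j) → N ≤ size U
    conclude j lt N≤ =
      let Q≤q , thin , large = reached j lt
          g<t = remainder j lt thin large
          _ , growth = grows j (tree-like j lt) thin g<t
      in [ (λ h → ≤-trans h (≤-trans (+-mono-≤ Q≤q g<t) (≤-reflexive (sym (U≡q+t j)))))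
         , (λ h → ≤-trans h (≤-trans (Q-step j Q≤q growth) (q≤U (suc j)))) ]′ N≤

  remainder₁ : 2 ≤ κ → 3 ≤ κ ⊎ 6 ≤ g → Remainder 1
  remainder₁ 2≤κ ok j lt thin large = ≰⇒> λ t≤g → not-exceptional ok j lt thin large (small-remainder j lt thin 2≤κ t≤g)

  remainder₂ : κ ≡ 1 → Remainder 2
  remainder₂ κ≡1 j lt thin _ = cubic-remainder κ≡1 j lt thin

  4<ℓ : 4 * 1 < ℓ
  4<ℓ = ≤-trans 5≤g g≤ℓ

  balance-cubic : κ ≡ 1 → 3 * (q 0 + t 0) ≤ 1 * g + 2 * q 0 + Z 0 + 2 * l 0
  balance-cubic e = subst (λ κ → (2 + κ) * (q 0 + t 0) ≤ κ * g + 2 * q 0 + Z 0 + 2 * l 0) e (balance 0 4<ℓ thin-zero)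

  weak : κ ≡ 1 → t 0 < g → q 0 + t 0 + 2 ≤ g + 2 * l 0
  weak κ≡1 t<g = weak-remainder g (q 0) (t 0) (Z 0) (l 0) (balance-cubic κ≡1) (Z+2≤2t 0 (1≤t 0 4<ℓ thin-zero) t<g)

  by-remainder : ∀ {N} → N ≤ g + g → (t 0 < g → N ≤ size U) → N ≤ size U
  by-remainder {N} N≤ small = [ small , (λ g≤t → ≤-trans N≤ (≤-trans (+-mono-≤ (g≤q 0) g≤t) (≤-reflexive (sym (U≡q+t 0))))) ]′ (<-≤-connex (t 0) g)

  quartic-5 : κ ≡ 2 → 10 ≤ g + g → 10 ≤ size U
  quartic-5 κ≡2 10≤ = by-remainder 10≤ λ t<g →
    contradiction (proj₁ (proj₂ (proj₂ (small-remainder 0 4<ℓ thin-zero (≤-reflexive (sym κ≡2)) (<⇒≤ t<g))))) (<⇒≢ t<g)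

  cubic-6 : κ ≡ 1 → g ≡ 6 → 8 ≤ size U
  cubic-6 κ≡1 g≡6 = by-remainder (subst (λ g → 8 ≤ g + g) (sym g≡6) (m≤m+n 8 4)) λ t<g →
    ≤-trans ([3,6]-arith (q 0) (t 0) (l 0) (subst (_≤ q 0) g≡6 (g≤q 0)) (l≤t 0)
      (subst (λ g → q 0 + t 0 + 2 ≤ g + 2 * l 0) g≡6 (weak κ≡1 t<g))) (≤-reflexive (sym (U≡q+t 0)))

  -- With at most 9 vertices, `weak` forces `R 0` to be empty, and `L 0` is independent as ℓ > 6.
  -- The remainder then contains no links, which the balance refutes.
  cubic-7 : κ ≡ 1 → g ≡ 7 → 10 ≤ size U
  cubic-7 κ≡1 g≡7 = by-remainder (subst (λ g → 10 ≤ g + g) (sym g≡7) (m≤m+n 10 4)) λ t<g → ≮⇒≥ λ U<10 →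
    let r≡0 = n≤0⇒n≡0 ([3,7]-r (q 0) (t 0) (l 0) (r 0) 7≤q (t≡l+r 0) (l≤t 0)
                (subst (λ g → q 0 + t 0 + 2 ≤ g + 2 * l 0) g≡7 (weak κ≡1 t<g))
                (≤-trans (≤-reflexive (sym (U≡q+t 0))) (s≤s⁻¹ U<10)))
        Z≡0 = trans (Z-split 0) (cong₂ _+_ (cong₂ _+_ (arcs-LL 0 6<ℓ) (arcs-empty (R 0) ⟦ R 0 ⟧ r≡0)) (cong (2 *_) (arcs-empty (R 0) ⟦ L 0 ⟧ r≡0)))
    in [3,7]-arith (q 0) (t 0) (Z 0) (l 0) (subst (λ g → 3 * (q 0 + t 0) ≤ 1 * g + 2 * q 0 + Z 0 + 2 * l 0) g≡7 (balance-cubic κ≡1))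
         (≤-reflexive Z≡0) 7≤q (l≤t 0) (1≤t 0 4<ℓ thin-zero)
    where
    7≤q : 7 ≤ q 0
    7≤q = subst (_≤ q 0) g≡7 (g≤q 0)
    6<ℓ : 6 < ℓ
    6<ℓ = subst (_≤ ℓ) g≡7 g≤ℓ

  R⁻ : ∀ j {v} → R j v ≡ true → U v ≡ true × B j v ≡ false × L j v ≡ false
  R⁻ j h = let h₁ , h₂ = ∖⁻ (X j) (L j) h ; h₃ , h₄ = ∖⁻ U (B j) h₁ in h₃ , h₄ , h₂

  R-dg≤2 : 6 < ℓ → ∀ {v} → R 0 v ≡ true → dg ⟦ L 0 ⟧ v ≤ 2
  R-dg≤2 6<ℓ {v} v∈R = ≮⇒≥ λ 3≤dg →
    let v∈U , v∉B , _ = R⁻ 0 v∈R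
        x₁ , vx₁ , x₁∈L = neighbour (L 0) v (≤-trans (s≤s z≤n) 3≤dg)
        x₂ , x₁≢x₂ , vx₂ , x₂∈L = neighbour≢ (L 0) v (≤-trans (n≤1+n 2) 3≤dg) x₁
        x₃ , x₁≢x₃ , x₂≢x₃ , vx₃ , x₃∈L = neighbour≢≢ (L 0) v 3≤dg x₁ x₂
        _ , ρ₁ = L-ray 0 v∈U v∉B vx₁ x₁∈L ; _ , ρ₂ = L-ray 0 v∈U v∉B vx₂ x₂∈L ; _ , ρ₃ = L-ray 0 v∈U v∉B vx₃ x₃∈L
    in <⇒≱ 6<ℓ (three-rays ρ₁ ρ₂ ρ₃ x₁≢x₂ x₂≢x₃ x₁≢x₃)

  -- The rays from v have 2, 2 and, through w, 3 links: total length 7 < ℓ, against `three-rays`.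
  R-edge : 7 < ℓ → ∀ {v w} → R 0 v ≡ true → R 0 w ≡ true → Adj v w → 2 ≤ dg ⟦ L 0 ⟧ v → ¬ (1 ≤ dg ⟦ L 0 ⟧ w)
  R-edge 7<ℓ {v} {w} v∈R w∈R vw 2≤dg 1≤dg =
    let v∈U , v∉B , v∉L = R⁻ 0 v∈R ; w∈U , w∉B , w∉L = R⁻ 0 w∈R
        x₁ , vx₁ , x₁∈L = neighbour (L 0) v (≤-trans (n≤1+n 1) 2≤dg)
        x₂ , x₁≢x₂ , vx₂ , x₂∈L = neighbour≢ (L 0) v 2≤dg x₁
        y , wy , y∈L = neighbour (L 0) w 1≤dg
        _ , ρ₁ = L-ray 0 v∈U v∉B vx₁ x₁∈L ; _ , ρ₂ = L-ray 0 v∈U v∉B vx₂ x₂∈L ; _ , ρ₃ = L-ray 0 w∈U w∉B wy y∈L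
    in <⇒≱ 7<ℓ (three-rays ρ₁ ρ₂ (ray-cons v∈U vw (true≢false {L 0} y∈L v∉L ∘ sym) ρ₃) x₁≢x₂
         (true≢false {L 0} x₂∈L w∉L) (true≢false {L 0} x₁∈L w∉L))

  RL≤2r : 6 < ℓ → ∀ A → A ⊆ R 0 → arcs ⟦ A ⟧ ⟦ L 0 ⟧ ≤ 2 * size A
  RL≤2r 6<ℓ A A⊆R = ≤-trans (∑-mono λ v → ≤-trans (𝟙*-mono (A v) λ h → R-dg≤2 6<ℓ (A⊆R h)) (≤-reflexive (*-comm (⟦ A ⟧ v) 2)))
    (≤-reflexive (∑-*ˡ 2 ⟦ A ⟧))

  -- By `R-edge` the two ends of a link in `R 0` send together at most two links to `L 0`, two fewer
  -- than `R-dg≤2` allows.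
  RL+2≤2r : 7 < ℓ → 1 ≤ arcs ⟦ R 0 ⟧ ⟦ R 0 ⟧ → arcs ⟦ R 0 ⟧ ⟦ L 0 ⟧ + 2 ≤ 2 * r 0
  RL+2≤2r 7<ℓ edge =
    let v , p = 1≤∑⁻ edge ; p₁ , p₂ = 1≤⁻* p ; w , vw , w∈R = neighbour (R 0) v p₂ in with-edge v w (1≤𝟙⁻ p₁) w∈R vw
    where
    6<ℓ : 6 < ℓ
    6<ℓ = ≤-trans (n≤1+n 7) 7<ℓ
    sum≤2 : ∀ i j → i ≤ 2 → j ≤ 2 → (2 ≤ i → ¬ (1 ≤ j)) → (2 ≤ j → ¬ (1 ≤ i)) → i + j ≤ 2
    sum≤2 zero j _ h _ _ = h
    sum≤2 (suc zero) zero _ _ _ _ = s≤s z≤n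
    sum≤2 (suc zero) (suc zero) _ _ _ _ = ≤-refl
    sum≤2 (suc zero) (suc (suc j)) _ _ _ h = contradiction (s≤s z≤n) (h (s≤s (s≤s z≤n)))
    sum≤2 (suc (suc i)) zero h _ _ _ = ≤-trans (≤-reflexive (+-identityʳ _)) h
    sum≤2 (suc (suc i)) (suc j) _ _ h _ = contradiction (s≤s z≤n) (h (s≤s (s≤s z≤n)))
    total : ∀ i j k m → i + j ≤ 2 → k ≤ 2 * m → i + (j + k) + 2 ≤ 2 * (1 + (1 + m))
    total i j k m h₁ h₂ = linarith 0 (h₁ ⊕ h₂) (solve (i ∷ j ∷ k ∷ m ∷ []))
    with-edge : ∀ v w → R 0 v ≡ true → R 0 w ≡ true → Adj v w → arcs ⟦ R 0 ⟧ ⟦ L 0 ⟧ + 2 ≤ 2 * r 0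
    with-edge v w v∈R w∈R vw = begin
      arcs ⟦ R 0 ⟧ ⟦ L 0 ⟧ + 2                            ≡⟨ cong (_+ 2) (arcs-removeˡ (R 0) ⟦ L 0 ⟧ v∈R) ⟩
      dg ⟦ L 0 ⟧ v + arcs ⟦ R′ ⟧ ⟦ L 0 ⟧ + 2              ≡⟨ cong (λ y → dg ⟦ L 0 ⟧ v + y + 2) (arcs-removeˡ R′ ⟦ L 0 ⟧ w∈R′) ⟩
      dg ⟦ L 0 ⟧ v + (dg ⟦ L 0 ⟧ w + arcs ⟦ R″ ⟧ ⟦ L 0 ⟧) + 2
        ≤⟨ total (dg ⟦ L 0 ⟧ v) (dg ⟦ L 0 ⟧ w) _ _ (sum≤2 _ _ (R-dg≤2 6<ℓ v∈R) (R-dg≤2 6<ℓ w∈R) (R-edge 7<ℓ v∈R w∈R vw) (R-edge 7<ℓ w∈R v∈R (Adj-sym vw)))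
             (RL≤2r 6<ℓ R″ (λ h → proj₁ (∖⁻ (R 0) (single v) (proj₁ (∖⁻ R′ (single w) h))))) ⟩
      2 * (1 + (1 + size R″))                             ≡⟨ cong (λ y → 2 * (1 + y)) (size-remove R′ w∈R′) ⟨
      2 * (1 + size R′)                                   ≡⟨ cong (2 *_) (size-remove (R 0) v∈R) ⟨
      2 * r 0                                             ∎
      where
      open ≤-Reasoning
      R′ R″ : VSet
      R′ = R 0 ∖ single v
      R″ = R′ ∖ single w
      w∈R′ : R′ w ≡ true
      w∈R′ = ∖⁺ (R 0) (single v) w∈R (dec-false (v ≟ w) λ { refl → Adj-irr vw })

  -- For s = 8 the parabola has P(14) = 0, so 14 vertices must be excluded too. If `R 0` contains a
  -- link, this takes the saving of `RL+2≤2r`.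
  cubic-8 : κ ≡ 1 → g ≡ 8 → 15 ≤ size U
  cubic-8 κ≡1 g≡8 = by-remainder (subst (λ g → 15 ≤ g + g) (sym g≡8) (m≤m+n 15 1)) λ t<g → ≮⇒≥ λ U<15 →
    no-edge-or-edge t<g U<15 (1 ≤? arcs ⟦ R 0 ⟧ ⟦ R 0 ⟧)
    where
    8≤ℓ : 8 ≤ ℓ
    8≤ℓ = subst (_≤ ℓ) g≡8 g≤ℓ
    Z≡ : Z 0 ≡ arcs ⟦ R 0 ⟧ ⟦ R 0 ⟧ + 2 * arcs ⟦ R 0 ⟧ ⟦ L 0 ⟧
    Z≡ = trans (Z-split 0) (cong (λ y → y + arcs ⟦ R 0 ⟧ ⟦ R 0 ⟧ + 2 * arcs ⟦ R 0 ⟧ ⟦ L 0 ⟧) (arcs-LL 0 (≤-trans (n≤1+n 7) 8≤ℓ)))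
    balance-8 : 3 * (q 0 + t 0) ≤ 1 * 8 + 2 * q 0 + Z 0 + 2 * l 0
    balance-8 = subst (λ g → 3 * (q 0 + t 0) ≤ 1 * g + 2 * q 0 + Z 0 + 2 * l 0) g≡8 (balance-cubic κ≡1)
    8≤q : 8 ≤ q 0
    8≤q = subst (_≤ q 0) g≡8 (g≤q 0)
    no-edge-or-edge : t 0 < g → size U < 15 → Dec (1 ≤ arcs ⟦ R 0 ⟧ ⟦ R 0 ⟧) → ⊥
    no-edge-or-edge t<g U<15 (no none) = [3,8]-no-edge (q 0) (t 0) (l 0) (r 0) (Z 0) (arcs ⟦ R 0 ⟧ ⟦ L 0 ⟧) (t≡l+r 0) balance-8
      (subst (λ g → q 0 + t 0 + 2 ≤ g + 2 * l 0) g≡8 (weak κ≡1 t<g)) 8≤q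
      (≤-reflexive (trans Z≡ (cong (_+ 2 * arcs ⟦ R 0 ⟧ ⟦ L 0 ⟧) (¬1≤⇒≡0 none)))) (RL≤2r (≤-trans (n≤1+n 7) 8≤ℓ) (R 0) id)
    no-edge-or-edge t<g U<15 (yes edge) = [3,8]-edge (q 0) (t 0) (l 0) (r 0) (Z 0) (arcs ⟦ R 0 ⟧ ⟦ L 0 ⟧) (arcs ⟦ R 0 ⟧ ⟦ R 0 ⟧) (t≡l+r 0) balance-8
      (subst (λ g → q 0 + t 0 + 2 ≤ g + 2 * l 0) g≡8 (weak κ≡1 t<g)) 8≤q (≤-trans (≤-reflexive (sym (U≡q+t 0))) (s≤s⁻¹ U<15))
      (≤-reflexive Z≡) (arcs-RR 0 1≤r (≤-trans (s≤s r≤t) (≤-trans t<g g≤ℓ))) (RL+2≤2r 8≤ℓ edge)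
      where
      r≤t : r 0 ≤ t 0
      r≤t = ≤-trans (m≤n+m (r 0) (l 0)) (≤-reflexive (sym (t≡l+r 0)))
      1≤r : 1 ≤ r 0
      1≤r = let v , p = 1≤∑⁻ edge ; p₁ , _ = 1≤⁻* p in 1≤size (R 0) (1≤𝟙⁻ p₁)

  bound : ∀ {N} → Bound κ g N → N ≤ size U
  bound b = go b refl refl
    where
    go : ∀ {κ′ g′ N} → Bound κ′ g′ N → κ′ ≡ κ → g′ ≡ g → N ≤ size U
    go (generic j 2≤κ ok lt N≤) refl refl = conclude {1} ≤-refl (remainder₁ 2≤κ ok) j (≤-trans lt g≤ℓ) N≤
    go (cubic j lt N≤) refl refl = conclude {2} (s≤s z≤n) (remainder₂ refl) j (≤-trans lt g≤ℓ) N≤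
    go [4,5] refl refl = quartic-5 refl ≤-refl
    go [3,5] refl refl = g<U
    go [3,6] e e′ = cubic-6 (sym e) (sym e′)
    go [3,7] e e′ = cubic-7 (sym e) (sym e′)
    go [3,8] e e′ = cubic-8 (sym e) (sym e′)

-- Trivial multipoles and the reduction to a minimal dense subset

injective⇒surjective : ∀ {n} {f : Fin n → Fin n} → Injective _≡_ _≡_ f → ∀ v → ∃ λ i → f i ≡ v
injective⇒surjective {n} {f} inj v with Data.Fin.Properties.any? (λ i → f i ≟ v)
... | yes p = p
... | no none = contradiction (Data.Fin.Properties.injective⇒≤ {f = h} h-inj) 1+n≰n
  where
  h : Fin (suc n) → Fin n
  h zero = v
  h (suc i) = f i
  h-inj : Injective _≡_ _≡_ h
  h-inj {zero} {zero} _ = refl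
  h-inj {zero} {suc j} e = contradiction (j , sym e) none
  h-inj {suc i} {zero} e = contradiction (i , e) none
  h-inj {suc i} {suc j} e = cong suc (inj e)

cprev : ∀ {m} → Fin (suc m) → Fin (suc m)
cprev {m} zero = Data.Fin.fromℕ m
cprev (suc i) = Data.Fin.inject₁ i

cnext-cprev : ∀ {m} (i : Fin (suc m)) → cnext (cprev i) ≡ i
cnext-cprev {m} zero with cnext-cases (Data.Fin.fromℕ m)
... | inj₁ (p , _) = contradiction p (<-irrefl (cong suc (Data.Fin.Properties.toℕ-fromℕ m)))
... | inj₂ (_ , e) = e
cnext-cprev {suc m} (suc i) with cnext-cases (Data.Fin.inject₁ i)
... | inj₁ (p , e) = trans e (toℕ-injective (trans (toℕ-fromℕ< p) (cong suc (Data.Fin.Properties.toℕ-inject₁ i))))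
... | inj₂ (e , _) = contradiction (trans (sym (Data.Fin.Properties.toℕ-inject₁ i)) (suc-injective e)) (<⇒≢ (toℕ<n i))

∑-tight : ∀ {n c} {f : Fin n → ℕ} → (∀ i → c ≤ f i) → ∑ f ≤ n * c → ∀ i → f i ≡ c
∑-tight {n} {c} {f} h tot i = ≤-antisym (≮⇒≥ λ c<fi → 1+n≰n (≤-trans (≤-trans (≤-reflexive (sym total)) (∑-mono (at c<fi))) tot)) (h i)
  where
  total : ∑ (λ j → δ i j + c) ≡ suc (n * c)
  total = trans (∑-+ (δ i) _) (cong₂ _+_ (trans (∑-cong λ j → sym (*-identityʳ (δ i j))) (∑-δ i (λ _ → 1))) (∑-const n c))
  at : c < f i → ∀ j → δ i j + c ≤ f j
  at c<fi j with i ≟ j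
  ... | yes refl = c<fi
  ... | no _ = h j

module Extremal {n} (G : Multipole n) where

  open VertexSets G

  two-neighbours : ∀ {x u v} → Adj x u → Adj x v → u ≢ v → 2 ≤ deg x
  two-neighbours {x} {u} {v} xu xv u≢v = ≤-trans (≤-reflexive (sym (trans (∑-+ (δ u) (δ v)) (cong₂ _+_ (∑δ u) (∑δ v))))) (∑-mono at)
    where
    ∑δ : ∀ u → ∑ (δ u) ≡ 1
    ∑δ u = WalkCount.∑δ≡1 G u
    at : ∀ z → δ u z + δ v z ≤ a x z
    at z with u ≟ z | v ≟ z
    ... | yes refl | yes refl = contradiction refl u≢v
    ... | yes refl | no _ = 1≤𝟙 xu
    ... | no _ | yes refl = 1≤𝟙 xv
    ... | no _ | no _ = z≤n

  three-neighbours : ∀ {x u v w} → Adj x u → Adj x v → Adj x w → u ≢ v → u ≢ w → v ≢ w → 3 ≤ deg x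
  three-neighbours {x} {u} {v} {w} xu xv xw u≢v u≢w v≢w =
    ≤-trans (≤-reflexive (sym (trans (∑-+ (δ u) _) (cong₂ _+_ (∑δ u) (trans (∑-+ (δ v) (δ w)) (cong₂ _+_ (∑δ v) (∑δ w))))))) (∑-mono at)
    where
    ∑δ : ∀ u → ∑ (δ u) ≡ 1
    ∑δ u = WalkCount.∑δ≡1 G u
    at : ∀ z → δ u z + (δ v z + δ w z) ≤ a x z
    at z with u ≟ z | v ≟ z | w ≟ z
    ... | yes refl | yes refl | _ = contradiction refl u≢v
    ... | yes refl | no _ | yes refl = contradiction refl u≢w
    ... | yes refl | no _ | no _ = 1≤𝟙 xu
    ... | no _ | yes refl | yes refl = contradiction refl v≢w
    ... | no _ | yes refl | no _ = 1≤𝟙 xv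
    ... | no _ | no _ | yes refl = 1≤𝟙 xw
    ... | no _ | no _ | no _ = z≤n

  full : VSet
  full _ = true

  size-full : size full ≡ n
  size-full = trans (∑-const n 1) (*-identityʳ n)

  arcs-full : arcs ⟦ full ⟧ ⟦ full ⟧ ≡ A₁
  arcs-full = ∑-cong λ u → trans (*-identityˡ _) (∑-cong λ w → *-identityʳ (a u w))

  Short-full : ∀ {g} → GirthAtLeast g G → Short g full
  Short-full girth nb _ = nb-unique girth nb

  degree≡ : ∀ v → degree G v ≡ deg v + sem G v
  degree≡ v = cong (_+ sem G v) (sum≡∑ (a v))

  -- Every vertex lies on the cycle and has at least two neighbours, while `arcs≤2size` bounds the
  -- sum of `deg` by 2 n. So `deg` is 2 throughout, a chord would create a third neighbour, and
  -- regularity leaves k - 2 semiedges at each vertex.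
  hamiltonian⇒IsGCycle : ∀ {k} m → n ≡ suc m → Regular k G → GirthAtLeast (suc m) G → Cycle G (suc m) → IsGCycle k (suc m) G
  hamiltonian⇒IsGCycle {k} m refl regular girth (3≤ , f , f-inj , f-adj) =
    refl , f , f-inj , f-adj , chordless , λ v → trans (sym (m+n∸m≡n 2 (sem G v)))
      (cong (_∸ 2) (trans (cong (_+ sem G v) (sym (deg≡2 v))) (trans (sym (degree≡ v)) (regular v))))
    where
    open Neighbourhood G full m (λ {l} → Short-full girth {l}) 3≤ f f-inj (λ _ → refl) f-adj using (cnext²≢)
    prev-adj : ∀ i → Adj (f i) (f (cprev i))
    prev-adj i = Adj-sym (subst (λ j → Adj (f (cprev i)) (f j)) (cnext-cprev i) (f-adj (cprev i)))
    next≢prev : ∀ i → f (cnext i) ≢ f (cprev i)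
    next≢prev i e = cnext²≢ (cprev i) (trans (sym (f-inj e)) (cong cnext (sym (cnext-cprev i))))
    deg≡2 : ∀ v → deg v ≡ 2
    deg≡2 = ∑-tight
      (λ v → let i , e = injective⇒surjective f-inj v in subst (λ v → 2 ≤ deg v) e (two-neighbours (f-adj i) (prev-adj i) (next≢prev i)))
      (≤-trans (≤-reflexive (sym arcs-full)) (≤-trans (arcs≤2size full 3≤ (λ {l} → Short-full girth {l}) (≤-reflexive size-full))
        (≤-reflexive (trans (cong (2 *_) size-full) (*-comm 2 n)))))
    chordless : ∀ i j → Adj (f i) (f j) → j ≡ cnext i ⊎ i ≡ cnext j
    chordless i j ij with j ≟ cnext i | i ≟ cnext j
    ... | yes p | _ = inj₁ p
    ... | no _ | yes p = inj₂ p
    ... | no j≢ | no i≢ = contradiction (deg≡2 (f i)) (<⇒≢ (three-neighbours (f-adj i) (prev-adj i) ij (next≢prev i)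
      (j≢ ∘ sym ∘ f-inj) (λ e → i≢ (trans (sym (cnext-cprev i)) (cong cnext (f-inj e)))) ) ∘ sym)

  nontrivial⇒g<n : ∀ {k g} → 5 ≤ g → Regular k G → GirthAtLeast g G → Nontrivial k g G → g < n
  nontrivial⇒g<n {k} {suc m} _ regular girth ((ℓ , cycle@(_ , f , f-inj , _)) , ¬gcycle) = ≤∧≢⇒< (≤-trans g≤ℓ ℓ≤n) λ g≡n →
    ¬gcycle (hamiltonian⇒IsGCycle m (sym g≡n) regular girth (subst (Cycle G) (≤-antisym (≤-trans ℓ≤n (≤-reflexive (sym g≡n))) g≤ℓ) cycle))
    where
    ℓ≤n : ℓ ≤ n
    ℓ≤n = Data.Fin.Properties.injective⇒≤ f-inj
    g≤ℓ : suc m ≤ ℓ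
    g≤ℓ = ≮⇒≥ λ ℓ<g → girth ℓ ℓ<g cycle

  -- The induced graph keeps the vertex set `Fin n`, with isolated vertices outside U, so that its
  -- cycles are cycles of G without renumbering.
  restrict : VSet → Multipole n
  restrict U = record
    { adj = λ u v → U u ∧ (U v ∧ adj G u v)
    ; adj-sym = λ u v → trans (∧-swap (U u) (U v) (adj G u v)) (cong (λ b → U v ∧ (U u ∧ b)) (adj-sym G u v))
    ; adj-irr = λ v → trans (cong (λ b → U v ∧ (U v ∧ b)) (adj-irr G v)) (∧-false (U v))
    ; sem = λ _ → 0 }
    where
    ∧-swap : ∀ b c d → b ∧ (c ∧ d) ≡ c ∧ (b ∧ d)
    ∧-swap true _ _ = refl
    ∧-swap false true _ = refl
    ∧-swap false false _ = refl
    ∧-false : ∀ b → b ∧ (b ∧ false) ≡ false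
    ∧-false true = refl
    ∧-false false = refl

  module _ {U : VSet} where

    restrict-adj : ∀ {u v} → U u ≡ true → U v ≡ true → Adj u v → Walks.Adj (restrict U) u v
    restrict-adj p q uv rewrite p | q = uv

    restrict-nb : ∀ {l} → NB l → (∀ {v} → v ∈ l → U v ≡ true) → Walks.NB (restrict U) l
    restrict-nb one h = Walks.one
    restrict-nb (two e) h = Walks.two (restrict-adj (h (here refl)) (h (there (here refl))) e)
    restrict-nb (cons e ne nb) h =
      Walks.cons (restrict-adj (h (here refl)) (h (there (here refl))) e) ne (restrict-nb nb (h ∘ there))

    restrict-short : ∀ {g} → GirthAtLeast g (restrict U) → Short g U
    restrict-short girth nb h = Walks.nb-unique (restrict U) girth (restrict-nb nb h)

  restrict-cycle : ∀ {U ℓ} → Cycle (restrict U) ℓ → Cycle G ℓ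
  restrict-cycle {U} (3≤ , f , f-inj , f-adj) = 3≤ , f , f-inj , λ i → proj₂ (∧-true {U (f (cnext i))} (proj₂ (∧-true {U (f i)} (f-adj i))))

  module _ {κ g N : ℕ} (1≤κ : 1 ≤ κ) (5≤g : 5 ≤ g) (girth : GirthAtLeast g G) (b : Bound κ g N) where

    -- At most κ g half-edges (semiedges and links) leave U.
    Dense : VSet → Set
    Dense U = (2 + κ) * size U ≤ κ * g + arcs ⟦ U ⟧ ⟦ U ⟧

    private
      Claim : ℕ → Set
      Claim s = ∀ U → size U ≡ s → g < size U → Dense U → N ≤ size U

      claim : ∀ s → (∀ {s′} → s′ < s → Claim s′) → Claim s
      claim s ih U refl g<U dense = ≮⇒≥ λ U<N → sparse (acyclic U<N)
        where
        -- No minimal set is chosen: by induction a smaller dense subset would have at least N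
        -- vertices, so for size U < N there is none. In the same way `acyclic` recurses on the
        -- cycle length, so that `shortest` may assume girth ℓ.
        minimal : size U < N → ∀ W → W ⊆ U → g < size W → size W < size U → κ * g + arcs ⟦ W ⟧ ⟦ W ⟧ < (2 + κ) * size W
        minimal U<N W _ g<W W<U = ≰⇒> λ denseW → <⇒≱ (≤-trans W<U (<⇒≤ U<N)) (ih W<U W refl g<W denseW)
        shortest : size U < N → ∀ ℓ → GirthAtLeast ℓ (restrict U) → ¬ Cycle (restrict U) ℓ
        shortest U<N (suc m) girthU cycle@(3≤ , f , f-inj , f-adj) = <⇒≱ U<N
          (Minimal.bound G U m (λ {l} → restrict-short girthU {l}) 3≤ f f-inj (λ i → proj₁ (∧-true (f-adj i)))
            (λ i → proj₂ (∧-true {U (f (cnext i))} (proj₂ (∧-true {U (f i)} (f-adj i)))))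
            κ g 1≤κ 5≤g (≮⇒≥ λ ℓ<g → girth (suc m) ℓ<g (restrict-cycle {U} cycle)) g<U dense (minimal U<N) b)
        acyclic : size U < N → ∀ ℓ → ¬ Cycle (restrict U) ℓ
        acyclic U<N ℓ = <-rec (λ ℓ → ¬ Cycle (restrict U) ℓ) (λ ℓ rec → shortest U<N ℓ λ i i<ℓ → rec i<ℓ) ℓ
        sparse : (∀ ℓ → ¬ Cycle (restrict U) ℓ) → ⊥
        sparse none = go κ g (size U) (arcs ⟦ U ⟧ ⟦ U ⟧) dense g<U
          (forest {suc (size U)} (size U) U refl (λ {l} → restrict-short (λ ℓ _ → none ℓ) {l}) ≤-refl (≤-trans (s≤s z≤n) g<U))
          where
          go : ∀ κ g u e → (2 + κ) * u ≤ κ * g + e → g < u → e + 2 ≤ 2 * u → ⊥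
          go κ g u e h₁ h₂ h₃ = impossible (1 + κ) (h₁ ⊕ κ ⊗ h₂ ⊕ h₃) (solve (κ ∷ g ∷ u ∷ e ∷ []))

    dense⇒N≤size : ∀ U → g < size U → Dense U → N ≤ size U
    dense⇒N≤size U = <-rec Claim claim (size U) U refl

-- The position of the lower bound relative to the parabola P

-- The polynomial P is negative between N and the vertex, so that N ≤ n and P(n) ≥ 0 put n
-- beyond the vertex.
CritOdd : ℕ → ℕ → ℕ → Set
CritOdd κ d N = M ≤ 2 * N ⊎ N * N + κ * (2 * d + 1) * K < M * N
  where
  M = 1 + (2 + κ) * geo (1 + κ) d
  K = wgeo (1 + κ) d

CritEven : ℕ → ℕ → ℕ → Set
CritEven κ d N = k * M + σ ≤ 2 * k * N ⊎ (N ≤ M × k * N * N + σ * M + 2 * σ * (x * K) < k * N * M + σ * N)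
  where
  k = 2 + κ
  x = 1 + κ
  M = 2 * geo x (suc d)
  K = wgeo x d
  σ = κ * (2 * d + 2)

abstract
  -- Left of the vertex P decreases, so N ≤ n would give P(n) ≤ P(N) < 0. The coefficient of s in P
  -- is nonnegative, which is why only the largest value σ is tested.
  past-vertex-odd : ∀ n N M s σ K → N ≤ n → s ≤ σ → M * n ≤ n * n + s * K → M ≤ 2 * N ⊎ N * N + σ * K < M * N → M ≤ 2 * n
  past-vertex-odd n N M s σ K N≤n s≤σ h (inj₁ c) = ≤-trans c (*-monoʳ-≤ 2 N≤n)
  past-vertex-odd n N M s σ K N≤n s≤σ h (inj₂ c) = ≮⇒≥ λ 2n<M →
    let p , e = m≤n⇒∃[o]m+o≡n N≤n ; r , e′ = m≤n⇒∃[o]m+o≡n 2n<M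
    in go N p r (σ * K) (subst₂ (λ n M → M * n ≤ n * n + σ * K) (sym e) (sym (trans (cong (λ n → suc (2 * n) + r) e) e′))
           (≤-trans h (+-monoʳ-≤ (n * n) (*-monoˡ-≤ K s≤σ))))
         (subst (λ M → N * N + σ * K < M * N) (sym (trans (cong (λ n → suc (2 * n) + r) e) e′)) c)
    where
    go : ∀ N p r σK → (1 + 2 * (N + p) + r) * (N + p) ≤ (N + p) * (N + p) + σK → 1 + (N * N + σK) ≤ (1 + 2 * (N + p) + r) * N → ⊥
    go N p r σK h c = impossible (p * p + (1 + r) * p) (h ⊕ c) (solve (N ∷ p ∷ r ∷ σK ∷ []))

  -- As in the odd case, but `κ` stands here for (k - 1) K. The coefficient of s in P(N) is M - N +
  -- 2 κ, and N ≤ M makes it nonnegative.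
  past-vertex-even : ∀ k n N M s σ κ → N ≤ n → s ≤ σ → (k * M + s) * n ≤ k * n * n + M * s + 2 * s * κ →
    k * M + σ ≤ 2 * k * N ⊎ (N ≤ M × k * N * N + σ * M + 2 * σ * κ < k * N * M + σ * N) → k * M + s ≤ 2 * k * n
  past-vertex-even k n N M s σ κ N≤n s≤σ h (inj₁ c) =
    ≤-trans (+-monoʳ-≤ (k * M) s≤σ) (≤-trans c (*-monoʳ-≤ (2 * k) N≤n))
  past-vertex-even k n N M s σ κ N≤n s≤σ h (inj₂ (N≤M , c)) = ≮⇒≥ λ lt →
    let p , e = m≤n⇒∃[o]m+o≡n N≤n ; m , e₁ = m≤n⇒∃[o]m+o≡n N≤M ; t , e₂ = m≤n⇒∃[o]m+o≡n s≤σ ; r , e₃ = m≤n⇒∃[o]m+o≡n lt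
    in go k N p m s t κ r (subst₂ (λ n M → (k * M + s) * n ≤ k * n * n + M * s + 2 * s * κ) (sym e) (sym e₁) h)
         (subst₂ (λ M σ → k * N * N + σ * M + 2 * σ * κ < k * N * M + σ * N) (sym e₁) (sym e₂) c)
         (≤-reflexive (trans (cong (λ n → suc (2 * k * n) + r) e) (trans e₃ (cong (λ M → k * M + s) (sym e₁)))))
    where
    go : ∀ k N p m s t κ r → (k * (N + m) + s) * (N + p) ≤ k * (N + p) * (N + p) + (N + m) * s + 2 * s * κ →
      1 + (k * N * N + (s + t) * (N + m) + 2 * (s + t) * κ) ≤ k * N * (N + m) + (s + t) * N →
      1 + 2 * k * (N + p) + r ≤ k * (N + m) + s → ⊥
    go k N p m s t κ r h c e = impossible (p * (1 + r) + k * p * p + t * m + 2 * t * κ) (h ⊕ c ⊕ p ⊗ e)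
      (solve (k ∷ N ∷ p ∷ m ∷ s ∷ t ∷ κ ∷ r ∷ []))

  wgeo≤ : ∀ x d → wgeo x d ≤ d * geo x d
  wgeo≤ x zero = ≤-refl
  wgeo≤ x (suc d) = go x d (wgeo x d) (geo x d) (wgeo≤ x d)
    where
    go : ∀ x d K S → K ≤ d * S → x * K + (1 + x * S) ≤ (1 + d) * (1 + x * S)
    go x d K S h = linarith d (x ⊗ h) (solve (x ∷ d ∷ K ∷ S ∷ []))

  -- N = g d is made for this estimate: by `wgeo≤` the term κ g K is at most κ N S, and P(N) < 0
  -- follows from N + κ S ≤ (2 + κ) S, that is N ≤ 2 S.
  large-odd : ∀ κ d → 1 ≤ d → (2 * d + 1) * d ≤ 2 * geo (1 + κ) d → CritOdd κ d ((2 * d + 1) * d)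
  large-odd κ (suc d) _ h = inj₂ (go κ d (geo (1 + κ) (suc d)) (wgeo (1 + κ) (suc d)) h (wgeo≤ (1 + κ) (suc d)))
    where
    go : ∀ κ d S K → (2 * (1 + d) + 1) * (1 + d) ≤ 2 * S → K ≤ (1 + d) * S →
      1 + ((2 * (1 + d) + 1) * (1 + d) * ((2 * (1 + d) + 1) * (1 + d)) + κ * (2 * (1 + d) + 1) * K) ≤ (1 + (2 + κ) * S) * ((2 * (1 + d) + 1) * (1 + d))
    go κ d S K h₁ h₂ = linarith (2 + 5 * d + 2 * d * d) ((3 + 5 * d + 2 * d * d) ⊗ h₁ ⊕ (κ * (2 * (1 + d) + 1)) ⊗ h₂) (solve (κ ∷ d ∷ S ∷ K ∷ []))

  -- For large d the inequality for girth 2d + 1 already excludes the whole range up to the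
  -- vertex for girth 2d + 2.
  large-even : ∀ κ d n s S K → 1 ≤ d → (2 * d + 2) * d ≤ n → s ≤ κ * (2 * d + 2) → (d + 1) * (2 * d + 1) ≤ S → K ≤ d * S →
    (1 + (2 + κ) * S) * n ≤ n * n + s * K → (2 + κ) * (2 * (1 + (1 + κ) * S)) + s ≤ 2 * (2 + κ) * n
  large-even κ d n s S K 1≤d N≤n s≤ d≤S K≤ h = ≮⇒≥ λ lt →
    let p , e = m≤n⇒∃[o]m+o≡n N≤n ; r , e′ = m≤n⇒∃[o]m+o≡n (below lt)
        M≡ = trans (sym e′) (cong (λ n → n + (2 * d + 2) * d + r) (sym e))
    in clash κ S ((2 * d + 2) * d) p r
         (subst₂ (λ M n → M * n ≤ n * n + κ * ((2 * d + 2) * d) * S) M≡ (sym e) (≤-trans h (+-monoʳ-≤ (n * n) sK≤)))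
         (≤-reflexive M≡) (small d S d≤S) (*-mono-≤ {1} {2 * d + 2} {1} {d} (≤-trans (s≤s z≤n) (m≤n+m 2 (2 * d))) 1≤d)
    where
    sK≤ : s * K ≤ κ * ((2 * d + 2) * d) * S
    sK≤ = ≤-trans (*-mono-≤ s≤ K≤) (≤-reflexive (assoc κ d S))
      where
      assoc : ∀ κ d S → κ * (2 * d + 2) * (d * S) ≡ κ * ((2 * d + 2) * d) * S
      assoc = solve-∀
    below : 2 * (2 + κ) * n < (2 + κ) * (2 * (1 + (1 + κ) * S)) + s → n + (2 * d + 2) * d ≤ 1 + (2 + κ) * S
    below lt = ≮⇒≥ λ gt → cancel κ d n s S lt s≤ d≤S gt
      where
      cancel : ∀ κ d n s S → 1 + 2 * (2 + κ) * n ≤ (2 + κ) * (2 * (1 + (1 + κ) * S)) + s → s ≤ κ * (2 * d + 2) →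
        (d + 1) * (2 * d + 1) ≤ S → 1 + (1 + (2 + κ) * S) ≤ n + (2 * d + 2) * d → ⊥
      cancel κ d n s S h₁ h₂ h₃ h₄ = impossible (2 * (2 + κ) + 4 * (1 + d)) (h₁ ⊕ h₂ ⊕ (2 * (2 + κ)) ⊗ h₃ ⊕ (2 * (2 + κ)) ⊗ h₄)
        (solve (κ ∷ d ∷ n ∷ s ∷ S ∷ []))
    clash : ∀ κ S N p r → (N + p + N + r) * (N + p) ≤ (N + p) * (N + p) + κ * N * S → 1 + (2 + κ) * S ≤ N + p + N + r →
      N ≤ 2 * S → 1 ≤ N → ⊥
    clash κ S N p r h₁ h₂ h₃ h₄ = impossible (p * r) (h₁ ⊕ N ⊗ h₂ ⊕ N ⊗ h₃ ⊕ h₄) (solve (κ ∷ S ∷ N ∷ p ∷ r ∷ []))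
    small : ∀ d S → (d + 1) * (2 * d + 1) ≤ S → (2 * d + 2) * d ≤ 2 * S
    small d S h = linarith (2 + 4 * d + 2 * d * d) (2 ⊗ h) (solve (d ∷ S ∷ []))

-- The choice of the lower bound N for every k and g

geo-mono : ∀ {x y} d → x ≤ y → geo x d ≤ geo y d
geo-mono zero h = z≤n
geo-mono (suc d) h = s≤s (*-mono-≤ h (geo-mono d h))

abstract
  geo-large : ∀ x d₀ e → 2 ≤ x → 2 ≤ d₀ → (d₀ + 1) * (2 * d₀ + 1) ≤ geo x d₀ → (d₀ + e + 1) * (2 * (d₀ + e) + 1) ≤ geo x (d₀ + e)
  geo-large x d₀ zero _ _ h = subst (λ d → (d + 1) * (2 * d + 1) ≤ geo x d) (sym (+-identityʳ d₀)) h
  geo-large x d₀ (suc e) 2≤x 2≤d₀ h = subst (λ d → (d + 1) * (2 * d + 1) ≤ geo x d) (sym (+-suc d₀ e))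
    (step (d₀ + e) (geo x (d₀ + e)) (x * geo x (d₀ + e)) (≤-trans 2≤d₀ (m≤m+n d₀ e)) (geo-large x d₀ e 2≤x 2≤d₀ h) (*-monoˡ-≤ (geo x (d₀ + e)) 2≤x))
    where
    step : ∀ d S xS → 2 ≤ d → (d + 1) * (2 * d + 1) ≤ S → 2 * S ≤ xS → (1 + d + 1) * (2 * (1 + d) + 1) ≤ 1 + xS
    step (suc (suc d)) S xS _ h₁ h₂ = go d S xS h₁ h₂
      where
      go : ∀ d S xS → (2 + d + 1) * (2 * (2 + d) + 1) ≤ S → 2 * S ≤ xS → (1 + (2 + d) + 1) * (2 * (1 + (2 + d)) + 1) ≤ 1 + xS
      go d S xS h₁ h₂ = linarith (3 + 7 * d + 2 * d * d) (2 ⊗ h₁ ⊕ h₂) (solve (d ∷ S ∷ xS ∷ []))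
    step (suc zero) _ _ (s≤s ()) _ _

Q-pow : ∀ k g j → k ^ j * g ≤ 2 ^ j * Q k g j
Q-pow k g zero = ≤-refl
Q-pow k g (suc j) = go k (k ^ j) (2 ^ j) g (Q k g j) (Q k g (suc j)) (Q-pow k g j) (≤2*⌈/2⌉ (k * Q k g j + 1))
  where
  go : ∀ k kj tj g q q′ → kj * g ≤ tj * q → k * q + 1 ≤ 2 * q′ → k * kj * g ≤ 2 * tj * q′
  go k kj tj g q q′ h₁ h₂ = linarith tj (k ⊗ h₁ ⊕ tj ⊗ h₂) (solve (k ∷ kj ∷ tj ∷ g ∷ q ∷ q′ ∷ []))

Q-base : ∀ k g j {m} → 2 ^ j * m ≤ k ^ j → m * g ≤ Q k g j
Q-base k g j {m} h = *-cancelˡ-≤ (2 ^ j) {{m^n≢0 2 j}} (≤-trans (≤-reflexive (sym (*-assoc (2 ^ j) m g))) (≤-trans (*-monoˡ-≤ g h) (Q-pow k g j)))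

-- A radius step multiplies Q by at least 3/2, which for c ≥ 5 is more than adding 2 g. It costs 4
-- in the girth, that is 2 in d, so Q keeps pace with g d.
Q-linear : ∀ k g j₀ c e → 3 ≤ k → 5 ≤ c → c * g ≤ Q k g j₀ → (c + 2 * e) * g ≤ Q k g (j₀ + e)
Q-linear k g j₀ c zero _ _ h rewrite +-identityʳ j₀ | +-identityʳ c = h
Q-linear k g j₀ c (suc e) 3≤k 5≤c h rewrite +-suc j₀ e =
  *-cancelˡ-≤ 2 (≤-trans (step c e g (Q k g (j₀ + e)) 5≤c (Q-linear k g j₀ c e 3≤k 5≤c h))
    (≤-trans (*-monoˡ-≤ (Q k g (j₀ + e)) 3≤k) (≤-trans (m≤m+n _ 1) (≤2*⌈/2⌉ (k * Q k g (j₀ + e) + 1)))))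
  where
  step : ∀ c e g q → 5 ≤ c → (c + 2 * e) * g ≤ q → 2 * ((c + 2 * (1 + e)) * g) ≤ 3 * q
  step c e g q h₁ h₂ = linarith (g + 2 * e * g) (g ⊗ h₁ ⊕ 3 ⊗ h₂) (solve (c ∷ e ∷ g ∷ q ∷ []))

half : ∀ m → ∃ λ e → 2 * e ≤ m × m ≤ 2 * e + 1
half zero = 0 , z≤n , z≤n
half (suc zero) = 0 , z≤n , ≤-refl
half (suc (suc m)) = let e , p , q = half m in
  suc e , ≤-trans (≤-reflexive (*-suc 2 e)) (s≤s (s≤s p)) , ≤-trans (s≤s (s≤s q)) (≤-reflexive (cong (_+ 1) (sym (*-suc 2 e))))

abstract
  large-girth : ∀ j e d g → 2 * suc j + 2 * e ≤ d → 2 * d < g → 4 * suc (j + e) < g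
  large-girth j e d g h₁ h₂ = linarith 0 (2 ⊗ h₁ ⊕ h₂) (solve (j ∷ e ∷ d ∷ g ∷ []))

  large-girth-cubic : ∀ j e d g → 2 * suc (suc j) + 2 * e ≤ d → 2 * d < g → 4 * suc (suc (j + e)) < g
  large-girth-cubic j e d g h₁ h₂ = linarith 0 (2 ⊗ h₁ ⊕ h₂) (solve (j ∷ e ∷ d ∷ g ∷ []))

large-Q : ∀ k d₀ j₀ g d e → 3 ≤ k → 4 ≤ d₀ → (suc d₀) * g ≤ Q k g j₀ → d ≤ d₀ + (2 * e + 1) → g * d ≤ Q k g (j₀ + e)
large-Q k d₀ j₀ g d e 3≤k 4≤d₀ base h = ≤-trans (≤-reflexive (*-comm g d))
  (≤-trans (*-monoˡ-≤ g (≤-trans h (≤-reflexive (go d₀ e)))) (Q-linear k g j₀ (suc d₀) e 3≤k (s≤s 4≤d₀) base))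
  where
  go : ∀ d₀ e → d₀ + (2 * e + 1) ≡ suc d₀ + 2 * e
  go = solve-∀

-- The input of `large-odd` and `large-even`, with N = g d; the quantifier over g covers g = 2 d + 1
-- and g = 2 d + 2 at once.
Large : ℕ → ℕ → Set
Large κ d = (∀ g → 2 * d < g → Bound κ g (g * d)) × (d + 1) * (2 * d + 1) ≤ geo (1 + κ) d

-- At d₀ = 2 (j + 1) the j + 1 possible growth steps give the factor (k/2)^(j + 1). It must reach d₀
-- + 1, not only d₀, to cover the odd remainder of `half`.
large-generic : ∀ κ j → 2 ≤ κ → 3 ≤ κ ⊎ 3 ≤ suc j → 2 ≤ suc j → 2 ^ suc j * suc (2 * suc j) ≤ (2 + κ) ^ suc j →
  (2 * suc j + 1) * (2 * (2 * suc j) + 1) ≤ geo (1 + κ) (2 * suc j) → ∀ d → 2 * suc j ≤ d → Large κ d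
large-generic κ j 2≤κ ok 2≤j pow S≤ d d₀≤d with m≤n⇒∃[o]m+o≡n d₀≤d
... | m , refl = let e , p , q = half m in
  (λ g 2d<g → generic (j + e) 2≤κ (six g 2d<g ok) (large-girth j e d g (+-monoʳ-≤ (2 * suc j) p) 2d<g)
    (inj₂ (large-Q (2 + κ) (2 * suc j) (suc j) g d e (s≤s (s≤s (≤-trans (s≤s z≤n) 2≤κ))) (*-monoʳ-≤ 2 2≤j)
      (Q-base (2 + κ) g (suc j) pow) (+-monoʳ-≤ (2 * suc j) q)))) ,
  geo-large (1 + κ) (2 * suc j) m (s≤s (≤-trans (s≤s z≤n) 2≤κ)) (*-monoʳ-≤ 2 (≤-trans (s≤s z≤n) 2≤j)) S≤
  where
  six : ∀ g → 2 * (2 * suc j + m) < g → 3 ≤ κ ⊎ 3 ≤ suc j → 3 ≤ κ ⊎ 6 ≤ g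
  six g lt (inj₁ h) = inj₁ h
  six g lt (inj₂ h) = inj₂ (≤-trans (*-monoʳ-≤ 2 h) (≤-trans (m≤m+n _ m) (≤-trans (m≤n*m (2 * suc j + m) 2) (<⇒≤ lt))))

large-cubic : ∀ j → 2 ^ suc j * suc (2 * suc (suc j)) ≤ 3 ^ suc j →
  (2 * suc (suc j) + 1) * (2 * (2 * suc (suc j)) + 1) ≤ geo 2 (2 * suc (suc j)) → ∀ d → 2 * suc (suc j) ≤ d → Large 1 d
large-cubic j pow S≤ d d₀≤d with m≤n⇒∃[o]m+o≡n d₀≤d
... | m , refl = let e , p , q = half m in
  (λ g 2d<g → cubic (j + e) (large-girth-cubic j e d g (+-monoʳ-≤ (2 * suc (suc j)) p) 2d<g)
    (inj₂ (large-Q 3 (2 * suc (suc j)) (suc j) g d e ≤-refl (*-monoʳ-≤ 2 {2} {2 + j} (s≤s (s≤s z≤n))) (Q-base 3 g (suc j) pow)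
      (+-monoʳ-≤ (2 * suc (suc j)) q)))) ,
  geo-large 2 (2 * suc (suc j)) m ≤-refl (*-monoʳ-≤ 2 {1} {2 + j} (s≤s z≤n)) S≤

-- The least j with (3/2)^j ≥ 2 j + 3 is 7, narrowly: 17 · 2⁷ = 2176 and 3⁷ = 2187. This makes 16
-- the threshold.
large-3 : ∀ d → 16 ≤ d → Large 1 d
large-3 = large-cubic 6 (≤ᵇ⇒≤ (2 ^ 7 * 17) (3 ^ 7) _) (≤ᵇ⇒≤ (17 * 33) (geo 2 16) _)

large-4 : ∀ d → 6 ≤ d → Large 2 d
large-4 = large-generic 2 2 ≤-refl (inj₂ ≤-refl) (≤ᵇ⇒≤ 2 3 _) (≤ᵇ⇒≤ (8 * 7) (4 ^ 3) _) (≤ᵇ⇒≤ (7 * 13) (geo 3 6) _)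

large-5 : ∀ d → 4 ≤ d → Large 3 d
large-5 = large-generic 3 1 (≤ᵇ⇒≤ 2 3 _) (inj₁ ≤-refl) ≤-refl (≤ᵇ⇒≤ (4 * 5) (5 ^ 2) _) (≤ᵇ⇒≤ (5 * 9) (geo 4 4) _)

bound-d≤3 : ∀ κ d g → 4 ≤ κ → d ≤ 3 → 4 < g → Bound κ g (g * d)
bound-d≤3 κ d g 4≤κ d≤3 4<g = generic 0 (≤-trans (≤ᵇ⇒≤ 2 4 _) 4≤κ) (inj₁ (≤-trans (≤ᵇ⇒≤ 3 4 _) 4≤κ)) 4<g
  (inj₂ (≤-trans (≤-reflexive (*-comm g d)) (Q-base (2 + κ) g 1 {d} (≤-trans (*-monoʳ-≤ 2 d≤3) (≤-trans (s≤s (s≤s 4≤κ)) (≤-reflexive (sym (*-identityʳ (2 + κ)))))))))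

large-6+ : ∀ κ d → 4 ≤ κ → 3 ≤ d → Large κ d
large-6+ κ d 4≤κ 3≤d with m≤n⇒m<n∨m≡n 3≤d
... | inj₂ refl = (λ g 6<g → bound-d≤3 κ 3 g 4≤κ ≤-refl (≤-trans (≤ᵇ⇒≤ 5 7 _) 6<g)) ,
  ≤-trans (≤ᵇ⇒≤ (4 * 7) (geo 5 3) _) (geo-mono 3 (s≤s 4≤κ))
... | inj₁ 4≤d = large-generic κ 1 (≤-trans (≤ᵇ⇒≤ 2 4 _) 4≤κ) (inj₁ (≤-trans (≤ᵇ⇒≤ 3 4 _) 4≤κ)) ≤-refl
  (≤-trans (≤ᵇ⇒≤ (4 * 5) (6 ^ 2) _) (^-monoˡ-≤ 2 (s≤s (s≤s 4≤κ))))
  (≤-trans (≤ᵇ⇒≤ (5 * 9) (geo 5 4) _) (geo-mono 4 (s≤s 4≤κ))) d 4≤d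

smallN : ℕ → ℕ → ℕ → ℕ
smallN k g j = Q k g (suc j) ⊔ (Q k g j + suc g)

smallN≤ : ∀ k g j → smallN k g j ≤ Q k g j + suc g ⊎ smallN k g j ≤ Q k g (suc j)
smallN≤ k g j with ≤-total (Q k g (suc j)) (Q k g j + suc g)
... | inj₁ h = inj₁ (≤-reflexive (m≤n⇒m⊔n≡n h))
... | inj₂ h = inj₂ (≤-reflexive (m≥n⇒m⊔n≡m h))

critOdd? : ∀ κ d N → Dec (CritOdd κ d N)
critOdd? κ d N = (_ ≤? _) ⊎-dec (_ <? _)

critEven? : ∀ κ d N → Dec (CritEven κ d N)
critEven? κ d N = (_ ≤? _) ⊎-dec ((_ ≤? _) ×-dec (_ <? _))

ChoiceOdd ChoiceEven : ℕ → ℕ → Set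
ChoiceOdd κ d = ∃ λ N → Bound κ (2 * d + 1) N × CritOdd κ d N
ChoiceEven κ d = (∃ λ N → Bound κ (2 * d + 2) N × CritEven κ d N) ⊎ Large κ d

large⇒odd : ∀ κ d → 2 ≤ d → Large κ d → ChoiceOdd κ d
large⇒odd κ d 2≤d (b , S≤) = _ , b (2 * d + 1) (≤-reflexive (sym (+-comm (2 * d) 1))) ,
  large-odd κ d (≤-trans (s≤s z≤n) 2≤d) (≤-trans (≤-reflexive (*-comm (2 * d + 1) d))
    (≤-trans (*-monoˡ-≤ (2 * d + 1) (m≤m+n d 1)) (≤-trans S≤ (m≤n*m _ 2))))

-- Here d = 4 + i, and `⌊ i /2⌋` is the largest radius that the girth condition admits, for both
-- parities. The range d = 4, ..., 15 is bounded above by `large-3`.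
CubicTable : ℕ → Set
CubicTable i =
  (4 * suc (suc ⌊ i /2⌋) < 2 * (4 + i) + 1 × CritOdd 1 (4 + i) (smallN 3 (2 * (4 + i) + 1) ⌊ i /2⌋)) ×
  (4 * suc (suc ⌊ i /2⌋) < 2 * (4 + i) + 2 × CritEven 1 (4 + i) (smallN 3 (2 * (4 + i) + 2) ⌊ i /2⌋))

CubicTable? : ∀ i → Dec (CubicTable i)
CubicTable? i =
  ((4 * suc (suc ⌊ i /2⌋) <? 2 * (4 + i) + 1) ×-dec critOdd? 1 (4 + i) (smallN 3 (2 * (4 + i) + 1) ⌊ i /2⌋)) ×-dec
  ((4 * suc (suc ⌊ i /2⌋) <? 2 * (4 + i) + 2) ×-dec critEven? 1 (4 + i) (smallN 3 (2 * (4 + i) + 2) ⌊ i /2⌋))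

odd-table : ∀ κ c → Set
odd-table κ c = ∀ {i} → i < c → 4 * suc ⌊ suc i /2⌋ < 2 * (3 + i) + 1 × CritOdd κ (3 + i) (smallN (2 + κ) (2 * (3 + i) + 1) ⌊ suc i /2⌋)

even-table : ∀ κ c → Set
even-table κ c = ∀ {i} → i < c → 4 * suc ⌊ i /2⌋ < 2 * (2 + i) + 2 × CritEven κ (2 + i) (smallN (2 + κ) (2 * (2 + i) + 2) ⌊ i /2⌋)

odd-table? : ∀ κ c → Dec (odd-table κ c)
odd-table? κ c = allUpTo? (λ i → (4 * suc ⌊ suc i /2⌋ <? 2 * (3 + i) + 1) ×-dec critOdd? κ (3 + i) (smallN (2 + κ) (2 * (3 + i) + 1) ⌊ suc i /2⌋)) c

even-table? : ∀ κ c → Dec (even-table κ c)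
even-table? κ c = allUpTo? (λ i → (4 * suc ⌊ i /2⌋ <? 2 * (2 + i) + 2) ×-dec critEven? κ (2 + i) (smallN (2 + κ) (2 * (2 + i) + 2) ⌊ i /2⌋)) c

abstract
  cubic-table : ∀ {i} → i < 12 → CubicTable i
  cubic-table = toWitness {a? = allUpTo? CubicTable? 12} _

  odd-table-2 : odd-table 2 3
  odd-table-2 = toWitness {a? = odd-table? 2 3} _

  odd-table-3 : odd-table 3 1
  odd-table-3 = toWitness {a? = odd-table? 3 1} _

  -- The first entry is k = 4, g = 6 with N = 13 = 2 g + 1. For s = 12 one has P(12) = 0, so the 2 g
  -- vertices of an exceptional configuration would not be enough.
  even-table-2 : even-table 2 4
  even-table-2 = toWitness {a? = even-table? 2 4} _

  even-table-3 : even-table 3 2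
  even-table-3 = toWitness {a? = even-table? 3 2} _

  crit-[3,5] : CritOdd 1 2 6
  crit-[3,5] = toWitness {a? = critOdd? 1 2 6} _

  crit-[3,6] : CritEven 1 2 8
  crit-[3,6] = toWitness {a? = critEven? 1 2 8} _

  -- For s = 7 one has P(9) = 2 and P(10) = -1, so 9 would not do.
  crit-[3,7] : CritOdd 1 3 10
  crit-[3,7] = toWitness {a? = critOdd? 1 3 10} _

  crit-[3,8] : CritEven 1 3 15
  crit-[3,8] = toWitness {a? = critEven? 1 3 15} _

  crit-[4,5] : CritOdd 2 2 10
  crit-[4,5] = toWitness {a? = critOdd? 2 2 10} _

  crit-[5,5] : CritOdd 3 2 (smallN 5 5 0)
  crit-[5,5] = toWitness {a? = critOdd? 3 2 (smallN 5 5 0)} _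

from-odd-table : ∀ κ c → 2 ≤ κ → odd-table κ c → ∀ d → 3 ≤ d → d < 3 + c → ChoiceOdd κ d
from-odd-table κ c 2≤κ table d 3≤d d<3+c with m≤n⇒∃[o]m+o≡n 3≤d
... | i , refl = let lt , crit = table (+-cancelˡ-< 3 _ _ d<3+c) in
  _ , generic ⌊ suc i /2⌋ 2≤κ (inj₂ (≤-trans (*-monoʳ-≤ 2 3≤d) (m≤m+n _ 1))) lt (smallN≤ (2 + κ) _ ⌊ suc i /2⌋) , crit

from-even-table : ∀ κ c → 2 ≤ κ → even-table κ c → ∀ d → 2 ≤ d → d < 2 + c → ChoiceEven κ d
from-even-table κ c 2≤κ table d 2≤d d<2+c with m≤n⇒∃[o]m+o≡n 2≤d
... | i , refl = let lt , crit = table (+-cancelˡ-< 2 _ _ d<2+c) in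
  inj₁ (_ , generic ⌊ i /2⌋ 2≤κ (inj₂ (+-monoˡ-≤ 2 (*-monoʳ-≤ 2 2≤d))) lt (smallN≤ (2 + κ) _ ⌊ i /2⌋) , crit)

choose-odd : ∀ κ d → 1 ≤ κ → 2 ≤ d → ChoiceOdd κ d
choose-odd 0 d () _
choose-odd 1 0 _ ()
choose-odd 1 1 _ (s≤s ())
choose-odd 1 2 _ _ = _ , [3,5] , crit-[3,5]
choose-odd 1 3 _ _ = _ , [3,7] , crit-[3,7]
choose-odd 1 (suc (suc (suc (suc i)))) _ 2≤d with i <? 12
... | yes i<12 = let (lt , crit) , _ = cubic-table i<12 in
  _ , cubic ⌊ i /2⌋ lt (smallN≤ 3 _ ⌊ i /2⌋) , crit
... | no i≮12 = large⇒odd 1 (4 + i) 2≤d (large-3 (4 + i) (+-monoʳ-≤ 4 (≮⇒≥ i≮12)))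
choose-odd 2 d _ 2≤d with m≤n⇒m<n∨m≡n 2≤d | d <? 6
... | inj₂ refl | _ = _ , [4,5] , crit-[4,5]
... | inj₁ 3≤d | yes d<6 = from-odd-table 2 3 ≤-refl odd-table-2 d 3≤d d<6
... | inj₁ _ | no d≮6 = large⇒odd 2 d 2≤d (large-4 d (≮⇒≥ d≮6))
choose-odd 3 d _ 2≤d with m≤n⇒m<n∨m≡n 2≤d | d <? 4
... | inj₂ refl | _ = _ , generic 0 (≤ᵇ⇒≤ 2 3 _) (inj₁ ≤-refl) ≤-refl (smallN≤ 5 5 0) , crit-[5,5]
... | inj₁ 3≤d | yes d<4 = from-odd-table 3 1 (≤ᵇ⇒≤ 2 3 _) odd-table-3 d 3≤d d<4
... | inj₁ _ | no d≮4 = large⇒odd 3 d 2≤d (large-5 d (≮⇒≥ d≮4))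
choose-odd κ@(suc (suc (suc (suc _)))) d _ 2≤d with m≤n⇒m<n∨m≡n 2≤d
... | inj₁ 3≤d = large⇒odd κ d 2≤d (large-6+ κ d (s≤s (s≤s (s≤s (s≤s z≤n)))) 3≤d)
... | inj₂ refl = _ , bound-d≤3 κ 2 5 (s≤s (s≤s (s≤s (s≤s z≤n)))) (≤ᵇ⇒≤ 2 3 _) ≤-refl ,
  large-odd κ 2 (s≤s z≤n) (≤-trans (≤ᵇ⇒≤ 10 (2 * geo 5 2) _) (*-monoʳ-≤ 2 (geo-mono {5} {suc κ} 2 (s≤s (s≤s (s≤s (s≤s (s≤s z≤n))))))))

-- For d = 2 the second condition of `Large` would be 15 ≤ k. The first ball has at least 3 k
-- vertices, and this is enough for all k = 6 + κ: the slack is a polynomial in κ with nonnegative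
-- coefficients.
hexagonal : ∀ κ → CritEven (4 + κ) 2 (3 * (6 + κ))
hexagonal κ = inj₂ (small κ , big κ)
  where
  small : ∀ κ → 3 * (6 + κ) ≤ 2 * (1 + (5 + κ) * (1 + (5 + κ) * (1 + (5 + κ) * 0)))
  small κ = linarith (44 + 19 * κ + 2 * κ * κ) (≤-refl {0}) (solve (κ ∷ []))
  big : ∀ κ → let k = 6 + κ ; x = 5 + κ ; N = 3 * (6 + κ) ; M = 2 * (1 + x * (1 + x * (1 + x * 0))) ; σ = (4 + κ) * 6
                  K = x * (x * 0 + (1 + x * 0)) + (1 + x * (1 + x * 0)) in
    1 + (k * N * N + σ * M + 2 * σ * (x * K)) ≤ k * N * M + σ * N
  big κ = linarith (1055 + 1248 * κ + 522 * (κ * κ) + 93 * (κ * κ * κ) + 6 * (κ * κ * κ * κ)) (≤-refl {0}) (solve (κ ∷ []))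

choose-even : ∀ κ d → 1 ≤ κ → 2 ≤ d → ChoiceEven κ d
choose-even 0 d () _
choose-even 1 0 _ ()
choose-even 1 1 _ (s≤s ())
choose-even 1 2 _ _ = inj₁ (_ , [3,6] , crit-[3,6])
choose-even 1 3 _ _ = inj₁ (_ , [3,8] , crit-[3,8])
choose-even 1 (suc (suc (suc (suc i)))) _ 2≤d with i <? 12
... | yes i<12 = let _ , lt , crit = cubic-table i<12 in
  inj₁ (_ , cubic ⌊ i /2⌋ lt (smallN≤ 3 _ ⌊ i /2⌋) , crit)
... | no i≮12 = inj₂ (large-3 (4 + i) (+-monoʳ-≤ 4 (≮⇒≥ i≮12)))
choose-even 2 d _ 2≤d with d <? 6
... | yes d<6 = from-even-table 2 4 ≤-refl even-table-2 d 2≤d d<6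
... | no d≮6 = inj₂ (large-4 d (≮⇒≥ d≮6))
choose-even 3 d _ 2≤d with d <? 4
... | yes d<4 = from-even-table 3 2 (≤ᵇ⇒≤ 2 3 _) even-table-3 d 2≤d d<4
... | no d≮4 = inj₂ (large-5 d (≮⇒≥ d≮4))
choose-even κ@(suc (suc (suc (suc κ′)))) d _ 2≤d with m≤n⇒m<n∨m≡n 2≤d
... | inj₁ 3≤d = inj₂ (large-6+ κ d (s≤s (s≤s (s≤s (s≤s z≤n)))) 3≤d)
... | inj₂ refl = inj₁ (_ , generic 0 (s≤s (s≤s z≤n)) (inj₁ (s≤s (s≤s (s≤s z≤n)))) (≤ᵇ⇒≤ 5 6 _)
  (inj₂ (*-cancelˡ-≤ 2 (≤-trans (≤-reflexive (go κ′)) (≤-trans (m≤m+n ((6 + κ′) * 6) 1) (≤2*⌈/2⌉ ((6 + κ′) * 6 + 1)))))) , hexagonal κ′)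
  where
  go : ∀ κ → 2 * (3 * (6 + κ)) ≡ (6 + κ) * 6
  go = solve-∀

vertex≤n-odd : ∀ κ d n s → 1 ≤ κ → 2 ≤ d → (∀ {N} → Bound κ (2 * d + 1) N → N ≤ n) → s ≤ κ * (2 * d + 1) →
  (1 + (2 + κ) * geo (1 + κ) d) * n ≤ n * n + s * wgeo (1 + κ) d → 1 + (2 + κ) * geo (1 + κ) d ≤ 2 * n
vertex≤n-odd κ d n s 1≤κ 2≤d lower s≤ h = let N , b , crit = choose-odd κ d 1≤κ 2≤d in
  past-vertex-odd n N _ s _ (wgeo (1 + κ) d) (lower b) s≤ h crit

vertex≤n-even : ∀ κ d n s → 1 ≤ κ → 2 ≤ d → (∀ {N} → Bound κ (2 * d + 2) N → N ≤ n) → s ≤ κ * (2 * d + 2) →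
  (1 + (2 + κ) * geo (1 + κ) d) * n ≤ n * n + s * wgeo (1 + κ) d →
  let k = 2 + κ ; x = 1 + κ ; M = 2 * geo x (suc d) in
  (k * M + s) * n ≤ k * n * n + M * s + 2 * s * (x * wgeo x d) → k * M + s ≤ 2 * k * n
vertex≤n-even κ d n s 1≤κ 2≤d lower s≤ odd even with choose-even κ d 1≤κ 2≤d
... | inj₁ (N , b , crit) = past-vertex-even (2 + κ) n N (2 * geo (1 + κ) (suc d)) s _ ((1 + κ) * wgeo (1 + κ) d) (lower b) s≤ even crit
... | inj₂ (b , S≤) = large-even κ d n s (geo (1 + κ) d) (wgeo (1 + κ) d) (≤-trans (s≤s z≤n) 2≤d)
  (lower (b (2 * d + 2) (≤-trans (≤-reflexive (+-comm 1 (2 * d))) (+-monoʳ-≤ (2 * d) (s≤s z≤n))))) s≤ S≤ (wgeo≤ (1 + κ) d) odd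

-- The graph-theoretic input for the given multipole

module Facts {n} (G : Multipole n) (κ g s : ℕ) (1≤κ : 1 ≤ κ) (5≤g : 5 ≤ g) (s≤ : s ≤ κ * g)
  (regular : Regular (2 + κ) G) (girth : GirthAtLeast g G) (semi : semiedges G ≡ s) (nontrivial : Nontrivial (2 + κ) g G) where

  private
    open Extremal G
    open WalkCount G using (A₁; deg)

    regular′ : ∀ v → deg v + sem G v ≡ 2 + κ
    regular′ v = trans (sym (degree≡ v)) (regular v)

    ∑sem : ∑ (sem G) ≡ s
    ∑sem = trans (sym (sum≡∑ (sem G))) semi

    A₁+s : A₁ + s ≡ (2 + κ) * n
    A₁+s = trans (cong (A₁ +_) (sym ∑sem)) (WalkCount.A₁+s G (1 + κ) regular′)

  -- The set of all vertices qualifies: s ≤ κ g half-edges leave it and, by nontriviality, it has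
  -- more than g vertices.
  lower : ∀ {N} → Bound κ g N → N ≤ n
  lower {N} b = subst (N ≤_) size-full (dense⇒N≤size 1≤κ 5≤g girth b full
    (subst (g <_) (sym size-full) (nontrivial⇒g<n 5≤g regular girth nontrivial))
    (subst₂ (λ m e → (2 + κ) * m ≤ κ * g + e) (sym size-full) (sym arcs-full)
      (≤-trans (≤-reflexive (sym A₁+s)) (≤-trans (+-monoʳ-≤ A₁ s≤) (≤-reflexive (+-comm A₁ (κ * g)))))))

  -- Asking for `2 * d + 1 ≤ g` and not for equality makes this available for g = 2 d + 2, where
  -- `large-even` relies on it.
  P≥0-odd : ∀ d → 1 ≤ d → 2 * d + 1 ≤ g → (1 + (2 + κ) * geo (1 + κ) d) * n ≤ n * n + s * wgeo (1 + κ) d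
  P≥0-odd (suc d) _ h = ≤-trans (≤-reflexive (go (2 + κ) (geo (1 + κ) (suc d)) n))
    (subst (λ s → n + (2 + κ) * n * geo (1 + κ) (suc d) ≤ n * n + s * wgeo (1 + κ) (suc d)) ∑sem
      (WalkCount.odd-ineq G (1 + κ) regular′ d girth h))
    where
    go : ∀ k S n → (1 + k * S) * n ≡ n + k * n * S
    go = solve-∀

  P≥0-even : ∀ d → 2 * d + 2 ≤ g → let k = 2 + κ ; x = 1 + κ ; M = 2 * geo x (suc d) in
    (k * M + s) * n ≤ k * n * n + M * s + 2 * s * (x * wgeo x d)
  P≥0-even d h = go (2 + κ) (1 + κ) A₁ n s (geo (1 + κ) (suc d)) (wgeo (1 + κ) d)
    (subst (λ s → 2 * A₁ * geo (1 + κ) (suc d) ≤ n * A₁ + 2 * (s * (1 + κ) * wgeo (1 + κ) d)) ∑sem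
      (WalkCount.even-ineq G (1 + κ) regular′ d girth h)) (≤-reflexive A₁+s) (≤-reflexive (sym A₁+s))
    where
    go : ∀ k x A n s S K → 2 * A * S ≤ n * A + 2 * (s * x * K) → A + s ≤ k * n → k * n ≤ A + s →
      (k * (2 * S) + s) * n ≤ k * n * n + 2 * S * s + 2 * s * (x * K)
    go k x A n s S K h₁ h₂ h₃ = linarith 0 (h₁ ⊕ n ⊗ h₂ ⊕ (2 * S) ⊗ h₃) (solve (k ∷ x ∷ A ∷ n ∷ s ∷ S ∷ K ∷ []))

pow-geo : ∀ κ d → (1 + κ) ^ d ≡ 1 + κ * geo (1 + κ) d
pow-geo κ zero = cong suc (sym (*-zeroʳ κ))
pow-geo κ (suc d) = trans (cong ((1 + κ) *_) (pow-geo κ d)) (go κ (geo (1 + κ) d))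
  where
  go : ∀ κ S → (1 + κ) * (1 + κ * S) ≡ 1 + κ * (1 + (1 + κ) * S)
  go = solve-∀

-- The closed form behind the constant term of P: as d k - 2 d - 1 = d κ - 1, the numerator (d κ -
-- 1)(k - 1)ᵈ + 1 equals κ² `wgeo`. The terms are arranged to avoid subtraction.
pow-wgeo : ∀ κ d → d * κ * (1 + κ) ^ d + 1 ≡ κ * κ * wgeo (1 + κ) d + (1 + κ) ^ d
pow-wgeo κ zero = sym (cong (_+ 1) (*-zeroʳ (κ * κ)))
pow-wgeo κ (suc d) = +-cancelʳ-≡ κ _ _ (trans (sym (left κ d X)) (trans (cong₂ (λ i j → (1 + κ) * i + κ * j) (pow-wgeo κ d) e)
  (right κ X (wgeo (1 + κ) d) (geo (1 + κ) (suc d)))))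
  where
  X = (1 + κ) ^ d
  e : (1 + κ) ^ suc d ≡ 1 + κ * geo (1 + κ) (suc d)
  e = pow-geo κ (suc d)
  left : ∀ κ d X → (1 + κ) * (d * κ * X + 1) + κ * ((1 + κ) * X) ≡ (1 + d) * κ * ((1 + κ) * X) + 1 + κ
  left = solve-∀
  right : ∀ κ X K S → (1 + κ) * (κ * κ * K + X) + κ * (1 + κ * S) ≡ κ * κ * ((1 + κ) * K + S) + (1 + κ) * X + κ
  right = solve-∀

-- Rational arithmetic

frac≃ : ∀ a b c d → zq a ℤ.* zq (suc d) ≡ zq c ℤ.* zq (suc b) → frac (zq a) (suc b) ≡ frac (zq c) (suc d)
frac≃ a b c d e = ℚP.fromℚᵘ-cong {mkℚᵘ (zq a) b} {mkℚᵘ (zq c) d} (*≡* e)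

fromℚᵘ-+ : ∀ p q → fromℚᵘ p ℚ.+ fromℚᵘ q ≡ fromℚᵘ (p ℚᵘ.+ q)
fromℚᵘ-+ p q = ℚP.toℚᵘ-injective (ℚᵘP.≃-trans (ℚP.toℚᵘ-homo-+ (fromℚᵘ p) (fromℚᵘ q))
  (ℚᵘP.≃-trans (ℚᵘP.+-cong (ℚP.toℚᵘ-fromℚᵘ p) (ℚP.toℚᵘ-fromℚᵘ q)) (ℚᵘP.≃-sym (ℚP.toℚᵘ-fromℚᵘ (p ℚᵘ.+ q)))))

fromℚᵘ-* : ∀ p q → fromℚᵘ p ℚ.* fromℚᵘ q ≡ fromℚᵘ (p ℚᵘ.* q)
fromℚᵘ-* p q = ℚP.toℚᵘ-injective (ℚᵘP.≃-trans (ℚP.toℚᵘ-homo-* (fromℚᵘ p) (fromℚᵘ q))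
  (ℚᵘP.≃-trans (ℚᵘP.*-cong (ℚP.toℚᵘ-fromℚᵘ p) (ℚP.toℚᵘ-fromℚᵘ q)) (ℚᵘP.≃-sym (ℚP.toℚᵘ-fromℚᵘ (p ℚᵘ.* q)))))

fromℚᵘ-mono : ∀ {p q} → p ℚᵘ.≤ q → fromℚᵘ p ℚ.≤ fromℚᵘ q
fromℚᵘ-mono {p} {q} h = ℚP.toℚᵘ-cancel-≤ (ℚᵘP.≤-respˡ-≃ (ℚᵘP.≃-sym (ℚP.toℚᵘ-fromℚᵘ p)) (ℚᵘP.≤-respʳ-≃ (ℚᵘP.≃-sym (ℚP.toℚᵘ-fromℚᵘ q)) h))

frac-+ : ∀ a b c d → frac (zq a) (suc b) ℚ.+ frac (zq c) (suc d) ≡ frac (zq (a * suc d + c * suc b)) (suc b * suc d)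
frac-+ a b c d = trans (fromℚᵘ-+ (mkℚᵘ (zq a) b) (mkℚᵘ (zq c) d))
  (cong (λ z → frac z (suc b * suc d)) (trans (cong₂ ℤ._+_ (sym (ℤP.pos-* a (suc d))) (sym (ℤP.pos-* c (suc b)))) (sym (ℤP.pos-+ (a * suc d) (c * suc b)))))

frac-* : ∀ a b c d → frac (zq a) (suc b) ℚ.* frac (zq c) (suc d) ≡ frac (zq (a * c)) (suc b * suc d)
frac-* a b c d = trans (fromℚᵘ-* (mkℚᵘ (zq a) b) (mkℚᵘ (zq c) d)) (cong (λ z → frac z (suc b * suc d)) (sym (ℤP.pos-* a c)))

frac-mono : ∀ {a c} b → a ≤ c → frac (zq a) (suc b) ℚ.≤ frac (zq c) (suc b)
frac-mono {a} {c} b h = fromℚᵘ-mono {mkℚᵘ (zq a) b} {mkℚᵘ (zq c) b} (*≤* (ℤP.*-monoʳ-≤-nonNeg (zq (suc b)) (ℤ.+≤+ h)))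

frac-cong : ∀ a b c d → a * suc d ≡ c * suc b → frac (zq a) (suc b) ≡ frac (zq c) (suc d)
frac-cong a b c d e = frac≃ a b c d (trans (sym (ℤP.pos-* a (suc d))) (trans (cong zq e) (ℤP.pos-* c (suc b))))

-- nq as an opaque map, so that type checking does not evaluate the normalisation of fractions.
opaque
  ι : ℕ → ℚ
  ι = nq

  ι≡nq : ∀ m → ι m ≡ nq m
  ι≡nq m = refl

  ι-+ : ∀ a b → ι a ℚ.+ ι b ≡ ι (a + b)
  ι-+ a b = trans (frac-+ a 0 b 0) (cong₂ (λ i j → nq (i + j)) (*-identityʳ a) (*-identityʳ b))

  ι-* : ∀ a b → ι a ℚ.* ι b ≡ ι (a * b)
  ι-* a b = frac-* a 0 b 0

  ι-mono : ∀ {a b} → a ≤ b → ι a ℚ.≤ ι b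
  ι-mono {a} {b} = frac-mono {a} {b} 0

  0≤ι : ∀ m → ℚ.0ℚ ℚ.≤ ι m
  0≤ι m = frac-mono {0} {m} 0 z≤n

  frac-cancel : ∀ m b → frac (zq (suc b * m)) (suc b) ≡ ι m
  frac-cancel m b = frac-cong (suc b * m) b m 0 (trans (*-identityʳ _) (*-comm (suc b) m))

  ι-half : ∀ m → ι m ℚ.* frac (zq 1) 2 ≡ frac (zq m) 2
  ι-half m = trans (frac-* m 0 1 1) (cong (λ i → frac (zq i) 2) (*-identityʳ m))

  double-half : ∀ m → ι 2 ℚ.* frac (zq m) 2 ≡ ι m
  double-half m = trans (frac-* 2 0 m 1) (frac-cancel m 1)

-‿≤ : ∀ {p q r} → p ℚ.≤ r ℚ.+ q → p ℚ.- q ℚ.≤ r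
-‿≤ {p} {q} {r} h = ℚP.≤-trans (ℚP.+-monoˡ-≤ (ℚ.- q) h) (ℚP.≤-reflexive
  (trans (ℚP.+-assoc r q (ℚ.- q)) (trans (cong (r ℚ.+_) (ℚP.+-inverseʳ q)) (ℚP.+-identityʳ r))))

+-cancel-‿ : ∀ p q → (q ℚ.+ p) ℚ.- q ≡ p
+-cancel-‿ p q = trans (cong (ℚ._- q) (ℚP.+-comm q p)) (trans (ℚP.+-assoc p q (ℚ.- q)) (trans (cong (p ℚ.+_) (ℚP.+-inverseʳ q)) (ℚP.+-identityʳ p)))

-- Comparison with the larger root of P

abstract
  square : ∀ a b c n e → b * n ≤ a * n * n + c → b + e ≤ 2 * a * n → 2 * a * n ≤ b + e → b * b ≤ e * e + 4 * a * c
  square a b c n e h h₁ h₂ = linarith 0 ((4 * a) ⊗ h ⊕ (2 * a * n + e) ⊗ h₂ ⊕ b ⊗ h₁) (solve (a ∷ b ∷ c ∷ n ∷ e ∷ []))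

-- Completing the square: with 2 a n = b + e and a n² + c = b n + f one has e² + 4 a c = b² + 4 a f.
above-root : ∀ A B C x v two four a b c n → A ≡ ι a → B ≡ ℚ.- ι b → C ≡ ι c → x ≡ ι n → two ≡ ι 2 → four ≡ ι 4 →
  b ≤ 2 * a * n → b * n ≤ a * n * n + c → v ℚ.≤ x →
  let D = B ℚ.* B ℚ.- four ℚ.* A ℚ.* C ; L = two ℚ.* A ℚ.* x ℚ.+ B in
  (ℚ.0ℚ ℚ.≤ D × ℚ.0ℚ ℚ.≤ L × D ℚ.≤ L ℚ.* L) ⊎ (D ℚ.< ℚ.0ℚ × v ℚ.≤ x)
above-root A B C x v two four a b c n refl refl refl refl refl refl b≤ P≥0 v≤x =
  decide (ℚ.0ℚ ℚ.≤? D) (m≤n⇒∃[o]m+o≡n b≤)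
  where
  D L : ℚ
  D = B ℚ.* B ℚ.- four ℚ.* A ℚ.* C
  L = two ℚ.* A ℚ.* x ℚ.+ B
  D≡ : D ≡ ι (b * b) ℚ.- ι (4 * a * c)
  D≡ = cong₂ ℚ._-_
    (trans (sym (ℚP.neg-distribˡ-* (ι b) (ℚ.- ι b))) (trans (cong ℚ.-_ (sym (ℚP.neg-distribʳ-* (ι b) (ι b))))
      (trans (Algebra.Properties.Group.⁻¹-involutive ℚP.+-0-group (ι b ℚ.* ι b)) (ι-* b b))))
    (trans (cong (ℚ._* ι c) (ι-* 4 a)) (ι-* (4 * a) c))
  decide : Dec (ℚ.0ℚ ℚ.≤ D) → (∃ λ e → b + e ≡ 2 * a * n) → (ℚ.0ℚ ℚ.≤ D × ℚ.0ℚ ℚ.≤ L × D ℚ.≤ L ℚ.* L) ⊎ (D ℚ.< ℚ.0ℚ × v ℚ.≤ x)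
  decide (no D<0) _ = inj₂ (ℚP.≰⇒> D<0 , v≤x)
  decide (yes 0≤D) (e , be) = inj₁ (0≤D , subst (ℚ.0ℚ ℚ.≤_) (sym L≡) (0≤ι e) ,
    subst₂ ℚ._≤_ (sym D≡) (sym (trans (cong₂ ℚ._*_ L≡ L≡) (ι-* e e)))
      (-‿≤ (ℚP.≤-trans (ι-mono (square a b c n e P≥0 (≤-reflexive be) (≤-reflexive (sym be)))) (ℚP.≤-reflexive (sym (ι-+ (e * e) (4 * a * c)))))))
    where
    L≡ : L ≡ ι e
    L≡ = trans (cong (ℚ._- ι b) (trans (cong (ℚ._* ι n) (ι-* 2 a)) (trans (ι-* (2 * a) n) (trans (cong ι (sym be)) (sym (ι-+ b e))))))
      (+-cancel-‿ (ι e) (ι b))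

-- At x = M/2 the linear form 2 A x + B equals a M - b ≤ 0, so its sign settles the case D ≥ 0
-- without any estimate of D.
below-root : ∀ A B C x v two four a b M → A ≡ ι a → B ≡ ℚ.- ι b → two ≡ ι 2 → ι 2 ℚ.* x ≡ ι M → a * M ≤ b → x ℚ.≤ v →
  let D = B ℚ.* B ℚ.- four ℚ.* A ℚ.* C ; L = two ℚ.* A ℚ.* x ℚ.+ B in
  (ℚ.0ℚ ℚ.≤ D × (L ℚ.≤ ℚ.0ℚ ⊎ L ℚ.* L ℚ.≤ D)) ⊎ (D ℚ.< ℚ.0ℚ × x ℚ.≤ v)
below-root A B C x v two four a b M refl refl refl 2x≡M aM≤b x≤v = decide (ℚ.0ℚ ℚ.≤? D)
  where
  D L : ℚ
  D = B ℚ.* B ℚ.- four ℚ.* A ℚ.* C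
  L = two ℚ.* A ℚ.* x ℚ.+ B
  L≡ : two ℚ.* A ℚ.* x ≡ ι (a * M)
  L≡ = trans (cong (ℚ._* x) (ℚP.*-comm (ι 2) (ι a))) (trans (ℚP.*-assoc (ι a) (ι 2) x) (trans (cong (ι a ℚ.*_) 2x≡M) (ι-* a M)))
  decide : Dec (ℚ.0ℚ ℚ.≤ D) → (ℚ.0ℚ ℚ.≤ D × (L ℚ.≤ ℚ.0ℚ ⊎ L ℚ.* L ℚ.≤ D)) ⊎ (D ℚ.< ℚ.0ℚ × x ℚ.≤ v)
  decide (no D<0) = inj₂ (ℚP.≰⇒> D<0 , x≤v)
  decide (yes 0≤D) = inj₁ (0≤D , inj₁ (subst (ℚ._≤ ℚ.0ℚ) (sym (cong (ℚ._- ι b) L≡))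
    (-‿≤ (ℚP.≤-trans (ι-mono aM≤b) (ℚP.≤-reflexive (sym (ℚP.+-identityˡ (ι b))))))))

-- The coefficients of P in terms of geometric sums

zq-^ : ∀ x d → zq x ℤ.^ d ≡ zq (x ^ d)
zq-^ x zero = refl
zq-^ x (suc d) = trans (cong (zq x ℤ.*_) (zq-^ x d)) (sym (ℤP.pos-* x (x ^ d)))

zq-cancel : ∀ m j → zq (m + j) ℤ.- zq j ≡ zq m
zq-cancel m j = trans (cong (ℤ._- zq j) (ℤP.pos-+ m j)) (trans (ℤP.+-assoc (zq m) (zq j) (ℤ.- zq j))
  (trans (cong (λ y → zq m ℤ.+ y) (ℤP.+-inverseʳ (zq j))) (ℤP.+-identityʳ (zq m))))

module Coefficients (κ′ : ℕ) where

  κ k x : ℕ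
  κ = suc κ′
  k = 2 + κ
  x = 1 + κ

  weight : ∀ s d → zq s ℤ.* (zq d ℤ.* zq k ℤ.- zq 2 ℤ.* zq d ℤ.- zq 1) ℤ.* zq x ℤ.^ d ℤ.+ zq s ≡ zq (κ * κ * (s * wgeo x d))
  weight s d = trans (cong (λ y → zq s ℤ.* (zq d ℤ.* zq k ℤ.- zq 2 ℤ.* zq d ℤ.- zq 1) ℤ.* y ℤ.+ zq s) (zq-^ x d))
    (trans (expand (zq s) (zq d) (zq κ) (zq (x ^ d))) (trans (cong (λ y → zq s ℤ.* y ℤ.- zq s ℤ.* zq (x ^ d)) identity)
      (trans (collapse (zq s) (zq (κ * κ * wgeo x d)) (zq (x ^ d)))
        (trans (sym (ℤP.pos-* s (κ * κ * wgeo x d))) (cong zq (swap s (κ * κ) (wgeo x d)))))))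
    where
    expand : ∀ s d κ X → s ℤ.* (d ℤ.* (zq 2 ℤ.+ κ) ℤ.- zq 2 ℤ.* d ℤ.- zq 1) ℤ.* X ℤ.+ s ≡ s ℤ.* (d ℤ.* κ ℤ.* X ℤ.+ zq 1) ℤ.- s ℤ.* X
    expand = ℤSolver.solve-∀
    collapse : ∀ s W X → s ℤ.* (W ℤ.+ X) ℤ.- s ℤ.* X ≡ s ℤ.* W
    collapse = ℤSolver.solve-∀
    swap : ∀ s a b → s * (a * b) ≡ a * (s * b)
    swap = solve-∀
    identity : zq d ℤ.* zq κ ℤ.* zq (x ^ d) ℤ.+ zq 1 ≡ zq (κ * κ * wgeo x d) ℤ.+ zq (x ^ d)
    identity = trans (cong (ℤ._+ zq 1) (trans (cong (ℤ._* zq (x ^ d)) (sym (ℤP.pos-* d κ))) (sym (ℤP.pos-* (d * κ) (x ^ d)))))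
      (trans (sym (ℤP.pos-+ (d * κ * x ^ d) 1)) (trans (cong zq (pow-wgeo κ d)) (ℤP.pos-+ (κ * κ * wgeo x d) (x ^ d))))

  module _ (g : ℕ) (d : ℕ) (d≡ : dOf g ≡ d) where

    -- `moore` with parity and d as arguments: `cong₂` can then replace `odd? g` and `dOf g`, which
    -- do not reduce for a variable g. `coefCAt` serves the constant term in the same way.
    mooreAt : Bool → ℕ → ℚ
    mooreAt b d = if b then frac (zq k ℤ.* zq x ℤ.^ d ℤ.- zq 2) κ else frac (zq 2 ℤ.* zq x ℤ.^ (suc d) ℤ.- zq 2) κ

    coefCAt : ℕ → Bool → ℕ → ℚ
    coefCAt s b d =
      if b
      then frac (zq s ℤ.* (zq d ℤ.* zq k ℤ.- zq 2 ℤ.* zq d ℤ.- zq 1) ℤ.* zq x ℤ.^ d ℤ.+ zq s) (κ * κ)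
      else moore k g ℚ.* nq s ℚ.+
           nq (2 * s) ℚ.* frac ((zq d ℤ.* zq k ℤ.- zq 2 ℤ.* zq d ℤ.- zq 1) ℤ.* zq x ℤ.^ (suc d) ℤ.+ zq x) (κ * κ)

    module Odd (odd≡ : odd? g ≡ true) where

      M : ℕ
      M = 1 + k * geo x d

      moore≡ : moore k g ≡ ι M
      moore≡ = trans (cong₂ mooreAt odd≡ d≡) (trans (cong (λ z → frac z κ) numerator) (frac-cancel M κ′))
        where
        numerator : zq k ℤ.* zq x ℤ.^ d ℤ.- zq 2 ≡ zq (κ * M)
        numerator = trans (cong (λ y → zq k ℤ.* y ℤ.- zq 2) (zq-^ x d)) (trans (cong (ℤ._- zq 2) (sym (ℤP.pos-* k (x ^ d))))
          (trans (cong (λ y → zq (k * y) ℤ.- zq 2) (pow-geo κ d)) (trans (cong (λ y → zq y ℤ.- zq 2) (go κ (geo x d))) (zq-cancel (κ * M) 2))))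
          where
          go : ∀ κ S → (2 + κ) * (1 + κ * S) ≡ κ * (1 + (2 + κ) * S) + 2
          go = solve-∀

      halfMoore≡ : halfMoore k g ≡ frac (zq M) 2
      halfMoore≡ = trans (cong (ℚ._* frac (zq 1) 2) moore≡) (ι-half M)

      module _ (s : ℕ) where

        A≡ : coefA k g s ≡ ι 1
        A≡ = trans (cong (λ b → if b then nq 1 else nq k) odd≡) (sym (ι≡nq 1))

        B≡ : coefB k g s ≡ ℚ.- ι M
        B≡ = trans (cong (λ b → if b then ℚ.- moore k g else ℚ.- (nq k ℚ.* moore k g ℚ.+ nq s)) odd≡) (cong ℚ.-_ moore≡)

        C≡ : coefC k g s ≡ ι (s * wgeo x d)
        C≡ = trans (cong₂ (coefCAt s) odd≡ d≡) (trans (cong (λ z → frac z (κ * κ)) (weight s d)) (frac-cancel (s * wgeo x d) _))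

        vertex≡ : vertexV k g s ≡ halfMoore k g
        vertex≡ = cong (λ b → if b then moore k g ℚ.* frac (zq 1) 2 else moore k g ℚ.* frac (zq 1) 2 ℚ.+ frac (zq s) (2 * k)) odd≡

        vertex≤ : ∀ n → M ≤ 2 * n → vertexV k g s ℚ.≤ nq n
        vertex≤ n h = ℚP.≤-trans (ℚP.≤-reflexive (trans vertex≡ halfMoore≡)) (ℚP.≤-trans (frac-mono {M} {2 * n} 1 h) (ℚP.≤-reflexive (trans (frac-cancel n 1) (ι≡nq n))))

        conclusion : ∀ n → M ≤ 2 * n → M * n ≤ n * n + s * wgeo x d → b₂≤ k g s (nq n) × ≤b₂ k g s (halfMoore k g)
        conclusion n M≤2n P≥0 =
          above-root (coefA k g s) (coefB k g s) (coefC k g s) (nq n) (vertexV k g s) (nq 2) (nq 4) 1 M (s * wgeo x d) n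
            A≡ B≡ C≡ (sym (ι≡nq n)) (sym (ι≡nq 2)) (sym (ι≡nq 4)) M≤2n
            (≤-trans P≥0 (≤-reflexive (cong (λ y → y * n + s * wgeo x d) (sym (*-identityˡ n))))) (vertex≤ n M≤2n) ,
          below-root (coefA k g s) (coefB k g s) (coefC k g s) (halfMoore k g) (vertexV k g s) (nq 2) (nq 4) 1 M M
            A≡ B≡ (sym (ι≡nq 2)) (trans (cong (ι 2 ℚ.*_) halfMoore≡) (double-half M)) (≤-reflexive (*-identityˡ M))
            (ℚP.≤-reflexive (sym vertex≡))

    module Even (odd≡ : odd? g ≡ false) where

      M : ℕ
      M = 2 * geo x (suc d)

      moore≡ : moore k g ≡ ι M
      moore≡ = trans (cong₂ mooreAt odd≡ d≡) (trans (cong (λ z → frac z κ) numerator) (frac-cancel M κ′))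
        where
        numerator : zq 2 ℤ.* zq x ℤ.^ (suc d) ℤ.- zq 2 ≡ zq (κ * M)
        numerator = trans (cong (λ y → zq 2 ℤ.* y ℤ.- zq 2) (zq-^ x (suc d))) (trans (cong (ℤ._- zq 2) (sym (ℤP.pos-* 2 (x ^ suc d))))
          (trans (cong (λ y → zq (2 * y) ℤ.- zq 2) (pow-geo κ (suc d))) (trans (cong (λ y → zq y ℤ.- zq 2) (go κ (geo x (suc d)))) (zq-cancel (κ * M) 2))))
          where
          go : ∀ κ S → 2 * (1 + κ * S) ≡ κ * (2 * S) + 2
          go = solve-∀

      halfMoore≡ : halfMoore k g ≡ frac (zq M) 2
      halfMoore≡ = trans (cong (ℚ._* frac (zq 1) 2) moore≡) (ι-half M)

      module _ (s : ℕ) where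

        b c : ℕ
        b = k * M + s
        c = M * s + 2 * s * (x * wgeo x d)

        A≡ : coefA k g s ≡ ι k
        A≡ = trans (cong (λ b → if b then nq 1 else nq k) odd≡) (sym (ι≡nq k))

        B≡ : coefB k g s ≡ ℚ.- ι b
        B≡ = trans (cong (λ b → if b then ℚ.- moore k g else ℚ.- (nq k ℚ.* moore k g ℚ.+ nq s)) odd≡)
          (cong ℚ.-_ (trans (cong₂ (λ y z → y ℚ.* z ℚ.+ nq s) (sym (ι≡nq k)) moore≡)
            (trans (cong₂ ℚ._+_ (ι-* k M) (sym (ι≡nq s))) (ι-+ (k * M) s))))

        C≡ : coefC k g s ≡ ι c
        C≡ = trans (cong₂ (coefCAt s) odd≡ d≡) (trans (cong₂ (λ y z → y ℚ.* nq s ℚ.+ nq (2 * s) ℚ.* frac z (κ * κ)) moore≡ numerator)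
          (trans (cong₂ ℚ._+_ (trans (cong (ι M ℚ.*_) (sym (ι≡nq s))) (ι-* M s))
              (trans (cong₂ ℚ._*_ (sym (ι≡nq (2 * s))) (frac-cancel (x * wgeo x d) _)) (ι-* (2 * s) (x * wgeo x d))))
            (ι-+ (M * s) (2 * s * (x * wgeo x d)))))
          where
          reorder : ∀ y x X → y ℤ.* (x ℤ.* X) ℤ.+ x ≡ x ℤ.* y ℤ.* X ℤ.+ x
          reorder = ℤSolver.solve-∀
          numerator : (zq d ℤ.* zq k ℤ.- zq 2 ℤ.* zq d ℤ.- zq 1) ℤ.* zq x ℤ.^ (suc d) ℤ.+ zq x ≡ zq (κ * κ * (x * wgeo x d))
          numerator = trans (reorder (zq d ℤ.* zq k ℤ.- zq 2 ℤ.* zq d ℤ.- zq 1) (zq x) (zq x ℤ.^ d)) (weight x d)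

        vertex≡ : vertexV k g s ≡ frac (zq M) 2 ℚ.+ frac (zq s) (2 * k)
        vertex≡ = trans (cong (λ b → if b then moore k g ℚ.* frac (zq 1) 2 else moore k g ℚ.* frac (zq 1) 2 ℚ.+ frac (zq s) (2 * k)) odd≡)
          (cong (ℚ._+ frac (zq s) (2 * k)) halfMoore≡)

        vertex≡′ : vertexV k g s ≡ frac (zq b) (2 * k)
        vertex≡′ = trans vertex≡ (trans (frac-+ M 1 s _) (frac-cong (M * (2 * k) + s * 2) _ b _ (go M k s)))
          where
          go : ∀ M k s → (M * (2 * k) + s * 2) * (2 * k) ≡ (k * M + s) * (2 * (2 * k))
          go = solve-∀

        vertex≤ : ∀ n → b ≤ 2 * k * n → vertexV k g s ℚ.≤ nq n
        vertex≤ n h = ℚP.≤-trans (ℚP.≤-reflexive vertex≡′) (ℚP.≤-trans (frac-mono {b} {2 * k * n} _ h) (ℚP.≤-reflexive (trans (frac-cancel n _) (ι≡nq n))))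

        conclusion : ∀ n → b ≤ 2 * k * n → b * n ≤ k * n * n + M * s + 2 * s * (x * wgeo x d) → b₂≤ k g s (nq n) × ≤b₂ k g s (halfMoore k g)
        conclusion n b≤ P≥0 =
          above-root (coefA k g s) (coefB k g s) (coefC k g s) (nq n) (vertexV k g s) (nq 2) (nq 4) k b c n
            A≡ B≡ C≡ (sym (ι≡nq n)) (sym (ι≡nq 2)) (sym (ι≡nq 4)) b≤
            (≤-trans P≥0 (≤-reflexive (+-assoc (k * n * n) (M * s) _))) (vertex≤ n b≤) ,
          below-root (coefA k g s) (coefB k g s) (coefC k g s) (halfMoore k g) (vertexV k g s) (nq 2) (nq 4) k b M
            A≡ B≡ (sym (ι≡nq 2)) (trans (cong (ι 2 ℚ.*_) halfMoore≡) (double-half M)) (m≤m+n (k * M) s)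
            (ℚP.≤-trans (ℚP.≤-reflexive halfMoore≡)
              (ℚP.≤-trans (ℚP.≤-reflexive (sym (ℚP.+-identityʳ (frac (zq M) 2))))
                (ℚP.≤-trans (ℚP.+-monoʳ-≤ (frac (zq M) 2) nonneg) (ℚP.≤-reflexive (sym vertex≡)))))
          where
          nonneg : ℚ.0ℚ ℚ.≤ frac (zq s) (2 * k)
          nonneg = ℚP.≤-trans (ℚP.≤-reflexive (frac-cong 0 0 0 (pred (2 * k)) refl)) (frac-mono {0} {s} (pred (2 * k)) z≤n)

-- Parity of g and assembly of the theorem

odd?-true : ∀ g → g ℕDiv.% 2 ≡ 1 → odd? g ≡ true
odd?-true g h with g ℕDiv.% 2
odd?-true g refl | .1 = refl

odd?-false : ∀ g → g ℕDiv.% 2 ≡ 0 → odd? g ≡ false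
odd?-false g h with g ℕDiv.% 2
odd?-false g refl | .0 = refl

odd-parity : ∀ d → odd? (2 * d + 1) ≡ true × dOf (2 * d + 1) ≡ d
odd-parity d = odd , trans (cong (λ b → if b then ((2 * d + 1) ∸ 1) ℕDiv./ 2 else ((2 * d + 1) ∸ 2) ℕDiv./ 2) odd)
  (trans (cong (ℕDiv._/ 2) (trans (m+n∸n≡m (2 * d) 1) (*-comm 2 d))) (ℕDiv.m*n/n≡m d 2))
  where
  odd : odd? (2 * d + 1) ≡ true
  odd = odd?-true (2 * d + 1) (trans (cong (ℕDiv._% 2) (trans (+-comm (2 * d) 1) (cong (1 +_) (*-comm 2 d)))) (ℕDiv.[m+kn]%n≡m%n 1 d 2))

even-parity : ∀ d → odd? (2 * d + 2) ≡ false × dOf (2 * d + 2) ≡ d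
even-parity d = even , trans (cong (λ b → if b then ((2 * d + 2) ∸ 1) ℕDiv./ 2 else ((2 * d + 2) ∸ 2) ℕDiv./ 2) even)
  (trans (cong (ℕDiv._/ 2) (trans (m+n∸n≡m (2 * d) 2) (*-comm 2 d))) (ℕDiv.m*n/n≡m d 2))
  where
  even : odd? (2 * d + 2) ≡ false
  even = odd?-false (2 * d + 2) (trans (cong (ℕDiv._% 2) (trans (+-comm (2 * d) 2) (cong (2 +_) (*-comm 2 d)))) (ℕDiv.[m+kn]%n≡m%n 2 d 2))

odd-or-even : ∀ g → 5 ≤ g → ∃ λ d → 2 ≤ d × (g ≡ 2 * d + 1 ⊎ g ≡ 2 * d + 2)
odd-or-even g 5≤g with half g
... | suc e , 2e≤g , g≤2e+1 with m≤n⇒m<n∨m≡n g≤2e+1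
... | inj₂ g≡ = suc e , two (suc e) (≤-trans 5≤g g≤2e+1) , inj₁ g≡
  where
  two : ∀ d → 5 ≤ 2 * d + 1 → 2 ≤ d
  two d h = *-cancelˡ-≤ 2 (+-cancelʳ-≤ 1 4 (2 * d) h)
... | inj₁ g<2e+1 = e , two e (subst (5 ≤_) g≡ 5≤g) , inj₂ g≡
  where
  g≡ : g ≡ 2 * e + 2
  g≡ = trans (≤-antisym (s≤s⁻¹ (≤-trans g<2e+1 (≤-reflexive (+-comm _ 1)))) 2e≤g) (trans (*-suc 2 e) (+-comm 2 (2 * e)))
  two : ∀ e → 5 ≤ 2 * e + 2 → 2 ≤ e
  two zero (s≤s (s≤s ()))
  two (suc zero) (s≤s (s≤s (s≤s (s≤s ()))))
  two (suc (suc e)) _ = s≤s (s≤s z≤n)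
odd-or-even g 5≤g | zero , _ , g≤1 = contradiction (≤-trans 5≤g g≤1) λ { (s≤s ()) }

module _ {n} (G : Multipole n) (κ′ g s : ℕ) (5≤g : 5 ≤ g) (s≤ : s ≤ suc κ′ * g)
  (regular : Regular (3 + κ′) G) (girth : GirthAtLeast g G) (semi : semiedges G ≡ s) (nontrivial : Nontrivial (3 + κ′) g G) where

  private
    κ = suc κ′
    open Facts G κ g s (s≤s z≤n) 5≤g s≤ regular girth semi nontrivial
    open Coefficients κ′ using (module Odd; module Even)

  bound-odd : ∀ d → 2 ≤ d → g ≡ 2 * d + 1 → b₂≤ (2 + κ) g s (nq n) × ≤b₂ (2 + κ) g s (halfMoore (2 + κ) g)
  bound-odd d 2≤d g≡ = Odd.conclusion g d (trans (cong dOf g≡) (proj₂ (odd-parity d))) (trans (cong odd? g≡) (proj₁ (odd-parity d))) s n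
    (vertex≤n-odd κ d n s (s≤s z≤n) 2≤d (λ {N} b → lower (subst (λ g → Bound κ g N) (sym g≡) b)) (subst (λ g → s ≤ κ * g) g≡ s≤) P≥0) P≥0
    where
    P≥0 = P≥0-odd d (≤-trans (s≤s z≤n) 2≤d) (≤-reflexive (sym g≡))

  bound-even : ∀ d → 2 ≤ d → g ≡ 2 * d + 2 → b₂≤ (2 + κ) g s (nq n) × ≤b₂ (2 + κ) g s (halfMoore (2 + κ) g)
  bound-even d 2≤d g≡ = Even.conclusion g d (trans (cong dOf g≡) (proj₂ (even-parity d))) (trans (cong odd? g≡) (proj₁ (even-parity d))) s n
    (vertex≤n-even κ d n s (s≤s z≤n) 2≤d (λ {N} b → lower (subst (λ g → Bound κ g N) (sym g≡) b)) (subst (λ g → s ≤ κ * g) g≡ s≤)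
      (P≥0-odd d (≤-trans (s≤s z≤n) 2≤d) (≤-trans (+-monoʳ-≤ (2 * d) (n≤1+n 1)) (≤-reflexive (sym g≡)))) P≥0) P≥0
    where
    P≥0 = P≥0-even d (≤-reflexive (sym g≡))

  b₂-bounds : (∃ λ d → 2 ≤ d × (g ≡ 2 * d + 1 ⊎ g ≡ 2 * d + 2)) → b₂≤ (2 + κ) g s (nq n) × ≤b₂ (2 + κ) g s (halfMoore (2 + κ) g)
  b₂-bounds (d , 2≤d , inj₁ g≡) = bound-odd d 2≤d g≡
  b₂-bounds (d , 2≤d , inj₂ g≡) = bound-even d 2≤d g≡

theorem1 : (k g s : ℕ) → 3 ≤ k → 5 ≤ g → s ≤ (k ∸ 2) * g →
    {n : ℕ} (G : Multipole n) → IsMultipole k g s G → Nontrivial k g G →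
    b₂≤ k g s (nq (order G)) × ≤b₂ k g s (halfMoore k g)
theorem1 (suc (suc (suc κ′))) g s _ 5≤g s≤ G (regular , girth , semi) nontrivial =
  b₂-bounds G κ′ g s 5≤g s≤ regular girth semi nontrivial (odd-or-even g 5≤g)
theorem1 zero _ _ ()
theorem1 (suc zero) _ _ (s≤s ())
theorem1 (suc (suc zero)) _ _ (s≤s (s≤s ()))
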